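{- For rational $N>1/4$ let $\mathcal{E}_N$ be the elliptic curve over $\mathbb{Q}$ given by $v^2=u^3+2(2N^2+2N-1)u^2-(4N-1)u$, and let $T_6^+=(1-4N,\,2N(4N-1))\in\mathcal{E}_N(\mathbb{Q})$. (i) If $N=m^2+1$ for a rational number $m>1$, then the rank of $\mathcal{E}_N$ is positive, with a non-torsion point $$P=\left(\frac{1}{m^2},\ \frac{3m^2+1}{m^3}\right)$$ such that the point $$-P-T_6^+=\left(-\frac{(4m^2+3)(m+1)^2}{(2m^2-m+1)^2},\ \frac{2(m+1)(4m^2+3)(m^2+1)(2m^3+m^2+2m-1)}{(2m^2-m+1)^3}\right)$$ leads to the triangle with sides $$f=(m-1)(2m^2+m+1)^2,\quad g=(m+1)(2m^2-m+1)^2,\quad h=4m(m^2+1).$$ (ii) If $N=m^2-1>1/4$ for a rational number $m>1$, then the rank of $\mathcal{E}_N$ is positive, with a non-torsion point $$P=\left(\frac{1}{m^2},\ \frac{m^2-1}{m^3}\right)$$ such that the point $$-P-T_6^+=\left(-\frac{4m^2-5}{(2m-1)^2},\ \frac{2(m-1)(4m^2-5)(2m^2+m+1)}{(2m-1)^3}\right)$$ leads to the triangle with sides $$f=(m-1)(2m+1)^2,\quad g=(m+1)(2m-1)^2,\quad h=4m.$$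
   Context: The rank of $\mathcal{E}_N$ is the rank of the group $\mathcal{E}_N(\mathbb{Q})$, with the usual group law having the point at infinity as neutral element. A rational point $(u,v)$ on $\mathcal{E}_N$ "leads to" the triangle with sides $f,g,h$ if, setting $$x=-\frac{4N(v+2Nu)}{(u-1)(u+4N-1)},$$ $$A_1=-x^2-2(2N-1)x+4N,\qquad A_2=-x^2+2(2N+1)x-4N,$$ $$B=x^4+4(2N-1)x^3+4(4N^2-2N+1)x^2-32N^2x+16N^2,$$ one has, for some positive rational $s$ (i.e. up to scaling), $$f=\frac{s}{2x}(A_1-\sqrt{B}),\quad g=sx,\quad h=\frac{s}{2x}(A_2+\sqrt{B})$$ (with $\sqrt{B}$ the non-negative square root), and $f,g,h$ are the side lengths of a non-degenerate triangle with $R/r=N$, where $R$ is its circumradius and $r$ is the radius of the excircle touching the side $h$ from outside; explicitly $\frac{R}{r}=\frac{2fgh}{(f+g+h)(f-g-h)(g-h-f)}$. -}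

module Defs where

open import Algebra.Bundles.Raw using (RawGroup)
import Algebra.Definitions.RawMonoid as RawMonoidDefs
import Algebra.Definitions.RawSemiring as RawSemiringDefs
open import Algebra.Properties.Group using (x∙y⁻¹≈ε⇒x≈y)
open import Data.Empty using (⊥)
open import Data.Integer.Base as ℤ using (ℤ; 0ℤ)
open import Data.Nat.Base as ℕ using (ℕ)
import Data.Nat.Literals as ℕ-Literals
open import Data.Product using (_×_; _,_; Σ-syntax; ∃-syntax)
open import Data.Rational.Base hiding (_⊔_)
open import Data.Rational.Literals as ℚ-Literals using (fromℤ)
open import Data.Rational.Properties using
  ( _≟_; <-trans; +-identityˡ; +-inverseʳ; +-0-group; +-monoˡ-<
  ; *-assoc; *-identityˡ; *-identityʳ; *-inverseˡ; *-zeroʳ; *-monoʳ-<-pos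
  ; positive⁻¹; pos⇒nonZero; pos*pos⇒pos; pos+pos⇒pos )
open import Data.Rational.Solver using (module +-*-Solver)
open import Data.Unit.Base public using (tt)
open import Data.Vec.Functional using (Vector)
open import Function.Base using (_∘_)
open import Level using (Level; 0ℓ; _⊔_)
open import Relation.Binary.PropositionalEquality
open import Relation.Nullary using (yes; no)
open +-*-Solver using (solve; _:=_; _:+_; _:*_; _:-_; :-_; _:^_; con)

private
  variable
    c ℓ : Level

open RawSemiringDefs +-*-rawSemiring public using (_^_)

private
  module Identities where
    2ℚ 3ℚ 4ℚ 16ℚ : ℚ
    2ℚ  = fromℤ (ℤ.+ 2)
    3ℚ  = fromℤ (ℤ.+ 3)
    4ℚ  = fromℤ (ℤ.+ 4)
    16ℚ = fromℤ (ℤ.+ 16)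

    neg-square : ∀ y → (- y) ^ 2 ≡ y ^ 2
    neg-square = solve 1 (λ y → (:- y) :^ 2 := y :^ 2) refl

    p-q+q : ∀ q p → p - q + q ≡ p
    p-q+q = solve 2 (λ q p → p :- q :+ q := p) refl

    chord : ∀ k x₁ y₁ x₂ a b →
      let x₃ = k ^ 2 - a - x₁ - x₂
          d  = λ x y → y ^ 2 - (x ^ 3 + a * x ^ 2 + b * x)
      in (x₂ - x₁) * d x₃ (k * (x₁ - x₃) - y₁) ≡
         (x₂ - x₃) * d x₁ y₁ + (x₃ - x₁) * d x₂ (k * (x₂ - x₁) + y₁)
    chord = solve 6 (λ k x₁ y₁ x₂ a b →
      let x₃ = k :^ 2 :- a :- x₁ :- x₂
          d  = λ x y → y :^ 2 :- (x :^ 3 :+ a :* x :^ 2 :+ b :* x)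
      in (x₂ :- x₁) :* d x₃ (k :* (x₁ :- x₃) :- y₁) :=
         (x₂ :- x₃) :* d x₁ y₁ :+ (x₃ :- x₁) :* d x₂ (k :* (x₂ :- x₁) :+ y₁)) refl

    tangent : ∀ k x y a b →
      let x₃ = k ^ 2 - a - x - x
          d  = λ x y → y ^ 2 - (x ^ 3 + a * x ^ 2 + b * x)
      in d x₃ (k * (x - x₃) - y) ≡
         d x y + (x₃ - x) * (k * (2ℚ * y) - (3ℚ * x ^ 2 + 2ℚ * a * x + b))
    tangent = solve 5 (λ k x y a b →
      let x₃ = k :^ 2 :- a :- x :- x
          d  = λ x y → y :^ 2 :- (x :^ 3 :+ a :* x :^ 2 :+ b :* x)
      in d x₃ (k :* (x :- x₃) :- y) :=
         d x y :+ (x₃ :- x) :*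
           (k :* (con 2ℚ :* y) :- (con 3ℚ :* x :^ 2 :+ con 2ℚ :* a :* x :+ b))) refl

    discriminant : ∀ N →
      let a = 2ℚ * (2ℚ * N ^ 2 + 2ℚ * N - 1ℚ)
          b = - (4ℚ * N - 1ℚ)
      in (4ℚ * N - 1ℚ) * (4ℚ * N - 1ℚ) * (16ℚ * N * N * N * (N + 2ℚ)) ≡
         b ^ 2 * (a ^ 2 - 4ℚ * b)
    discriminant = solve 1 (λ N →
      let a = con 2ℚ :* (con 2ℚ :* N :^ 2 :+ con 2ℚ :* N :- con 1ℚ)
          b = :- (con 4ℚ :* N :- con 1ℚ)
          c = con 4ℚ :* N :- con 1ℚ
      in c :* c :* (con 16ℚ :* N :* N :* N :* (N :+ con 2ℚ)) :=
         b :^ 2 :* (a :^ 2 :- con 4ℚ :* b)) refl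

    T₆-onCurve : ∀ N →
      let a = 2ℚ * (2ℚ * N ^ 2 + 2ℚ * N - 1ℚ)
          b = - (4ℚ * N - 1ℚ)
          u = 1ℚ - 4ℚ * N
      in (2ℚ * N * (4ℚ * N - 1ℚ)) ^ 2 ≡ u ^ 3 + a * u ^ 2 + b * u
    T₆-onCurve = solve 1 (λ N →
      let a = con 2ℚ :* (con 2ℚ :* N :^ 2 :+ con 2ℚ :* N :- con 1ℚ)
          b = :- (con 4ℚ :* N :- con 1ℚ)
          u = con 1ℚ :- con 4ℚ :* N
      in (con 2ℚ :* N :* (con 4ℚ :* N :- con 1ℚ)) :^ 2 :=
         u :^ 3 :+ a :* u :^ 2 :+ b :* u) refl

    2m²-m+1 : ∀ m → m * m + (m - 1ℚ) * (m - 1ℚ) + m ≡ 2ℚ * m ^ 2 - m + 1ℚ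
    2m²-m+1 = solve 1 (λ m →
      m :* m :+ (m :- con 1ℚ) :* (m :- con 1ℚ) :+ m :=
      con 2ℚ :* m :^ 2 :- m :+ con 1ℚ) refl

    2m-1 : ∀ m → (m - 1ℚ) + m ≡ 2ℚ * m - 1ℚ
    2m-1 = solve 1 (λ m → (m :- con 1ℚ) :+ m := con 2ℚ :* m :- con 1ℚ) refl

-- Opened only now: the numerals in the solver calls above must be plain ℕ.
open import Agda.Builtin.FromNat public using (Number; fromNat)

instance
  ℕ-number : Number ℕ
  ℕ-number = ℕ-Literals.number

  ℚ-number : Number ℚ
  ℚ-number = ℚ-Literals.number

module _ (G : RawGroup c ℓ) where
  open RawGroup G
  open RawMonoidDefs rawMonoid using (sum) renaming (_×_ to _×ᴳ_)

  _·_ : ℤ → Carrier → Carrier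
  (ℤ.+ n)    · g = n ×ᴳ g
  ℤ.-[1+ n ] · g = (ℕ.suc n ×ᴳ g) ⁻¹

  Torsion : Carrier → Set ℓ
  Torsion g = ∃[ n ] 0 ℕ.< n × n ×ᴳ g ≈ ε

  LinearlyIndependent : ∀ {n} → Vector Carrier n → Set ℓ
  LinearlyIndependent {n} g =
    (k : Vector ℤ n) → sum (λ i → k i · g i) ≈ ε → ∀ i → k i ≡ 0ℤ

  -- The rank of an abelian group is the supremum, in ℕ ∪ {∞}, of the
  -- sizes of its finite ℤ-linearly independent families; it is given
  -- here through its lower bounds, so that no finiteness is presupposed.
  Rank≥ : ℕ → Set (c ⊔ ℓ)
  Rank≥ n = Σ[ g ∈ Vector Carrier n ] LinearlyIndependent g

-- y² = x³ + a x² + b x, whose discriminant is 16 b² (a² - 4 b).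
record EllipticCurve : Set where
  field
    a b          : ℚ
    .nonsingular : NonZero (b ^ 2 * (a ^ 2 - 4 * b))

OnCurve : EllipticCurve → ℚ → ℚ → Set
OnCurve E x y = y ^ 2 ≡ x ^ 3 + a * x ^ 2 + b * x
  where open EllipticCurve E

-- The proof that a point lies on the curve is irrelevant, so that
-- propositional equality of points is equality of coordinates.
data Point (E : EllipticCurve) : Set where
  ∞      : Point E
  affine : (x y : ℚ) → .(OnCurve E x y) → Point E

_HasCoordinates_ : ∀ {E} → Point E → ℚ × ℚ → Set
∞            HasCoordinates _       = ⊥
affine x y _ HasCoordinates (u , v) = x ≡ u × y ≡ v

private
  *-cancelˡ-0 : ∀ p q → p ≢ 0ℚ → p * q ≡ 0ℚ → q ≡ 0ℚ
  *-cancelˡ-0 p q p≢0 pq≡0 = begin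
    q              ≡⟨ *-identityˡ q ⟨
    1ℚ * q         ≡⟨ cong (_* q) (*-inverseˡ p) ⟨
    1/ p * p * q   ≡⟨ *-assoc (1/ p) p q ⟩
    1/ p * (p * q) ≡⟨ cong (1/ p *_) pq≡0 ⟩
    1/ p * 0ℚ      ≡⟨ *-zeroʳ (1/ p) ⟩
    0ℚ             ∎
    where
    open ≡-Reasoning
    instance _ = ≢-nonZero p≢0

  p-q≡0⇒p≡q : ∀ {p q} → p - q ≡ 0ℚ → p ≡ q
  p-q≡0⇒p≡q {p} {q} = x∙y⁻¹≈ε⇒x≈y +-0-group p q

  p≡q⇒p-q≡0 : ∀ {p q} → p ≡ q → p - q ≡ 0ℚ
  p≡q⇒p-q≡0 {p} refl = +-inverseʳ p

  ÷-*-cancel : ∀ p q .{{_ : NonZero q}} → p ÷ q * q ≡ p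
  ÷-*-cancel p q = begin
    p * 1/ q * q   ≡⟨ *-assoc p (1/ q) q ⟩
    p * (1/ q * q) ≡⟨ cong (p *_) (*-inverseˡ q) ⟩
    p * 1ℚ         ≡⟨ *-identityʳ p ⟩
    p              ∎
    where open ≡-Reasoning

  y₁≢-y₂⇒2y₁≢0 : ∀ {y₁ y₂} → y₁ ^ 2 ≡ y₂ ^ 2 → y₁ ≢ - y₂ → 2 * y₁ ≢ 0ℚ
  y₁≢-y₂⇒2y₁≢0 {y₁} {y₂} y₁²≡y₂² y₁≢-y₂ 2y₁≡0 =
    y₁≢-y₂ (trans y₁≡0 (cong -_ (sym y₂≡0)))
    where
    square : ∀ y → y ^ 2 ≡ y * y
    square y = cong (y *_) (*-identityʳ y)

    y₁≡0 : y₁ ≡ 0ℚ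
    y₁≡0 = *-cancelˡ-0 2 y₁ (λ ()) 2y₁≡0

    y₂y₂≡0 : y₂ * y₂ ≡ 0ℚ
    y₂y₂≡0 = begin
      y₂ * y₂ ≡⟨ square y₂ ⟨
      y₂ ^ 2  ≡⟨ y₁²≡y₂² ⟨
      y₁ ^ 2  ≡⟨ cong (_^ 2) y₁≡0 ⟩
      0ℚ      ∎
      where open ≡-Reasoning

    y₂≡0 : y₂ ≡ 0ℚ
    y₂≡0 with y₂ ≟ 0ℚ
    ... | yes p = p
    ... | no ¬p = *-cancelˡ-0 y₂ y₂ ¬p y₂y₂≡0

module GroupLaw {E : EllipticCurve} where
  open EllipticCurve E

  -- The third intersection point of the curve with the line of slope k
  -- through (x₁ , y₁) and (x₂ , y₂), reflected in the x-axis.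
  thirdX : (k x₁ x₂ : ℚ) → ℚ
  thirdX k x₁ x₂ = k ^ 2 - a - x₁ - x₂

  thirdY : (k x₁ y₁ x₂ : ℚ) → ℚ
  thirdY k x₁ y₁ x₂ = k * (x₁ - thirdX k x₁ x₂) - y₁

  chordSlope : (x₁ y₁ x₂ y₂ : ℚ) → .(x₁ ≢ x₂) → ℚ
  chordSlope x₁ y₁ x₂ y₂ x₁≢x₂ = ((y₂ - y₁) ÷ (x₂ - x₁)) {{≢-nonZero (x₁≢x₂ ∘ sym ∘ p-q≡0⇒p≡q)}}

  tangentSlope : (x y : ℚ) → .(2 * y ≢ 0ℚ) → ℚ
  tangentSlope x y 2y≢0 = ((3 * x ^ 2 + 2 * a * x + b) ÷ (2 * y)) {{≢-nonZero 2y≢0}}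

  neg-onCurve : ∀ {x y} → OnCurve E x y → OnCurve E x (- y)
  neg-onCurve {y = y} e = trans (Identities.neg-square y) e

  chord-onCurve : ∀ {x₁ y₁ x₂ y₂} → OnCurve E x₁ y₁ → OnCurve E x₂ y₂ → (x₁≢x₂ : x₁ ≢ x₂) →
                  let k = chordSlope x₁ y₁ x₂ y₂ x₁≢x₂ in
                  OnCurve E (thirdX k x₁ x₂) (thirdY k x₁ y₁ x₂)
  chord-onCurve {x₁} {y₁} {x₂} {y₂} e₁ e₂ x₁≢x₂ =
    p-q≡0⇒p≡q (*-cancelˡ-0 (x₂ - x₁) _ (x₁≢x₂ ∘ sym ∘ p-q≡0⇒p≡q) (begin
      (x₂ - x₁) * defect x₃ (thirdY k x₁ y₁ x₂)
        ≡⟨ Identities.chord k x₁ y₁ x₂ a b ⟩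
      (x₂ - x₃) * defect x₁ y₁ + (x₃ - x₁) * defect x₂ (k * (x₂ - x₁) + y₁)
        ≡⟨ cong (λ y → (x₂ - x₃) * defect x₁ y₁ + (x₃ - x₁) * defect x₂ y) y₂-on-line ⟩
      (x₂ - x₃) * defect x₁ y₁ + (x₃ - x₁) * defect x₂ y₂
        ≡⟨ cong₂ (λ d₁ d₂ → (x₂ - x₃) * d₁ + (x₃ - x₁) * d₂) (p≡q⇒p-q≡0 e₁) (p≡q⇒p-q≡0 e₂) ⟩
      (x₂ - x₃) * 0ℚ + (x₃ - x₁) * 0ℚ
        ≡⟨ cong₂ _+_ (*-zeroʳ (x₂ - x₃)) (*-zeroʳ (x₃ - x₁)) ⟩
      0ℚ ∎))
    where
    open ≡-Reasoning
    defect : ℚ → ℚ → ℚ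
    defect x y = y ^ 2 - (x ^ 3 + a * x ^ 2 + b * x)

    k x₃ : ℚ
    k  = chordSlope x₁ y₁ x₂ y₂ x₁≢x₂
    x₃ = thirdX k x₁ x₂

    y₂-on-line : k * (x₂ - x₁) + y₁ ≡ y₂
    y₂-on-line = trans
      (cong (_+ y₁) (÷-*-cancel (y₂ - y₁) (x₂ - x₁) {{≢-nonZero (x₁≢x₂ ∘ sym ∘ p-q≡0⇒p≡q)}}))
      (Identities.p-q+q y₁ y₂)

  tangent-onCurve : ∀ {x y} → OnCurve E x y → (2y≢0 : 2 * y ≢ 0ℚ) →
                    let k = tangentSlope x y 2y≢0 in
                    OnCurve E (thirdX k x x) (thirdY k x y x)
  tangent-onCurve {x} {y} e 2y≢0 = p-q≡0⇒p≡q (begin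
    defect x₃ (thirdY k x y x)
      ≡⟨ Identities.tangent k x y a b ⟩
    defect x y + (x₃ - x) * (k * (2 * y) - (3 * x ^ 2 + 2 * a * x + b))
      ≡⟨ cong₂ (λ d s → d + (x₃ - x) * s) (p≡q⇒p-q≡0 e) (p≡q⇒p-q≡0 k-tangent) ⟩
    0ℚ + (x₃ - x) * 0ℚ
      ≡⟨ trans (+-identityˡ _) (*-zeroʳ (x₃ - x)) ⟩
    0ℚ ∎)
    where
    open ≡-Reasoning
    defect : ℚ → ℚ → ℚ
    defect x y = y ^ 2 - (x ^ 3 + a * x ^ 2 + b * x)

    k x₃ : ℚ
    k  = tangentSlope x y 2y≢0
    x₃ = thirdX k x x

    k-tangent : k * (2 * y) ≡ 3 * x ^ 2 + 2 * a * x + b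
    k-tangent = ÷-*-cancel _ (2 * y) {{≢-nonZero 2y≢0}}

  doubling : ∀ {x₁ y₁ x₂ y₂} → OnCurve E x₁ y₁ → OnCurve E x₂ y₂ →
             x₁ ≡ x₂ → y₁ ≢ - y₂ → 2 * y₁ ≢ 0ℚ
  doubling {y₁ = y₁} {y₂ = y₂} e₁ e₂ refl = y₁≢-y₂⇒2y₁≢0 {y₁} {y₂} (trans e₁ (sym e₂))

  infix  8 ⊖_
  infixl 6 _⊕_ _⊝_

  ⊖_ : Point E → Point E
  ⊖ ∞            = ∞
  ⊖ affine x y e = affine x (- y) (neg-onCurve {x} {y} e)

  _⊕_ : Point E → Point E → Point E
  ∞                ⊕ Q = Q
  P@(affine _ _ _) ⊕ ∞ = P
  affine x₁ y₁ e₁ ⊕ affine x₂ y₂ e₂ with x₁ ≟ x₂ | y₁ ≟ - y₂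
  ... | no x₁≢x₂  | _         =
    let k = chordSlope x₁ y₁ x₂ y₂ x₁≢x₂ in
    affine (thirdX k x₁ x₂) (thirdY k x₁ y₁ x₂)
           (chord-onCurve {x₁} {y₁} {x₂} {y₂} e₁ e₂ x₁≢x₂)
  ... | yes _     | yes _     = ∞
  ... | yes x₁≡x₂ | no y₁≢-y₂ =
    let k = tangentSlope x₁ y₁ (doubling e₁ e₂ x₁≡x₂ y₁≢-y₂) in
    affine (thirdX k x₁ x₁) (thirdY k x₁ y₁ x₁)
           (tangent-onCurve {x₁} {y₁} e₁ (doubling e₁ e₂ x₁≡x₂ y₁≢-y₂))

  _⊝_ : Point E → Point E → Point E
  P ⊝ Q = P ⊕ ⊖ Q

open GroupLaw public using (⊖_; _⊕_; _⊝_)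

infix 4 _HasCoordinates_

𝓖 : EllipticCurve → RawGroup 0ℓ 0ℓ
𝓖 E = record
  { Carrier = Point E
  ; _≈_     = _≡_
  ; _∙_     = _⊕_
  ; ε       = ∞
  ; _⁻¹     = ⊖_
  }

private
  4N-1>0 : ∀ {N} → 1 ÷ 4 < N → Positive (4 * N - 1)
  4N-1>0 ¼<N = positive (+-monoˡ-< (- 1) (*-monoʳ-<-pos 4 ¼<N))

  N>0 : ∀ {N} → 1 ÷ 4 < N → Positive N
  N>0 ¼<N = positive (<-trans (positive⁻¹ (1 ÷ 4)) ¼<N)

  𝓔-nonsingular : ∀ {N} → 1 ÷ 4 < N →
    let a = 2 * (2 * N ^ 2 + 2 * N - 1)
        b = - (4 * N - 1)
    in NonZero (b ^ 2 * (a ^ 2 - 4 * b))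
  𝓔-nonsingular {N} ¼<N = subst NonZero (Identities.discriminant N) (pos⇒nonZero (q * q * r))
    where
    q r : ℚ
    q = 4 * N - 1
    r = 16 * N * N * N * (N + 2)
    instance
      q-pos : Positive q
      q-pos = 4N-1>0 ¼<N
      N-pos : Positive N
      N-pos = N>0 ¼<N
      r-pos : Positive r
      r-pos = pos*pos⇒pos (16 * N * N * N)
        {{pos*pos⇒pos (16 * N * N) {{pos*pos⇒pos (16 * N) {{pos*pos⇒pos 16 N}} N}} N}}
        (N + 2) {{pos+pos⇒pos N 2}}
      q²r-pos : Positive (q * q * r)
      q²r-pos = pos*pos⇒pos (q * q) {{pos*pos⇒pos q q}} r

𝓔 : (N : ℚ) → .(1 ÷ 4 < N) → EllipticCurve
𝓔 N ¼<N = record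
  { a           = 2 * (2 * N ^ 2 + 2 * N - 1)
  ; b           = - (4 * N - 1)
  ; nonsingular = 𝓔-nonsingular ¼<N
  }

T₆⁺ : ∀ N .(¼<N : 1 ÷ 4 < N) → Point (𝓔 N ¼<N)
T₆⁺ N ¼<N = affine (1 - 4 * N) (2 * N * (4 * N - 1)) (Identities.T₆-onCurve N)

record IsTriangle (f g h : ℚ) : Set where
  field
    f>0   : f > 0
    g>0   : g > 0
    h>0   : h > 0
    f<g+h : f < g + h
    g<h+f : g < h + f
    h<f+g : h < f + g

-- R / r = N, where R is the circumradius of the triangle with sides f, g
-- and h, and r is the radius of its excircle touching the side h from
-- outside: R / r = 2 f g h / ((f + g + h) (f - g - h) (g - h - f)).
R/r[_,_,_]≡_ : (f g h N : ℚ) → Set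
R/r[ f , g , h ]≡ N =
  Σ[ d≢0 ∈ NonZero ((f + g + h) * (f - g - h) * (g - h - f)) ]
    ((2 * f * g * h) ÷ ((f + g + h) * (f - g - h) * (g - h - f))) {{d≢0}} ≡ N

module _ (N x : ℚ) where
  A₁ A₂ B : ℚ
  A₁ = - (x ^ 2) - 2 * (2 * N - 1) * x + 4 * N
  A₂ = - (x ^ 2) + 2 * (2 * N + 1) * x - 4 * N
  B  = x ^ 4 + 4 * (2 * N - 1) * x ^ 3 + 4 * (4 * N ^ 2 - 2 * N + 1) * x ^ 2
       - 32 * N ^ 2 * x + 16 * N ^ 2

-- Since f, g, h, s and x are rational, so is the square root of B.
record TriangleFrom (N x f g h : ℚ) : Set where
  field
    {{2x≢0}}   : NonZero (2 * x)
    √B         : ℚ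
    √B≥0       : √B ≥ 0
    √B²≡B      : √B ^ 2 ≡ B N x
    s          : ℚ
    s>0        : s > 0
    f≡         : f ≡ s ÷ (2 * x) * (A₁ N x - √B)
    g≡         : g ≡ s * x
    h≡         : h ≡ s ÷ (2 * x) * (A₂ N x + √B)
    isTriangle : IsTriangle f g h
    R/r≡N      : R/r[ f , g , h ]≡ N

LeadsTo : ∀ N .(¼<N : 1 ÷ 4 < N) → Point (𝓔 N ¼<N) → (f g h : ℚ) → Set
LeadsTo N ¼<N ∞              f g h = ⊥
LeadsTo N ¼<N (affine u v _) f g h =
  Σ[ d≢0 ∈ NonZero ((u - 1) * (u + 4 * N - 1)) ]
    TriangleFrom N (- (((4 * N * (v + 2 * N * u)) ÷ ((u - 1) * (u + 4 * N - 1))) {{d≢0}})) f g h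

^-nonZero : ∀ p → .{{Positive p}} → ∀ n → NonZero (p ^ n)
^-nonZero p n = pos⇒nonZero (p ^ n) {{^-pos n}}
  where
  ^-pos : ∀ n → Positive (p ^ n)
  ^-pos ℕ.zero    = _
  ^-pos (ℕ.suc n) = pos*pos⇒pos p (p ^ n) {{^-pos n}}

module _ {m : ℚ} (1<m : 1 < m) where
  m>0 : Positive m
  m>0 = positive (<-trans (positive⁻¹ 1) 1<m)

  private
    instance
      _ = m>0
      m-1>0 : Positive (m - 1)
      m-1>0 = positive (+-monoˡ-< (- 1) 1<m)

  2m-1>0 : Positive (2 * m - 1)
  2m-1>0 = subst Positive (Identities.2m-1 m) (pos+pos⇒pos (m - 1) m)

  2m²-m+1>0 : Positive (2 * m ^ 2 - m + 1)
  2m²-m+1>0 = subst Positive (Identities.2m²-m+1 m)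
    (pos+pos⇒pos (m * m + (m - 1) * (m - 1))
      {{pos+pos⇒pos (m * m) {{pos*pos⇒pos m m}} ((m - 1) * (m - 1)) {{pos*pos⇒pos (m - 1) (m - 1)}}}} m)

-- The point P is not torsion because it reduces to ∞ modulo the numerator p of m.
-- In the chart z = x / y around ∞, addition of P to such points is an isometry up
-- to factors in 1 + p² R, where R is ℤ localised at 1 + p ℤ. Summing along the
-- multiples of n P gives z (j n P) = z (n P) (j + p² c) with c in R, and j + p² c
-- does not vanish if j = p or p ∤ j, so z (n P) ≠ 0 for n > 0 by strong induction.
-- This uses only the addition formula, neither associativity of ⊕ nor Mazur's
-- theorem. The coordinates and the triangles are identities of rational functions.

module Submission where

-- The numerator `p` of `m` may be composite, so there is no valuation to argue with. Inverting only
-- `1 + p ℤ` takes its place: this set is closed under products and avoids zero as soon as `p > 1`.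
-- The exponent in `1 + p² R` matters. A factor in `1 + p R` would give `j + p c`, which for `j = p`
-- is `p (1 + c)` and may vanish, whereas `p + p² c = p (1 + p c)` cannot. The second power is there
-- because the curve near `∞` is `w = z³ + a z² w + b z w²`: slopes of its chords are quadratic in
-- `(z , w)`, hence divisible by `p²` once `z` and `w` are divisible by `p`. The chart also removes
-- the case distinctions of the affine group law. The slope of the line through two points near `∞`
-- is a quotient by a unit whether or not the points coincide, so translations by a fixed point can
-- be compared by plain subtraction.

open import Algebra.Bundles.Raw using (RawGroup)
import Algebra.Definitions.RawMonoid as RawMonoidDefs
open import Algebra.Properties.Group using (x∙y⁻¹≈ε⇒x≈y)
open import Data.Empty using (⊥-elim)
open import Data.Fin.Base using (zero)
open import Data.Integer.Base as ℤ using (ℤ)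
import Data.Integer.Properties as ℤ
open import Data.Nat.Base as ℕ using (ℕ)
open import Data.Nat.Coprimality as Coprimality using (Coprime; coprime-Bézout)
open import Data.Nat.Divisibility using (_∣_; divides; _∣?_; ∣1⇒≡1; m∣m*n)
open import Data.Nat.GCD using (module Bézout)
open import Data.Nat.Induction using (<-rec)
import Data.Nat.Properties as ℕ
open import Data.Product using (_×_; _,_; proj₁; proj₂; Σ-syntax)
open import Data.Rational.Base
open import Data.Rational.Literals using (fromℤ)
import Data.Rational.Properties as ℚ
open import Data.Rational.Solver using (module +-*-Solver)
import Data.Rational.Unnormalised.Base as ℚᵘ
import Data.Rational.Unnormalised.Properties as ℚᵘ
open import Function.Base using (_∘_)
open import Relation.Binary.PropositionalEquality
open import Relation.Nullary using (¬_; yes; no)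
open import Relation.Nullary.Decidable using (recompute)
open +-*-Solver using (Polynomial; solve; _:=_; _:+_; _:*_; _:-_; :-_; _:^_; con)

-- Numerals are fixed before Defs overloads them: terms of the solver containing
-- numerals that are still to be resolved make its normalisation blow up.
solve₁ = solve 1
solve₂ = solve 2
solve₃ = solve 3
solve₄ = solve 4
solve₅ = solve 5
solve₆ = solve 6
solve₇ = solve 7
solve₈ = solve 8
solve₉ = solve 9
solve₁₁ = solve 11
solve₁₂ = solve 12
solve₁₃ = solve 13

infixl 10 _² _³ _⁴ _⁵ _⁶

_² _³ _⁴ _⁵ _⁶ : ∀ {n} → Polynomial n → Polynomial n
x ² = x :^ 2
x ³ = x :^ 3
x ⁴ = x :^ 4
x ⁵ = x :^ 5
x ⁶ = x :^ 6

#0 #1 #2 #3 #4 #5 #6 #7 #8 #11 #16 #32 : ∀ {n} → Polynomial n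
#0 = con (fromℤ (ℤ.+ 0))
#1 = con (fromℤ (ℤ.+ 1))
#2 = con (fromℤ (ℤ.+ 2))
#3 = con (fromℤ (ℤ.+ 3))
#4 = con (fromℤ (ℤ.+ 4))
#5 = con (fromℤ (ℤ.+ 5))
#6 = con (fromℤ (ℤ.+ 6))
#7 = con (fromℤ (ℤ.+ 7))
#8 = con (fromℤ (ℤ.+ 8))
#11 = con (fromℤ (ℤ.+ 11))
#16 = con (fromℤ (ℤ.+ 16))
#32 = con (fromℤ (ℤ.+ 32))

open import Defs

-- Equations between rationals

p-q≡0⇒p≡q : ∀ {p q} → p - q ≡ 0 → p ≡ q
p-q≡0⇒p≡q {p} {q} = x∙y⁻¹≈ε⇒x≈y ℚ.+-0-group p q

p≡q⇒p-q≡0 : ∀ {p q} → p ≡ q → p - q ≡ 0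
p≡q⇒p-q≡0 {p} refl = ℚ.+-inverseʳ p

*-cancelˡ-0 : ∀ {p q} → p ≢ 0 → p * q ≡ 0 → q ≡ 0
*-cancelˡ-0 {p} {q} p≢0 pq≡0 = begin
  q              ≡⟨ ℚ.*-identityˡ q ⟨
  1 * q          ≡⟨ cong (_* q) (ℚ.*-inverseˡ p) ⟨
  1/ p * p * q   ≡⟨ ℚ.*-assoc (1/ p) p q ⟩
  1/ p * (p * q) ≡⟨ cong (1/ p *_) pq≡0 ⟩
  1/ p * 0       ≡⟨ ℚ.*-zeroʳ (1/ p) ⟩
  0              ∎
  where
  open ≡-Reasoning
  instance _ = ≢-nonZero p≢0

inverse : ∀ {p} → p ≢ 0 → Σ[ q ∈ ℚ ] p * q ≡ 1
inverse {p} p≢0 = 1/ p , ℚ.*-inverseʳ p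
  where instance _ = ≢-nonZero p≢0

-- Equations are derived from hypotheses l ≡ r by exhibiting the difference of
-- their sides as a combination of terms c * (l - r).

infixl 7 _⋆_
infixl 6 _⊞_

_⋆_ : ∀ c {l r} → l ≡ r → c * (l - r) ≡ 0
c ⋆ l≡r = trans (cong (c *_) (p≡q⇒p-q≡0 l≡r)) (ℚ.*-zeroʳ c)

_⊞_ : ∀ {p q} → p ≡ 0 → q ≡ 0 → p + q ≡ 0
_⊞_ = cong₂ _+_

combine : ∀ {p q e} → e ≡ 0 → p - q ≡ e → p ≡ q
combine e≡0 p-q≡e = p-q≡0⇒p≡q (trans p-q≡e e≡0)

cancel-combine : ∀ {c p q e} → c ≢ 0 → e ≡ 0 → c * (p - q) ≡ e → p ≡ q
cancel-combine c≢0 e≡0 eq = p-q≡0⇒p≡q (*-cancelˡ-0 c≢0 (trans eq e≡0))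

-- Integers in `ℚ` and the localisation at `1 + p ℤ`

fromℤ-+ : ∀ a b → fromℤ (a ℤ.+ b) ≡ fromℤ a + fromℤ b
fromℤ-+ a b = ℚ.toℚᵘ-injective (ℚᵘ.≃-trans
  (ℚᵘ.*≡* (cong₂ (λ a b → (a ℤ.+ b) ℤ.* ℤ.1ℤ) (sym (ℤ.*-identityʳ a)) (sym (ℤ.*-identityʳ b))))
  (ℚᵘ.≃-sym (ℚ.toℚᵘ-homo-+ (fromℤ a) (fromℤ b))))

fromℤ-* : ∀ a b → fromℤ (a ℤ.* b) ≡ fromℤ a * fromℤ b
fromℤ-* a b = ℚ.toℚᵘ-injective (ℚᵘ.≃-sym (ℚ.toℚᵘ-homo-* (fromℤ a) (fromℤ b)))

fromℤ-neg : ∀ a → fromℤ (ℤ.- a) ≡ - fromℤ a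
fromℤ-neg (ℤ.+ ℕ.zero)  = refl
fromℤ-neg (ℤ.+ ℕ.suc _) = refl
fromℤ-neg ℤ.-[1+ _ ]    = refl

Integer : ℚ → Set
Integer x = Σ[ a ∈ ℤ ] x ≡ fromℤ a

Integer-+ : ∀ {x y} → Integer x → Integer y → Integer (x + y)
Integer-+ (a , refl) (b , refl) = a ℤ.+ b , sym (fromℤ-+ a b)

Integer-* : ∀ {x y} → Integer x → Integer y → Integer (x * y)
Integer-* (a , refl) (b , refl) = a ℤ.* b , sym (fromℤ-* a b)

Integer-neg : ∀ {x} → Integer x → Integer (- x)
Integer-neg (a , refl) = ℤ.- a , sym (fromℤ-neg a)

-- The ring ℤ localised at 1 + p ℤ, in which 1 + p x is a unit for every x.
module Localisation (p₀ : ℕ) (p₀>1 : 1 ℕ.< p₀) (p : ℚ) (p≡p₀ : p ≡ fromℤ (ℤ.+ p₀)) where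

  p-Integer : Integer p
  p-Integer = ℤ.+ p₀ , p≡p₀

  divides-if-zero : ∀ n {i} → Integer i → fromℤ (ℤ.+ n) + p * i ≡ 0 → p₀ ∣ n
  divides-if-zero n (k , refl) eq = subst (p₀ ∣_) (sym n≡) (m∣m*n ℤ.∣ k ∣)
    where
    open ≡-Reasoning
    n≡-pk : ℤ.+ n ≡ ℤ.- (ℤ.+ p₀ ℤ.* k)
    -- The numerator of `fromℤ a` is `a` by computation, so `↥_` carries the equation from `ℚ` back
    -- to `ℤ`.
    n≡-pk = cong ↥_ (begin
      fromℤ (ℤ.+ n)                ≡⟨ combine (1 ⋆ eq)
        (solve₃ (λ ν p α → ν :- :- (p :* α)
          := #1 :* (ν :+ p :* α :- #0)) refl (fromℤ (ℤ.+ n)) p (fromℤ k)) ⟩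
      - (p * fromℤ k)              ≡⟨ cong (λ p → - (p * fromℤ k)) p≡p₀ ⟩
      - (fromℤ (ℤ.+ p₀) * fromℤ k) ≡⟨ cong -_ (fromℤ-* (ℤ.+ p₀) k) ⟨
      - fromℤ (ℤ.+ p₀ ℤ.* k)       ≡⟨ fromℤ-neg (ℤ.+ p₀ ℤ.* k) ⟨
      fromℤ (ℤ.- (ℤ.+ p₀ ℤ.* k))   ∎)

    n≡ : n ≡ p₀ ℕ.* ℤ.∣ k ∣
    n≡ = trans (cong ℤ.∣_∣ n≡-pk) (trans (ℤ.∣-i∣≡∣i∣ (ℤ.+ p₀ ℤ.* k)) (ℤ.abs-* (ℤ.+ p₀) k))

  1+p*-Integer≢0 : ∀ {i} → Integer i → 1 + p * i ≢ 0
  1+p*-Integer≢0 i eq = ℕ.<⇒≢ p₀>1 (sym (∣1⇒≡1 (divides-if-zero 1 i eq)))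

  p≢0 : p ≢ 0
  p≢0 eq = ℕ.<⇒≢ (ℕ.<-trans (ℕ.s≤s ℕ.z≤n) p₀>1) (sym (ℤ.+-injective (cong ↥_ (trans (sym p≡p₀) eq))))

  -- `x` stays a plain rational and `t` only witnesses a denominator `1 + p t`, nonzero by
  -- `1+p*-Integer≢0`; membership can thus accompany identities of rationals without any division.
  record Local (x : ℚ) : Set where
    constructor _/1+p_
    field
      {t}         : ℚ
      numerator   : Integer (x * (1 + p * t))
      denominator : Integer t

  infixl 6 _⟨+⟩_ _⟨-⟩_
  infixl 7 _⟨*⟩_
  infix  8 ⟨neg⟩_

  private
    -- Denominators multiply: `(1 + p t) (1 + p s) = 1 + p (t + s + p t s)`.
    t⊕s : ∀ {t s} → Integer t → Integer s → Integer (t + s + p * (t * s))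
    t⊕s t s = Integer-+ (Integer-+ t s) (Integer-* p-Integer (Integer-* t s))

    1+pt : ∀ {t} → Integer t → Integer (1 + p * t)
    1+pt t = Integer-+ (ℤ.1ℤ , refl) (Integer-* p-Integer t)

  integer : ∀ {x} → Integer x → Local x
  integer {x} xi = subst Integer x≡ xi /1+p (ℤ.0ℤ , refl)
    where
    x≡ : x ≡ x * (1 + p * 0)
    x≡ = solve₂ (λ x p → x := x :* (#1 :+ p :* #0)) refl x p

  _⟨+⟩_ : ∀ {x y} → Local x → Local y → Local (x + y)
  _⟨+⟩_ {x} {y} (_/1+p_ {t} xi ti) (_/1+p_ {s} yi si) =
    subst Integer {x * (1 + p * t) * (1 + p * s) + y * (1 + p * s) * (1 + p * t)}
      (solve₅ (λ x p t s y →
        x :* (#1 :+ p :* t) :* (#1 :+ p :* s) :+ y :* (#1 :+ p :* s) :* (#1 :+ p :* t)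
        := (x :+ y) :* (#1 :+ p :* (t :+ s :+ p :* (t :* s)))) refl x p t s y)
      (Integer-+ (Integer-* xi (1+pt si)) (Integer-* yi (1+pt ti)))
    /1+p t⊕s ti si

  _⟨*⟩_ : ∀ {x y} → Local x → Local y → Local (x * y)
  _⟨*⟩_ {x} {y} (_/1+p_ {t} xi ti) (_/1+p_ {s} yi si) =
    subst Integer {x * (1 + p * t) * (y * (1 + p * s))}
      (solve₅ (λ x p t y s → x :* (#1 :+ p :* t) :* (y :* (#1 :+ p :* s))
        := x :* y :* (#1 :+ p :* (t :+ s :+ p :* (t :* s)))) refl x p t y s) (Integer-* xi yi) /1+p t⊕s ti si

  ⟨neg⟩_ : ∀ {x} → Local x → Local (- x)
  ⟨neg⟩_ {x} (_/1+p_ {t} xi ti) = subst Integer {(- (x * (1 + p * t)))}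
    (solve₃ (λ x p t → :- (x :* (#1 :+ p :* t))
      := :- x :* (#1 :+ p :* t)) refl x p t) (Integer-neg xi) /1+p ti

  _⟨-⟩_ : ∀ {x y} → Local x → Local y → Local (x - y)
  x ⟨-⟩ y = x ⟨+⟩ (⟨neg⟩ y)

  ⟨0⟩ : Local 0
  ⟨0⟩ = integer (ℤ.0ℤ , refl)

  ⟨1⟩ : Local 1
  ⟨1⟩ = integer (ℤ.1ℤ , refl)

  ⟨2⟩ : Local 2
  ⟨2⟩ = ⟨1⟩ ⟨+⟩ ⟨1⟩

  ⟨p⟩ : Local p
  ⟨p⟩ = integer p-Integer

  -- If `x = n / (1 + p t)` with `n` an integer, then `1 + p x = (1 + p (t + n)) / (1 + p t)` is a
  -- quotient of two elements of `1 + p ℤ`.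
  1+p*-invertible : ∀ {x} → Local x → Σ[ y ∈ ℚ ] Local y × (1 + p * x) * y ≡ 1
  1+p*-invertible {x} (_/1+p_ {t} xi ti) with inverse (1+p*-Integer≢0 (Integer-+ ti xi))
  ... | i , di≡1 =
    (1 + p * t) * i ,
    (subst Integer (sym y-Local) (1+pt ti) /1+p Integer-+ ti xi) ,
    combine (1 ⋆ di≡1)
      (solve₄ (λ p x t i → (#1 :+ p :* x) :* ((#1 :+ p :* t) :* i) :- #1
        := #1 :* ((#1 :+ p :* (t :+ x :* (#1 :+ p :* t))) :* i :- #1)) refl p x t i)
    where
    y-Local : (1 + p * t) * i * (1 + p * (t + x * (1 + p * t))) ≡ 1 + p * t
    y-Local = combine ((1 + p * t) ⋆ di≡1)
      (solve₄ (λ p t i x →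
        (#1 :+ p :* t) :* i :* (#1 :+ p :* (t :+ x :* (#1 :+ p :* t))) :- (#1 :+ p :* t)
        := (#1 :+ p :* t) :* ((#1 :+ p :* (t :+ x :* (#1 :+ p :* t))) :* i :- #1)) refl p t i x)

  -- Multiplied by the denominator `1 + p t` of `c`, a zero would read `n + p i = 0` with `i` an
  -- integer.
  n+p²*≢0 : ∀ n {c} → ¬ p₀ ∣ n → Local c → fromℤ (ℤ.+ n) + p * p * c ≢ 0
  n+p²*≢0 n {c} p∤n (_/1+p_ {t} ci ti) eq = p∤n (divides-if-zero n
    (Integer-+ (Integer-* (ℤ.+ n , refl) ti) (Integer-* p-Integer ci))
    (combine ((1 + p * t) ⋆ eq)
      (solve₄ (λ ν p t c → ν :+ p :* (ν :* t :+ p :* (c :* (#1 :+ p :* t))) :- #0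
        := (#1 :+ p :* t) :* (ν :+ p :* p :* c :- #0)) refl (fromℤ (ℤ.+ n)) p t c)))

  p+p²*≢0 : ∀ {c} → Local c → p + p * p * c ≢ 0
  p+p²*≢0 {c} (_/1+p_ {t} ci ti) eq = 1+p*-Integer≢0 (Integer-+ ti ci)
    (*-cancelˡ-0 p≢0 (combine ((1 + p * t) ⋆ eq)
      (solve₃ (λ p t c → p :* (#1 :+ p :* (t :+ c :* (#1 :+ p :* t))) :- #0
        := (#1 :+ p :* t) :* (p :+ p :* p :* c :- #0)) refl p t c)))

  -- A sequence starting at 0 ≢ z 1 on which the shift is an isometry up to
  -- factors in 1 + p² Local satisfies z (j * n) ≡ z n * (j + p² c), and the
  -- second factor is nonzero if j is p or prime to p.
  module _ (z : ℕ → ℚ) (z0≡0 : z 0 ≡ 0) (z1≢0 : z 1 ≢ 0)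
           (shift : ∀ i j → Σ[ c ∈ ℚ ] Local c ×
             z (ℕ.suc i) - z (ℕ.suc j) ≡ (z i - z j) * (1 + p * p * c)) where

    shifts : ∀ k i j → Σ[ c ∈ ℚ ] Local c ×
      z (k ℕ.+ i) - z (k ℕ.+ j) ≡ (z i - z j) * (1 + p * p * c)
    shifts ℕ.zero    i j = 0 , ⟨0⟩ , eq
      where
      eq : ∀ {x} → x ≡ x * (1 + p * p * 0)
      eq {x} = solve₂ (λ x p → x := x :* (#1 :+ p :* p :* #0)) refl x p
    shifts (ℕ.suc k) i j with shifts k i j | shift (k ℕ.+ i) (k ℕ.+ j)
    ... | c , c∈ , eq | d , d∈ , eq′ = c + d + p * p * (c * d) ,
      c∈ ⟨+⟩ d∈ ⟨+⟩ ⟨p⟩ ⟨*⟩ ⟨p⟩ ⟨*⟩ (c∈ ⟨*⟩ d∈) ,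
      combine (1 ⋆ eq′ ⊞ (1 + p * p * d) ⋆ eq)
        (solve₉ (λ α β zᵢ zⱼ p c d γ η →
          α :- β :- (zᵢ :- zⱼ) :* (#1 :+ p :* p :* (c :+ d :+ p :* p :* (c :* d)))
          := #1 :* (α :- β :- (γ :- η) :* (#1 :+ p :* p :* d)) :+ (#1 :+ p :* p :* d) :* (γ :- η
             :- (zᵢ :- zⱼ) :* (#1 :+ p :* p :* c)))
          refl (z (ℕ.suc (k ℕ.+ i))) (z (ℕ.suc (k ℕ.+ j))) (z i) (z j) p c d (z (k ℕ.+ i)) (z (k ℕ.+ j)))

    multiple : ∀ n j → Σ[ c ∈ ℚ ] Local c × z (j ℕ.* n) ≡ z n * (fromℤ (ℤ.+ j) + p * p * c)
    multiple n ℕ.zero    = 0 , ⟨0⟩ , trans z0≡0 eq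
      where
      eq : 0 ≡ z n * (0 + p * p * 0)
      eq = solve₂ (λ zₙ p → #0 := zₙ :* (#0 :+ p :* p :* #0)) refl (z n) p
    -- `z (j n + n) - z (j n)` is the difference `z n - z 0` shifted by `j n`, hence `z n` times an
    -- element of `1 + p² Local`; such terms are added up.
    multiple n (ℕ.suc j) with multiple n j | shifts (j ℕ.* n) n 0
    ... | c , c∈ , eq | d , d∈ , eq′ = c + d , c∈ ⟨+⟩ d∈ , (begin
      z (n ℕ.+ j ℕ.* n)
        ≡⟨ cong z (ℕ.+-comm n (j ℕ.* n)) ⟩
      z (j ℕ.* n ℕ.+ n)
        ≡⟨ telescope {v = z n} {k = fromℤ (ℤ.+ j)} eq′ (trans (cong z (ℕ.+-identityʳ (j ℕ.* n))) eq) z0≡0 ⟩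
      z n * (1 + fromℤ (ℤ.+ j) + p * p * (c + d))
        ≡⟨ cong (λ k → z n * (k + p * p * (c + d))) (fromℤ-+ ℤ.1ℤ (ℤ.+ j)) ⟨
      z n * (fromℤ (ℤ.+ ℕ.suc j) + p * p * (c + d)) ∎)
      where
      open ≡-Reasoning
      telescope : ∀ {x y v o k} → x - y ≡ (v - o) * (1 + p * p * d) → y ≡ v * (k + p * p * c) →
                  o ≡ 0 → x ≡ v * (1 + k + p * p * (c + d))
      telescope {x} {y} {v} {o} {k} h₁ h₂ h₃ = combine (1 ⋆ h₁ ⊞ 1 ⋆ h₂ ⊞ (- (1 + p * p * d)) ⋆ h₃)
        (solve₈ (λ x v k p c d y o → x :- v :* (#1 :+ k :+ p :* p :* (c :+ d))
          := #1 :* (x :- y :- (v :- o) :* (#1 :+ p :* p :* d)) :+ #1 :* (y :- v :* (k :+ p :* p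
             :* c)) :+ :- (#1 :+ p :* p :* d) :* (o :- #0)) refl x v k p c d y o)

    nonvanishing : ∀ n → 0 ℕ.< n → z n ≢ 0
    nonvanishing = <-rec _ step
      where
      step : ∀ n → (∀ {k} → k ℕ.< n → 0 ℕ.< k → z k ≢ 0) → 0 ℕ.< n → z n ≢ 0
      step n rec n>0 zn≡0 with p₀ ∣? n
      ... | no p∤n with multiple 1 n
      ...   | c , c∈ , eq = n+p²*≢0 n p∤n c∈ (*-cancelˡ-0 z1≢0
                (trans (sym eq) (trans (cong z (ℕ.*-identityʳ n)) zn≡0)))
      -- `n = k p₀` is read as the `p₀`-fold of `k`, so that the induction hypothesis supplies
      -- `z k ≢ 0`.
      step n rec n>0 zn≡0 | yes (divides k refl) with multiple k p₀
      ...   | c , c∈ , eq = p+p²*≢0 c∈ (*-cancelˡ-0 (rec k<kp k>0)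
                (trans (cong (λ p′ → z k * (p′ + p * p * c)) p≡p₀)
                  (trans (sym eq) (trans (cong z (ℕ.*-comm p₀ k)) zn≡0))))
              where
              k>0 : 0 ℕ.< k
              k>0 = ℕ.n≢0⇒n>0 λ { refl → ℕ.<-irrefl refl n>0 }
              k<kp : k ℕ.< k ℕ.* p₀
              k<kp = ℕ.m<m*n k p₀ {{ℕ.>-nonZero k>0}} p₀>1

-- Lines and translations in the chart around `∞`

-- The points of y² = x³ + a x² + b x that reduce to ∞ modulo p, in the chart
-- z = x / y = p ζ, w = 1 / y = p ω around ∞.
module Neighbourhood
  (p₀ : ℕ) (p₀>1 : 1 ℕ.< p₀) (p : ℚ) (p≡p₀ : p ≡ fromℤ (ℤ.+ p₀)) where

  open Localisation p₀ p₀>1 p p≡p₀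

  module Chart {a b : ℚ} (a∈ : Local a) (b∈ : Local b) where

    -- `curve` is `y² = x³ + a x² + b x` divided by `y³`, that is, `w = z³ + a z² w + b z w²`; `∞`
    -- is the origin.
    record Near : Set where
      constructor near
      field
        ζ ω   : ℚ
        ζ∈    : Local ζ
        ω∈    : Local ω
        curve : p * ω ≡ (p * ζ) ^ 3 + a * (p * ζ) ^ 2 * (p * ω) + b * (p * ζ) * (p * ω) ^ 2

    -- The slope p² ℓ of the line through two points is a quotient by the unit Δ
    -- also when the points coincide; E is the leading coefficient of the cubic
    -- whose roots are the z-coordinates of the intersections with the line.
    record Line (X Y : Near) : Set where
      constructor line
      open Near X renaming (ζ to ζ₁; ω to ω₁)
      open Near Y renaming (ζ to ζ₂; ω to ω₂)
      field
        ℓ δ ε : ℚ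
        ℓ∈    : Local ℓ
        δ∈    : Local δ
        ε∈    : Local ε
        Δδ≡1  : (1 - p * p * (a * ζ₂ ^ 2 + b * ζ₂ * (ω₁ + ω₂))) * δ ≡ 1
        ℓΔ≡   : ℓ * (1 - p * p * (a * ζ₂ ^ 2 + b * ζ₂ * (ω₁ + ω₂))) ≡
                ζ₁ * ζ₁ + ζ₁ * ζ₂ + ζ₂ * ζ₂ + a * (ζ₁ + ζ₂) * ω₁ + b * ω₁ * ω₁
        slope : ω₁ - ω₂ ≡ p * p * ℓ * (ζ₁ - ζ₂)
        Eε≡1  : (1 + a * (p * p * ℓ) + b * (p * p * ℓ) ^ 2) * ε ≡ 1

      -- The line is `w = p² ℓ z + p n`. By Vieta its three intersections have `ζ`-sum
      -- `- n (a + 2 b p² ℓ) / E`. The third one is then negated, and negation is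
      -- `(z , w) ↦ (- z , - w)`.
      n ζ₃ ω₃ : ℚ
      n  = ω₁ - p * p * ℓ * ζ₁
      ζ₃ = ζ₁ + ζ₂ + n * (a + 2 * b * (p * p * ℓ)) * ε
      ω₃ = p * p * ℓ * ζ₃ - n

      n∈ : Local n
      n∈ = Near.ω∈ X ⟨-⟩ ⟨p⟩ ⟨*⟩ ⟨p⟩ ⟨*⟩ ℓ∈ ⟨*⟩ Near.ζ∈ X

      ζ₃∈ : Local ζ₃
      ζ₃∈ = Near.ζ∈ X ⟨+⟩ Near.ζ∈ Y ⟨+⟩
        n∈ ⟨*⟩ (a∈ ⟨+⟩ ⟨2⟩ ⟨*⟩ b∈ ⟨*⟩ (⟨p⟩ ⟨*⟩ ⟨p⟩ ⟨*⟩ ℓ∈)) ⟨*⟩ ε∈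

      ω₃∈ : Local ω₃
      ω₃∈ = ⟨p⟩ ⟨*⟩ ⟨p⟩ ⟨*⟩ ℓ∈ ⟨*⟩ ζ₃∈ ⟨-⟩ n∈

    -- Subtracting the curve equations gives `(w₁ - w₂) (1 - a z₂² - b z₂ (w₁ + w₂)) = (z₁ - z₂)
    -- (z₁² + z₁ z₂ + z₂² + a (z₁ + z₂) w₁ + b w₁²)`. The last factor is homogeneous of degree 2,
    -- which is the source of `p²`.
    chord-slope : ∀ {ζ₁ ω₁ ζ₂ ω₂ δ ℓ} →
      p * ω₁ ≡ (p * ζ₁) ^ 3 + a * (p * ζ₁) ^ 2 * (p * ω₁) + b * (p * ζ₁) * (p * ω₁) ^ 2 →
      p * ω₂ ≡ (p * ζ₂) ^ 3 + a * (p * ζ₂) ^ 2 * (p * ω₂) + b * (p * ζ₂) * (p * ω₂) ^ 2 →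
      (1 - p * p * (a * ζ₂ ^ 2 + b * ζ₂ * (ω₁ + ω₂))) * δ ≡ 1 →
      ℓ * (1 - p * p * (a * ζ₂ ^ 2 + b * ζ₂ * (ω₁ + ω₂))) ≡
        ζ₁ * ζ₁ + ζ₁ * ζ₂ + ζ₂ * ζ₂ + a * (ζ₁ + ζ₂) * ω₁ + b * ω₁ * ω₁ →
      ω₁ - ω₂ ≡ p * p * ℓ * (ζ₁ - ζ₂)
    chord-slope {ζ₁} {ω₁} {ζ₂} {ω₂} {δ} {ℓ} curve₁ curve₂ Δδ≡1 ℓΔ≡ = cancel-combine p≢0
      (δ ⋆ curve₁ ⊞ (- δ) ⋆ curve₂
        ⊞ (p * p * p * ℓ * (ζ₁ - ζ₂) - p * (ω₁ - ω₂)) ⋆ Δδ≡1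
        ⊞ (- (p * p * p * (ζ₁ - ζ₂) * δ)) ⋆ ℓΔ≡)
      (solve₉ (λ p ω₁ ω₂ ℓ ζ₁ ζ₂ δ a b → p :* (ω₁ :- ω₂ :- p :* p :* ℓ :* (ζ₁ :- ζ₂))
        := δ :* (p :* ω₁ :- ((p :* ζ₁) ³ :+ a :* (p :* ζ₁) ² :* (p :* ω₁) :+ b :* (p :* ζ₁) :*
           (p :* ω₁) ²)) :+ :- δ :* (p :* ω₂ :- ((p :* ζ₂) ³ :+ a :* (p :* ζ₂) ² :* (p :* ω₂) :+
           b :* (p :* ζ₂) :* (p :* ω₂) ²)) :+ (p :* p :* p :* ℓ :* (ζ₁ :- ζ₂) :- p :* (ω₁ :-
           ω₂)) :* ((#1 :- p :* p :* (a :* ζ₂ ² :+ b :* ζ₂ :* (ω₁ :+ ω₂))) :* δ :- #1) :+ :- (p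
           :* p :* p :* (ζ₁ :- ζ₂) :* δ) :* (ℓ :* (#1 :- p :* p :* (a :* ζ₂ ² :+ b :* ζ₂ :* (ω₁
           :+ ω₂))) :- (ζ₁ :* ζ₁ :+ ζ₁ :* ζ₂ :+ ζ₂ :* ζ₂ :+ a :* (ζ₁ :+ ζ₂) :* ω₁ :+ b :* ω₁ :*
           ω₁))) refl p ω₁ ω₂ ℓ ζ₁ ζ₂ δ a b)

    E-unit : ∀ {ℓ} → Local ℓ →
      Σ[ ε ∈ ℚ ] Local ε × (1 + a * (p * p * ℓ) + b * (p * p * ℓ) ^ 2) * ε ≡ 1
    E-unit {ℓ} ℓ∈ =
      let ε , ε∈ , eq = 1+p*-invertible {p * (a * ℓ + b * p * p * ℓ * ℓ)}
                          (⟨p⟩ ⟨*⟩ (a∈ ⟨*⟩ ℓ∈ ⟨+⟩ b∈ ⟨*⟩ ⟨p⟩ ⟨*⟩ ⟨p⟩ ⟨*⟩ ℓ∈ ⟨*⟩ ℓ∈))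
      in ε , ε∈ , trans (expand ε) eq
      where
      expand : ∀ ε → (1 + a * (p * p * ℓ) + b * (p * p * ℓ) ^ 2) * ε ≡
                     (1 + p * (p * (a * ℓ + b * p * p * ℓ * ℓ))) * ε
      expand ε =
        solve₅ (λ a p ℓ b ε → (#1 :+ a :* (p :* p :* ℓ) :+ b :* (p :* p :* ℓ) ²) :* ε
          := (#1 :+ p :* (p :* (a :* ℓ :+ b :* p :* p :* ℓ :* ℓ))) :* ε) refl a p ℓ b ε

    Δ-unit : ∀ {ζ₂ ω₁ ω₂} → Local ζ₂ → Local ω₁ → Local ω₂ →
      Σ[ δ ∈ ℚ ] Local δ × (1 - p * p * (a * ζ₂ ^ 2 + b * ζ₂ * (ω₁ + ω₂))) * δ ≡ 1
    Δ-unit {ζ₂} {ω₁} {ω₂} ζ₂∈ ω₁∈ ω₂∈ =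
      let δ , δ∈ , eq = 1+p*-invertible {(- (p * (a * ζ₂ * ζ₂ + b * ζ₂ * (ω₁ + ω₂))))}
                          (⟨neg⟩ (⟨p⟩ ⟨*⟩ (a∈ ⟨*⟩ ζ₂∈ ⟨*⟩ ζ₂∈ ⟨+⟩ b∈ ⟨*⟩ ζ₂∈ ⟨*⟩ (ω₁∈ ⟨+⟩ ω₂∈))))
      in δ , δ∈ , trans (expand δ) eq
      where
      expand : ∀ δ → (1 - p * p * (a * ζ₂ ^ 2 + b * ζ₂ * (ω₁ + ω₂))) * δ ≡
                     (1 + p * (- (p * (a * ζ₂ * ζ₂ + b * ζ₂ * (ω₁ + ω₂))))) * δ
      expand δ =
        solve₇ (λ p a ζ₂ b ω₁ ω₂ δ → (#1 :- p :* p :* (a :* ζ₂ ² :+ b :* ζ₂ :* (ω₁ :+ ω₂))) :* δ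
          := (#1 :+ p :* (:- (p :* (a :* ζ₂ :* ζ₂ :+ b :* ζ₂ :* (ω₁ :+ ω₂))))) :* δ)
          refl p a ζ₂ b ω₁ ω₂ δ

    -- Unfolding lines would make equality checking too slow.
    abstract
      line-through : ∀ X Y → Line X Y
      line-through (near ζ₁ ω₁ ζ₁∈ ω₁∈ curve₁) (near ζ₂ ω₂ ζ₂∈ ω₂∈ curve₂) =
        let δ , δ∈ , Δδ≡1 = Δ-unit ζ₂∈ ω₁∈ ω₂∈
            ℓ₀ = ζ₁ * ζ₁ + ζ₁ * ζ₂ + ζ₂ * ζ₂ + a * (ζ₁ + ζ₂) * ω₁ + b * ω₁ * ω₁
            ℓ∈ = (ζ₁∈ ⟨*⟩ ζ₁∈ ⟨+⟩ ζ₁∈ ⟨*⟩ ζ₂∈ ⟨+⟩ ζ₂∈ ⟨*⟩ ζ₂∈ ⟨+⟩ a∈ ⟨*⟩ (ζ₁∈ ⟨+⟩ ζ₂∈) ⟨*⟩ ω₁∈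
                   ⟨+⟩ b∈ ⟨*⟩ ω₁∈ ⟨*⟩ ω₁∈) ⟨*⟩ δ∈
            ε , ε∈ , Eε≡1 = E-unit ℓ∈
            ℓΔ≡ = trans (ℚ.*-assoc ℓ₀ δ _) (trans (cong (ℓ₀ *_) (trans (ℚ.*-comm δ _) Δδ≡1)) (ℚ.*-identityʳ ℓ₀))
        in line (ℓ₀ * δ) δ ε ℓ∈ δ∈ ε∈ Δδ≡1 ℓΔ≡ (chord-slope curve₁ curve₂ Δδ≡1 ℓΔ≡) Eε≡1

    -- `ω - ω′` is eliminated through the slope `p² μ` of the line joining the two moving points.
    -- What remains is a multiple of `ζ - ζ′`: the slope is Lipschitz in the moving point.
    ℓ-shift : ∀ {ζ₁ ω₁ ζ ω ζ′ ω′ δ ℓ ℓ′ μ} →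
      (1 - p * p * (a * ζ ^ 2 + b * ζ * (ω₁ + ω))) * δ ≡ 1 →
      ℓ * (1 - p * p * (a * ζ ^ 2 + b * ζ * (ω₁ + ω))) ≡
        ζ₁ * ζ₁ + ζ₁ * ζ + ζ * ζ + a * (ζ₁ + ζ) * ω₁ + b * ω₁ * ω₁ →
      ℓ′ * (1 - p * p * (a * ζ′ ^ 2 + b * ζ′ * (ω₁ + ω′))) ≡
        ζ₁ * ζ₁ + ζ₁ * ζ′ + ζ′ * ζ′ + a * (ζ₁ + ζ′) * ω₁ + b * ω₁ * ω₁ →
      ω - ω′ ≡ p * p * μ * (ζ - ζ′) →
      ℓ - ℓ′ ≡ (ζ - ζ′) * ((ζ₁ + ζ + ζ′ + a * ω₁) * δ +
        ℓ′ * δ * (p * p * (a * (ζ + ζ′) + b * (ω₁ + ω) + b * ζ′ * (p * p * μ))))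
    ℓ-shift {ζ₁} {ω₁} {ζ} {ω} {ζ′} {ω′} {δ} {ℓ} {ℓ′} {μ} Δδ≡1 ℓΔ≡ ℓ′Δ′≡ slope = combine
      ((ℓ′ - ℓ) ⋆ Δδ≡1 ⊞ δ ⋆ ℓΔ≡ ⊞ (- δ) ⋆ ℓ′Δ′≡ ⊞ (ℓ′ * δ * p * p * b * ζ′) ⋆ slope)
        (solve₁₃ (λ ℓ ℓ′ ζ ζ′ ζ₁ a ω₁ δ p b ω μ ω′ →
          ℓ :- ℓ′ :- (ζ :- ζ′) :* ((ζ₁ :+ ζ :+ ζ′ :+ a :* ω₁) :* δ :+ ℓ′ :* δ :* (p :* p :* (a
            :* (ζ :+ ζ′) :+ b :* (ω₁ :+ ω) :+ b :* ζ′ :* (p :* p :* μ))))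
          := (ℓ′ :- ℓ) :* ((#1 :- p :* p :* (a :* ζ ² :+ b :* ζ :* (ω₁ :+ ω))) :* δ :- #1) :+ δ
             :* (ℓ :* (#1 :- p :* p :* (a :* ζ ² :+ b :* ζ :* (ω₁ :+ ω))) :- (ζ₁ :* ζ₁ :+ ζ₁ :*
             ζ :+ ζ :* ζ :+ a :* (ζ₁ :+ ζ) :* ω₁ :+ b :* ω₁ :* ω₁)) :+ :- δ :* (ℓ′ :* (#1 :- p
             :* p :* (a :* ζ′ ² :+ b :* ζ′ :* (ω₁ :+ ω′))) :- (ζ₁ :* ζ₁ :+ ζ₁ :* ζ′ :+ ζ′ :* ζ′
             :+ a :* (ζ₁ :+ ζ′) :* ω₁ :+ b :* ω₁ :* ω₁)) :+ ℓ′ :* δ :* p :* p :* b :* ζ′ :* (ω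
             :- ω′ :- p :* p :* μ :* (ζ :- ζ′))) refl ℓ ℓ′ ζ ζ′ ζ₁ a ω₁ δ p b ω μ ω′)

    -- Apart from the summand `ζ`, the moving point enters `ζ₃` only through `p² ℓ`, and differences
    -- of `ℓ` are multiples of `ζ - ζ′`; this yields the factor `1 + p² c`.
    ζ₃-shift : ∀ {ζ₁ ω₁ ζ ζ′ ℓ ℓ′ ε ε′ g} →
      (1 + a * (p * p * ℓ) + b * (p * p * ℓ) ^ 2) * ε ≡ 1 →
      (1 + a * (p * p * ℓ′) + b * (p * p * ℓ′) ^ 2) * ε′ ≡ 1 →
      ℓ - ℓ′ ≡ (ζ - ζ′) * g →
      (ζ₁ + ζ + (ω₁ - p * p * ℓ * ζ₁) * (a + 2 * b * (p * p * ℓ)) * ε) -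
      (ζ₁ + ζ′ + (ω₁ - p * p * ℓ′ * ζ₁) * (a + 2 * b * (p * p * ℓ′)) * ε′) ≡
      (ζ - ζ′) * (1 + p * p * (g *
        ((ω₁ - p * p * ℓ′ * ζ₁) *
           (2 * b * ε - (a + 2 * b * (p * p * ℓ′)) * ε * ε′ * (a + b * (p * p * ℓ + p * p * ℓ′)))
         - ζ₁ * (a + 2 * b * (p * p * ℓ)) * ε)))
    ζ₃-shift {ζ₁} {ω₁} {ζ} {ζ′} {ℓ} {ℓ′} {ε} {ε′} {g} Eε≡1 E′ε′≡1 ℓ-ℓ′≡ = combine
      (((ω₁ - p * p * ℓ′ * ζ₁) * (a + 2 * b * (p * p * ℓ′)) * ε′) ⋆ Eε≡1
        ⊞ (- ((ω₁ - p * p * ℓ′ * ζ₁) * (a + 2 * b * (p * p * ℓ′)) * ε)) ⋆ E′ε′≡1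
        ⊞ (p * p * ((ω₁ - p * p * ℓ′ * ζ₁) *
           (2 * b * ε - (a + 2 * b * (p * p * ℓ′)) * ε * ε′ * (a + b * (p * p * ℓ + p * p * ℓ′)))
         - ζ₁ * (a + 2 * b * (p * p * ℓ)) * ε)) ⋆ ℓ-ℓ′≡)
           (solve₁₂ (λ ζ₁ ζ ω₁ p ℓ a b ε ζ′ ℓ′ ε′ g →
             ζ₁ :+ ζ :+ (ω₁ :- p :* p :* ℓ :* ζ₁) :* (a :+ #2 :* b :* (p :* p :* ℓ)) :* ε :- (ζ₁
               :+ ζ′ :+ (ω₁ :- p :* p :* ℓ′ :* ζ₁) :* (a :+ #2 :* b :* (p :* p :* ℓ′)) :* ε′) :-
               (ζ :- ζ′) :* (#1 :+ p :* p :* (g :* ((ω₁ :- p :* p :* ℓ′ :* ζ₁) :* (#2 :* b :* ε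
               :- (a :+ #2 :* b :* (p :* p :* ℓ′)) :* ε :* ε′ :* (a :+ b :* (p :* p :* ℓ :+ p :*
               p :* ℓ′))) :- ζ₁ :* (a :+ #2 :* b :* (p :* p :* ℓ)) :* ε)))
             := (ω₁ :- p :* p :* ℓ′ :* ζ₁) :* (a :+ #2 :* b :* (p :* p :* ℓ′)) :* ε′ :* ((#1 :+
                a :* (p :* p :* ℓ) :+ b :* (p :* p :* ℓ) ²) :* ε :- #1) :+ :- ((ω₁ :- p :* p :*
                ℓ′ :* ζ₁) :* (a :+ #2 :* b :* (p :* p :* ℓ′)) :* ε) :* ((#1 :+ a :* (p :* p :*
                ℓ′) :+ b :* (p :* p :* ℓ′) ²) :* ε′ :- #1) :+ p :* p :* ((ω₁ :- p :* p :* ℓ′ :*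
                ζ₁) :* (#2 :* b :* ε :- (a :+ #2 :* b :* (p :* p :* ℓ′)) :* ε :* ε′ :* (a :+ b
                :* (p :* p :* ℓ :+ p :* p :* ℓ′))) :- ζ₁ :* (a :+ #2 :* b :* (p :* p :* ℓ)) :*
                ε) :* (ℓ :- ℓ′ :- (ζ :- ζ′) :* g)) refl ζ₁ ζ ω₁ p ℓ a b ε ζ′ ℓ′ ε′ g)

    shift-isometry : ∀ {X Y Y′} (L : Line X Y) (L′ : Line X Y′) → Σ[ c ∈ ℚ ] Local c ×
      Line.ζ₃ L - Line.ζ₃ L′ ≡ (Near.ζ Y - Near.ζ Y′) * (1 + p * p * c)
    shift-isometry {near ζ₁ ω₁ ζ₁∈ ω₁∈ _} {Y@(near ζ ω ζ∈ ω∈ _)} {Y′@(near ζ′ ω′ ζ′∈ ω′∈ _)}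
      L@(line ℓ δ ε ℓ∈ δ∈ ε∈ Δδ≡1 ℓΔ≡ _ Eε≡1) L′@(line ℓ′ _ ε′ ℓ′∈ _ ε′∈ _ ℓ′Δ′≡ _ E′ε′≡1)
      = let μ∈ = Line.ℓ∈ M
            p² = ⟨p⟩ ⟨*⟩ ⟨p⟩
            g∈ = (ζ₁∈ ⟨+⟩ ζ∈ ⟨+⟩ ζ′∈ ⟨+⟩ a∈ ⟨*⟩ ω₁∈) ⟨*⟩ δ∈ ⟨+⟩
              ℓ′∈ ⟨*⟩ δ∈ ⟨*⟩ (p² ⟨*⟩ (a∈ ⟨*⟩ (ζ∈ ⟨+⟩ ζ′∈) ⟨+⟩ b∈ ⟨*⟩ (ω₁∈ ⟨+⟩ ω∈) ⟨+⟩ b∈ ⟨*⟩ ζ′∈ ⟨*⟩ (p² ⟨*⟩ μ∈)))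
        in _ ,
        g∈ ⟨*⟩ ((ω₁∈ ⟨-⟩ p² ⟨*⟩ ℓ′∈ ⟨*⟩ ζ₁∈) ⟨*⟩
            (⟨2⟩ ⟨*⟩ b∈ ⟨*⟩ ε∈ ⟨-⟩ (a∈ ⟨+⟩ ⟨2⟩ ⟨*⟩ b∈ ⟨*⟩ (p² ⟨*⟩ ℓ′∈)) ⟨*⟩ ε∈ ⟨*⟩ ε′∈ ⟨*⟩
               (a∈ ⟨+⟩ b∈ ⟨*⟩ (p² ⟨*⟩ ℓ∈ ⟨+⟩ p² ⟨*⟩ ℓ′∈)))
          ⟨-⟩ ζ₁∈ ⟨*⟩ (a∈ ⟨+⟩ ⟨2⟩ ⟨*⟩ b∈ ⟨*⟩ (p² ⟨*⟩ ℓ∈)) ⟨*⟩ ε∈) ,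
        ζ₃-shift {ζ₁} {ω₁} {ζ} {ζ′} {ℓ} {ℓ′} Eε≡1 E′ε′≡1
          (ℓ-shift {ζ₁} {ω₁} {ζ} {ω} {ζ′} {ω′} {ℓ = ℓ} {ℓ′} Δδ≡1 ℓΔ≡ ℓ′Δ′≡ (Line.slope M))
      where
      M : Line Y Y′
      M = line-through Y Y′

-- Agreement of the chart formulas with `_⊕_`

÷-*-cancel : ∀ p q .{{_ : NonZero q}} → p ÷ q * q ≡ p
÷-*-cancel p q = trans (ℚ.*-assoc p (1/ q) q)
  (trans (cong (p *_) (ℚ.*-inverseˡ q)) (ℚ.*-identityʳ p))

-- The line y = k x + c meets the curve in x₁, x₂, x₃. It is λ z + ν w = 1 in
-- terms of z and w, where ν c = 1 and λ = - ν k.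
module LineSum {a b x₁ x₂ x₃ k c λ′ ν ε z₁ z₂ : ℚ}
  (x₃≡ : x₃ ≡ k ^ 2 - a - x₁ - x₂)
  (b≡ : b ≡ x₁ * x₂ + (x₁ + x₂) * x₃ + 2 * k * c)
  (c²≡ : c ^ 2 ≡ x₁ * x₂ * x₃)
  (λ≡ : λ′ ≡ - (ν * k)) (νc≡1 : ν * c ≡ 1)
  (Eε≡1 : (1 + a * λ′ + b * λ′ ^ 2) * ε ≡ 1)
  (z₁y₁≡x₁ : z₁ * (k * x₁ + c) ≡ x₁) (z₂y₂≡x₂ : z₂ * (k * x₂ + c) ≡ x₂) where

  private
    -- Vieta in the chart, cleared of denominators: with `yᵢ = k xᵢ + c`, the sum of the `xᵢ / yᵢ`
    -- is `- (a c² - 2 b k c) / (y₁ y₂ y₃)`.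
    I≡0 : (x₁ * (k * x₂ + c) + x₂ * (k * x₁ + c)) * (k * x₃ + c)
          + (k * x₁ + c) * (k * x₂ + c) * x₃ + (a * c ^ 2 - 2 * b * k * c) ≡ 0
    I≡0 = combine ((c ^ 2) ⋆ x₃≡ ⊞ (- (2 * k * c)) ⋆ b≡ ⊞ (- (3 * k ^ 2)) ⋆ c²≡)
      (solve₇ (λ x₁ k x₂ c x₃ a b →
        (x₁ :* (k :* x₂ :+ c) :+ x₂ :* (k :* x₁ :+ c)) :* (k :* x₃ :+ c) :+ (k :* x₁ :+ c) :* (k
          :* x₂ :+ c) :* x₃ :+ (a :* c ² :- #2 :* b :* k :* c) :- #0
        := c ² :* (x₃ :- (k ² :- a :- x₁ :- x₂)) :+ :- (#2 :* k :* c) :* (b :- (x₁ :* x₂ :+ (x₁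
           :+ x₂) :* x₃ :+ #2 :* k :* c)) :+ :- (#3 :* k ²) :* (c ² :- x₁ :* x₂ :* x₃))
        refl x₁ k x₂ c x₃ a b)

    scale-I : ∀ {X} → X + (a * c ^ 2 - 2 * b * k * c) ≡ 0 → ν ^ 3 * X + ν * (a - 2 * b * ν * k) ≡ 0
    scale-I {X} I≡0 = combine ((ν ^ 3) ⋆ I≡0 ⊞ (2 * b * ν ^ 2 * k - ν * a * (1 + ν * c)) ⋆ νc≡1)
      (solve₆ (λ ν X a b k c → ν ³ :* X :+ ν :* (a :- #2 :* b :* ν :* k) :- #0
        := ν ³ :* (X :+ (a :* c ² :- #2 :* b :* k :* c) :- #0) :+ (#2 :* b :* ν ² :* k :- ν :* a
           :* (#1 :+ ν :* c)) :* (ν :* c :- #1)) refl ν X a b k c)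

    -- The monic cubic with roots `xᵢ` is `f = X³ + (a - k²) X² + (b - 2 k c) X -
    -- c²`, and the product is the expansion of `- k³ f(- c / k)`. Scaled by `ν³` it becomes the
    -- leading coefficient of the cubic in the chart.
    y₁y₂y₃≡ : (k * x₁ + c) * (k * x₂ + c) * (k * x₃ + c) ≡
              c ^ 3 + k * c ^ 2 * (k ^ 2 - a) + k ^ 2 * c * (b - 2 * k * c) + k ^ 3 * c ^ 2
    y₁y₂y₃≡ = combine
      ((- (k ^ 3)) ⋆ c²≡ ⊞ (k * c ^ 2) ⋆ x₃≡ ⊞ (- (k ^ 2 * c)) ⋆ b≡)
        (solve₇ (λ k x₁ c x₂ x₃ a b →
          (k :* x₁ :+ c) :* (k :* x₂ :+ c) :* (k :* x₃ :+ c) :- (c ³ :+ k :* c ² :* (k ² :- a)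
            :+ k ² :* c :* (b :- #2 :* k :* c) :+ k ³ :* c ²)
          := :- (k ³) :* (c ² :- x₁ :* x₂ :* x₃) :+ k :* c ² :* (x₃ :- (k ² :- a :- x₁ :- x₂))
             :+ :- (k ² :* c) :* (b :- (x₁ :* x₂ :+ (x₁ :+ x₂) :* x₃ :+ #2 :* k :* c)))
          refl k x₁ c x₂ x₃ a b)

    scale-E : ∀ {Y} →
      Y ≡ c ^ 3 + k * c ^ 2 * (k ^ 2 - a) + k ^ 2 * c * (b - 2 * k * c) + k ^ 3 * c ^ 2 →
      1 - a * (ν * k) + b * (ν * k) ^ 2 ≡ ν ^ 3 * Y
    scale-E {Y} Y≡ = combine
      ((- (ν ^ 2 * c ^ 2 + ν * c + 1 - a * ν * k * (ν * c + 1) + b * ν ^ 2 * k ^ 2)) ⋆ νc≡1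
        ⊞ (- (ν ^ 3)) ⋆ Y≡)
          (solve₆ (λ a ν k b Y c → #1 :- a :* (ν :* k) :+ b :* (ν :* k) ² :- ν ³ :* Y
            := :- (ν ² :* c ² :+ ν :* c :+ #1 :- a :* ν :* k :* (ν :* c :+ #1) :+ b :* ν ² :* k
               ²) :* (ν :* c :- #1) :+ :- (ν ³) :* (Y :- (c ³ :+ k :* c ² :* (k ² :- a) :+ k ²
               :* c :* (b :- #2 :* k :* c) :+ k ³ :* c ²))) refl a ν k b Y c)

    E′ε≡1 : (1 - a * (ν * k) + b * (ν * k) ^ 2) * ε ≡ 1
    E′ε≡1 = combine (1 ⋆ Eε≡1 ⊞ (- (a * ε + b * ε * (λ′ - ν * k))) ⋆ λ≡)
      (solve₆ (λ a ν k b ε λ′ → (#1 :- a :* (ν :* k) :+ b :* (ν :* k) ²) :* ε :- #1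
        := #1 :* ((#1 :+ a :* λ′ :+ b :* λ′ ²) :* ε :- #1) :+ :- (a :* ε :+ b :* ε :* (λ′ :- ν
           :* k)) :* (λ′ :- :- (ν :* k))) refl a ν k b ε λ′)

    quotient : ∀ {Y₁ Y₂ Y₃ E M n} → E * ε ≡ 1 → E ≡ n * (Y₁ * Y₂ * Y₃) → z₁ * Y₁ ≡ x₁ → z₂ * Y₂ ≡ x₂ →
      n * ((x₁ * Y₂ + x₂ * Y₁) * Y₃ + Y₁ * Y₂ * x₃) + M ≡ 0 → (z₁ + z₂ + M * ε) * (- Y₃) ≡ x₃
    quotient {Y₁} {Y₂} {Y₃} {E} {M} {n} Eε≡1 E≡ z₁Y₁≡ z₂Y₂≡ M≡ = cancel-combine E≢0
      ((- (M * Y₃)) ⋆ Eε≡1 ⊞ (- ((z₁ + z₂) * Y₃ + x₃)) ⋆ E≡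
       ⊞ (- (n * Y₂ * Y₃ * Y₃)) ⋆ z₁Y₁≡ ⊞ (- (n * Y₁ * Y₃ * Y₃)) ⋆ z₂Y₂≡ ⊞ (- Y₃) ⋆ M≡)
         (solve₁₂ (λ E z₁ z₂ M ε Y₃ x₃ n Y₁ Y₂ x₁ x₂ →
           E :* ((z₁ :+ z₂ :+ M :* ε) :* (:- Y₃) :- x₃)
           := :- (M :* Y₃) :* (E :* ε :- #1) :+ :- ((z₁ :+ z₂) :* Y₃ :+ x₃) :* (E :- n :* (Y₁ :*
              Y₂ :* Y₃)) :+ :- (n :* Y₂ :* Y₃ :* Y₃) :* (z₁ :* Y₁ :- x₁) :+ :- (n :* Y₁ :* Y₃ :*
              Y₃) :* (z₂ :* Y₂ :- x₂) :+ :- Y₃ :* (n :* ((x₁ :* Y₂ :+ x₂ :* Y₁) :* Y₃ :+ Y₁ :*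
              Y₂ :* x₃) :+ M :- #0)) refl E z₁ z₂ M ε Y₃ x₃ n Y₁ Y₂ x₁ x₂)
      where
      E≢0 : E ≢ 0
      E≢0 E≡0 with trans (sym Eε≡1) (trans (cong (_* ε) E≡0) (ℚ.*-zeroˡ ε))
      ... | ()

    z-coordinate′ : (z₁ + z₂ + ν * (a - 2 * b * ν * k) * ε) * (- (k * x₃ + c)) ≡ x₃
    z-coordinate′ = quotient {M = ν * (a - 2 * b * ν * k)} {ν ^ 3} E′ε≡1 (scale-E y₁y₂y₃≡) z₁y₁≡x₁ z₂y₂≡x₂
      (scale-I {(x₁ * (k * x₂ + c) + x₂ * (k * x₁ + c)) * (k * x₃ + c)
                + (k * x₁ + c) * (k * x₂ + c) * x₃} I≡0)

  z-coordinate : (z₁ + z₂ + ν * (a + 2 * b * λ′) * ε) * (k * (x₁ - x₃) - (k * x₁ + c)) ≡ x₃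
  z-coordinate = combine (1 ⋆ z-coordinate′ ⊞ (- (2 * b * ν * ε * (k * x₃ + c))) ⋆ λ≡)
    (solve₁₁ (λ z₁ z₂ ν a b λ′ ε k x₁ x₃ c →
      (z₁ :+ z₂ :+ ν :* (a :+ #2 :* b :* λ′) :* ε) :* (k :* (x₁ :- x₃) :- (k :* x₁ :+ c)) :- x₃
      := #1 :* ((z₁ :+ z₂ :+ ν :* (a :- #2 :* b :* ν :* k) :* ε) :* (:- (k :* x₃ :+ c)) :- x₃)
         :+ :- (#2 :* b :* ν :* ε :* (k :* x₃ :+ c)) :* (λ′ :- :- (ν :* k)))
      refl z₁ z₂ ν a b λ′ ε k x₁ x₃ c)

  w-coordinate : (λ′ * (z₁ + z₂ + ν * (a + 2 * b * λ′) * ε) - ν) * (k * (x₁ - x₃) - (k * x₁ + c)) ≡ 1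
  w-coordinate = combine (λ′ ⋆ z-coordinate ⊞ x₃ ⋆ λ≡ ⊞ 1 ⋆ νc≡1)
    (solve₁₁ (λ λ′ z₁ z₂ ν a b ε k x₁ x₃ c →
      (λ′ :* (z₁ :+ z₂ :+ ν :* (a :+ #2 :* b :* λ′) :* ε) :- ν) :* (k :* (x₁ :- x₃) :- (k :* x₁
        :+ c)) :- #1
      := λ′ :* ((z₁ :+ z₂ :+ ν :* (a :+ #2 :* b :* λ′) :* ε) :* (k :* (x₁ :- x₃) :- (k :* x₁ :+
         c)) :- x₃) :+ x₃ :* (λ′ :- :- (ν :* k)) :+ #1 :* (ν :* c :- #1))
      refl λ′ z₁ z₂ ν a b ε k x₁ x₃ c)

-- Vieta for the line through two points with distinct `x`: the second and third symmetric functions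
-- are `b - 2 k c` and `c²`, where `c = y₁ - k x₁`. The former is the difference of the curve
-- equations divided by `x₁ - x₂`; the latter follows from it and the first curve equation.
module Secant {a b x₁ y₁ x₂ y₂ k : ℚ} (x₁≢x₂ : x₁ ≢ x₂)
  (curve₁ : y₁ ^ 2 ≡ x₁ ^ 3 + a * x₁ ^ 2 + b * x₁)
  (curve₂ : y₂ ^ 2 ≡ x₂ ^ 3 + a * x₂ ^ 2 + b * x₂)
  (k≡ : k * (x₂ - x₁) ≡ y₂ - y₁) where

  x₁-x₂≢0 : x₁ - x₂ ≢ 0
  x₁-x₂≢0 = x₁≢x₂ ∘ p-q≡0⇒p≡q

  b≡ : b ≡ x₁ * x₂ + (x₁ + x₂) * (k ^ 2 - a - x₁ - x₂) + 2 * k * (y₁ - k * x₁)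
  b≡ = cancel-combine x₁-x₂≢0
    ((- 1) ⋆ curve₁ ⊞ 1 ⋆ curve₂ ⊞ (y₂ + y₁ + k * (x₂ - x₁)) ⋆ k≡)
      (solve₇ (λ x₁ x₂ b k a y₁ y₂ →
        (x₁ :- x₂) :* (b :- (x₁ :* x₂ :+ (x₁ :+ x₂) :* (k ² :- a :- x₁ :- x₂) :+ #2 :* k :* (y₁
          :- k :* x₁)))
        := :- #1 :* (y₁ ² :- (x₁ ³ :+ a :* x₁ ² :+ b :* x₁)) :+ #1 :* (y₂ ² :- (x₂ ³ :+ a :* x₂
           ² :+ b :* x₂)) :+ (y₂ :+ y₁ :+ k :* (x₂ :- x₁)) :* (k :* (x₂ :- x₁) :- (y₂ :- y₁)))
        refl x₁ x₂ b k a y₁ y₂)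

  c²≡ : (y₁ - k * x₁) ^ 2 ≡ x₁ * x₂ * (k ^ 2 - a - x₁ - x₂)
  c²≡ = combine (1 ⋆ curve₁ ⊞ x₁ ⋆ b≡)
    (solve₆ (λ y₁ k x₁ x₂ a b → (y₁ :- k :* x₁) ² :- x₁ :* x₂ :* (k ² :- a :- x₁ :- x₂)
      := #1 :* (y₁ ² :- (x₁ ³ :+ a :* x₁ ² :+ b :* x₁)) :+ x₁ :* (b :- (x₁ :* x₂ :+ (x₁ :+ x₂)
         :* (k ² :- a :- x₁ :- x₂) :+ #2 :* k :* (y₁ :- k :* x₁)))) refl y₁ k x₁ x₂ a b)

-- The same relations with `x` as a double root; now the first one is the tangency condition itself.
module Tangent {a b x y k : ℚ}
  (curve : y ^ 2 ≡ x ^ 3 + a * x ^ 2 + b * x)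
  (k≡ : k * (2 * y) ≡ 3 * x ^ 2 + 2 * a * x + b) where

  b≡ : b ≡ x * x + (x + x) * (k ^ 2 - a - x - x) + 2 * k * (y - k * x)
  b≡ = combine ((- 1) ⋆ k≡)
    (solve₅ (λ b x k a y →
      b :- (x :* x :+ (x :+ x) :* (k ² :- a :- x :- x) :+ #2 :* k :* (y :- k :* x))
      := :- #1 :* (k :* (#2 :* y) :- (#3 :* x ² :+ #2 :* a :* x :+ b))) refl b x k a y)

  c²≡ : (y - k * x) ^ 2 ≡ x * x * (k ^ 2 - a - x - x)
  c²≡ = combine (1 ⋆ curve ⊞ (- x) ⋆ k≡)
    (solve₅ (λ y k x a b → (y :- k :* x) ² :- x :* x :* (k ² :- a :- x :- x)
      := #1 :* (y ² :- (x ³ :+ a :* x ² :+ b :* x)) :+ :- x :* (k :* (#2 :* y) :- (#3 :* x ² :+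
         #2 :* a :* x :+ b))) refl y k x a b)

p*q≡1⇒q≢0 : ∀ p {q} → p * q ≡ 1 → q ≢ 0
p*q≡1⇒q≢0 p pq≡1 refl with trans (sym pq≡1) (ℚ.*-zeroʳ p)
... | ()

*-cancelʳ-≡ : ∀ p q {r} → r ≢ 0 → p * r ≡ q * r → p ≡ q
*-cancelʳ-≡ p q {r} r≢0 pr≡qr = cancel-combine r≢0 (1 ⋆ pr≡qr)
  (solve₃ (λ r p q → r :* (p :- q)
    := #1 :* (p :* r :- q :* r)) refl r p q)

square-roots : ∀ {y₁ y₂} → y₁ ^ 2 ≡ y₂ ^ 2 → y₁ ≢ - y₂ → y₁ ≡ y₂
square-roots {y₁} {y₂} y₁²≡y₂² y₁≢-y₂ = cancel-combine y₁+y₂≢0 (1 ⋆ y₁²≡y₂²)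
  (solve₂ (λ y₁ y₂ → (y₁ :+ y₂) :* (y₁ :- y₂)
    := #1 :* (y₁ ² :- y₂ ²)) refl y₁ y₂)
  where
  y₁+y₂≢0 : y₁ + y₂ ≢ 0
  y₁+y₂≢0 eq = y₁≢-y₂ (combine (1 ⋆ eq)
    (solve₂ (λ y₁ y₂ → y₁ :- :- y₂
      := #1 :* (y₁ :+ y₂ :- #0)) refl y₁ y₂))

-- A line through two points of the chart, written w = λ′ z + ν.
module ChartLine {a b z₁ w₁ z₂ w₂ λ′ ν ε : ℚ}
  (slope : w₁ - w₂ ≡ λ′ * (z₁ - z₂))
  (tangent : λ′ * (1 - (a * z₂ ^ 2 + b * z₂ * (w₁ + w₂))) ≡
             z₁ * z₁ + z₁ * z₂ + z₂ * z₂ + a * (z₁ + z₂) * w₁ + b * w₁ * w₁)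
  (ν≡ : ν ≡ w₁ - λ′ * z₁)
  (Eε≡1 : (1 + a * λ′ + b * λ′ ^ 2) * ε ≡ 1) where

  on-line₁ : ∀ {x y} → z₁ * y ≡ x → w₁ * y ≡ 1 → ν * y ≡ 1 - λ′ * x
  on-line₁ {x} {y} z₁y≡x w₁y≡1 = combine (y ⋆ ν≡ ⊞ (- λ′) ⋆ z₁y≡x ⊞ 1 ⋆ w₁y≡1)
    (solve₆ (λ ν y λ′ x w₁ z₁ → ν :* y :- (#1 :- λ′ :* x)
      := y :* (ν :- (w₁ :- λ′ :* z₁)) :+ :- λ′ :* (z₁ :* y :- x) :+ #1 :* (w₁ :* y :- #1))
      refl ν y λ′ x w₁ z₁)

  on-line₂ : ∀ {x y} → z₂ * y ≡ x → w₂ * y ≡ 1 → ν * y ≡ 1 - λ′ * x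
  on-line₂ {x} {y} z₂y≡x w₂y≡1 =
    combine (y ⋆ ν≡ ⊞ y ⋆ slope ⊞ (- λ′) ⋆ z₂y≡x ⊞ 1 ⋆ w₂y≡1)
      (solve₈ (λ ν y λ′ x w₁ z₁ w₂ z₂ → ν :* y :- (#1 :- λ′ :* x)
        := y :* (ν :- (w₁ :- λ′ :* z₁)) :+ y :* (w₁ :- w₂ :- λ′ :* (z₁ :- z₂)) :+ :- λ′ :* (z₂
           :* y :- x) :+ #1 :* (w₂ :* y :- #1)) refl ν y λ′ x w₁ z₁ w₂ z₂)

  -- `ν = 0` says that the line passes through the origin `∞`, as it does when a summand is `∞` or
  -- the two are opposite; the sum formula then loses its correction term.
  ν≡0⇒z₃≡ : ν ≡ 0 → z₁ + z₂ ≡ z₁ + z₂ + ν * (a + 2 * b * λ′) * ε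
  ν≡0⇒z₃≡ ν≡0 = combine ((- ((a + 2 * b * λ′) * ε)) ⋆ ν≡0)
    (solve₇ (λ z₁ z₂ ν a b λ′ ε → z₁ :+ z₂ :- (z₁ :+ z₂ :+ ν :* (a :+ #2 :* b :* λ′) :* ε)
      := :- ((a :+ #2 :* b :* λ′) :* ε) :* (ν :- #0)) refl z₁ z₂ ν a b λ′ ε)

  ν≡0⇒w₃≡ : ν ≡ 0 → λ′ * (z₁ + z₂) ≡ λ′ * (z₁ + z₂ + ν * (a + 2 * b * λ′) * ε) - ν
  ν≡0⇒w₃≡ ν≡0 = combine ((1 - λ′ * (a + 2 * b * λ′) * ε) ⋆ ν≡0)
    (solve₇ (λ λ′ z₁ z₂ ν a b ε →
      λ′ :* (z₁ :+ z₂) :- (λ′ :* (z₁ :+ z₂ :+ ν :* (a :+ #2 :* b :* λ′) :* ε) :- ν)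
      := (#1 :- λ′ :* (a :+ #2 :* b :* λ′) :* ε) :* (ν :- #0)) refl λ′ z₁ z₂ ν a b ε)

  secant-λ≡ : ∀ {x₁ y₁ x₂ y₂ k} → x₁ ≢ x₂ → k * (x₂ - x₁) ≡ y₂ - y₁ →
    ν * y₁ ≡ 1 - λ′ * x₁ → ν * y₂ ≡ 1 - λ′ * x₂ → λ′ ≡ - (ν * k)
  secant-λ≡ {x₁} {y₁} {x₂} {y₂} {k} x₁≢x₂ k≡ l₁ l₂ = cancel-combine (x₁≢x₂ ∘ p-q≡0⇒p≡q)
    (1 ⋆ l₁ ⊞ (- 1) ⋆ l₂ ⊞ (- ν) ⋆ k≡)
      (solve₇ (λ x₁ x₂ λ′ ν k y₁ y₂ → (x₁ :- x₂) :* (λ′ :- :- (ν :* k))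
        := #1 :* (ν :* y₁ :- (#1 :- λ′ :* x₁)) :+ :- #1 :* (ν :* y₂ :- (#1 :- λ′ :* x₂)) :+ :- ν
           :* (k :* (x₂ :- x₁) :- (y₂ :- y₁))) refl x₁ x₂ λ′ ν k y₁ y₂)

  -- Both slopes come from implicit differentiation, one in `(z , w)` and one in `(x , y)`.
  -- Multiplying the first by `y²` gives them the same right-hand side `3 x² + 2 a x + b`.
  tangent-λ≡ : ∀ {x y k} → y ^ 2 ≡ x ^ 3 + a * x ^ 2 + b * x → z₁ ≡ z₂ → w₁ ≡ w₂ →
    z₁ * y ≡ x → w₁ * y ≡ 1 → k * (2 * y) ≡ 3 * x ^ 2 + 2 * a * x + b → λ′ ≡ - (ν * k)
  tangent-λ≡ {x} {y} {k} curve z₁≡z₂ w₁≡w₂ z₁y≡x w₁y≡1 k≡ =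
    *-cancelʳ-≡ λ′ (- (ν * k)) y≢0 (*-cancelʳ-≡ (λ′ * y) (- (ν * k) * y) y≢0 (*-cancelʳ-≡ (λ′ * y * y) (- (ν * k) * y * y) {2} (λ ()) (combine
      ((- 1) ⋆ scaled z₁≡z₂ w₁≡w₂ tangent ⊞ (3 * λ′) ⋆ curve
        ⊞ (2 * y * k) ⋆ on-line₁ z₁y≡x w₁y≡1 ⊞ (1 - λ′ * x) ⋆ k≡)
          (solve₇ (λ λ′ y ν k a x b → λ′ :* y :* y :* #2 :- :- (ν :* k) :* y :* y :* #2
            := :- #1 :* (λ′ :* (y ² :- a :* x ² :- #2 :* b :* x) :- (#3 :* x ² :+ #2 :* a :* x
               :+ b)) :+ #3 :* λ′ :* (y ² :- (x ³ :+ a :* x ² :+ b :* x)) :+ #2 :* y :* k :* (ν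
               :* y :- (#1 :- λ′ :* x)) :+ (#1 :- λ′ :* x) :* (k :* (#2 :* y) :- (#3 :* x ² :+
               #2 :* a :* x :+ b))) refl λ′ y ν k a x b))))
    where
    y≢0 : y ≢ 0
    y≢0 = p*q≡1⇒q≢0 w₁ w₁y≡1
    scaled : ∀ {z₂ w₂} → z₁ ≡ z₂ → w₁ ≡ w₂ →
      λ′ * (1 - (a * z₂ ^ 2 + b * z₂ * (w₁ + w₂))) ≡
        z₁ * z₁ + z₁ * z₂ + z₂ * z₂ + a * (z₁ + z₂) * w₁ + b * w₁ * w₁ →
      λ′ * (y ^ 2 - a * x ^ 2 - 2 * b * x) ≡ 3 * x ^ 2 + 2 * a * x + b
    scaled {z₂} {w₂} refl refl tangent = combine
      ((y ^ 2) ⋆ tangent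
       ⊞ ((a * λ′ + 3) * (z₁ * y + x) + (2 * a + 2 * b * λ′) * (w₁ * y)) ⋆ z₁y≡x
       ⊞ (2 * a * x + 2 * b * λ′ * x + b * (w₁ * y + 1)) ⋆ w₁y≡1)
         (solve₇ (λ λ′ y a x b z₁ w₁ →
           λ′ :* (y ² :- a :* x ² :- #2 :* b :* x) :- (#3 :* x ² :+ #2 :* a :* x :+ b)
           := y ² :* (λ′ :* (#1 :- (a :* z₁ ² :+ b :* z₁ :* (w₁ :+ w₁))) :- (z₁ :* z₁ :+ z₁ :*
              z₁ :+ z₁ :* z₁ :+ a :* (z₁ :+ z₁) :* w₁ :+ b :* w₁ :* w₁)) :+ ((a :* λ′ :+ #3) :*
              (z₁ :* y :+ x) :+ (#2 :* a :+ #2 :* b :* λ′) :* (w₁ :* y)) :* (z₁ :* y :- x) :+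
              (#2 :* a :* x :+ #2 :* b :* λ′ :* x :+ b :* (w₁ :* y :+ #1)) :* (w₁ :* y :- #1))
           refl λ′ y a x b z₁ w₁)

  -- Opposite points have opposite chart coordinates, and adding the equations `wᵢ = λ′ zᵢ + ν`
  -- gives `2 ν = 0`.
  opposite : ∀ {x y₁ y₂} → z₁ * y₁ ≡ x → w₁ * y₁ ≡ 1 → z₂ * y₂ ≡ x → w₂ * y₂ ≡ 1 → y₁ ≡ - y₂ →
    ν ≡ 0 × z₁ + z₂ ≡ 0
  opposite {x} {y₁} {y₂} z₁y₁≡x w₁y₁≡1 z₂y₂≡x w₂y₂≡1 y₁≡-y₂ =
    *-cancelʳ-≡ ν 0 {2} (λ ()) (combine
      (2 ⋆ ν≡ ⊞ 1 ⋆ slope ⊞ 1 ⋆ w₁+w₂≡0 ⊞ (- λ′) ⋆ z₁+z₂≡0)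
        (solve₆ (λ ν w₁ λ′ z₁ w₂ z₂ → ν :* #2 :- #0 :* #2
          := #2 :* (ν :- (w₁ :- λ′ :* z₁)) :+ #1 :* (w₁ :- w₂ :- λ′ :* (z₁ :- z₂)) :+ #1 :* (w₁
             :+ w₂ :- #0) :+ :- λ′ :* (z₁ :+ z₂ :- #0)) refl ν w₁ λ′ z₁ w₂ z₂)) ,
    z₁+z₂≡0
    where
    z₁+z₂≡0 : z₁ + z₂ ≡ 0
    z₁+z₂≡0 = *-cancelʳ-≡ (z₁ + z₂) 0 (p*q≡1⇒q≢0 w₂ w₂y₂≡1)
      (combine ((- 1) ⋆ z₁y₁≡x ⊞ 1 ⋆ z₂y₂≡x ⊞ z₁ ⋆ y₁≡-y₂)
        (solve₅ (λ z₁ z₂ y₂ y₁ x → (z₁ :+ z₂) :* y₂ :- #0 :* y₂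
          := :- #1 :* (z₁ :* y₁ :- x) :+ #1 :* (z₂ :* y₂ :- x) :+ z₁ :* (y₁ :- :- y₂))
          refl z₁ z₂ y₂ y₁ x))
    w₁+w₂≡0 : w₁ + w₂ ≡ 0
    w₁+w₂≡0 = *-cancelʳ-≡ (w₁ + w₂) 0 (p*q≡1⇒q≢0 w₂ w₂y₂≡1)
      (combine ((- 1) ⋆ w₁y₁≡1 ⊞ 1 ⋆ w₂y₂≡1 ⊞ w₁ ⋆ y₁≡-y₂)
        (solve₄ (λ w₁ w₂ y₂ y₁ → (w₁ :+ w₂) :* y₂ :- #0 :* y₂
          := :- #1 :* (w₁ :* y₁ :- #1) :+ #1 :* (w₂ :* y₂ :- #1) :+ w₁ :* (y₁ :- :- y₂))
          refl w₁ w₂ y₂ y₁))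

  module _ {x₁ y₁ x₂ y₂ k : ℚ} (z₁y₁≡x₁ : z₁ * y₁ ≡ x₁) (w₁y₁≡1 : w₁ * y₁ ≡ 1)
    (z₂y₂≡x₂ : z₂ * y₂ ≡ x₂)
    (λ≡ : λ′ ≡ - (ν * k)) (k≡ : k * (x₂ - x₁) ≡ y₂ - y₁)
    (b≡ : b ≡ x₁ * x₂ + (x₁ + x₂) * (k ^ 2 - a - x₁ - x₂) + 2 * k * (y₁ - k * x₁))
    (c²≡ : (y₁ - k * x₁) ^ 2 ≡ x₁ * x₂ * (k ^ 2 - a - x₁ - x₂)) where

    private
      νc≡1 : ν * (y₁ - k * x₁) ≡ 1
      νc≡1 = combine (1 ⋆ on-line₁ z₁y₁≡x₁ w₁y₁≡1 ⊞ (- x₁) ⋆ λ≡)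
        (solve₅ (λ ν y₁ k x₁ λ′ → ν :* (y₁ :- k :* x₁) :- #1
          := #1 :* (ν :* y₁ :- (#1 :- λ′ :* x₁)) :+ :- x₁ :* (λ′ :- :- (ν :* k)))
          refl ν y₁ k x₁ λ′)

      y₁≡ : y₁ ≡ k * x₁ + (y₁ - k * x₁)
      y₁≡ = solve₃ (λ y₁ k x₁ → y₁ := k :* x₁ :+ (y₁ :- k :* x₁)) refl y₁ k x₁

      y₂≡ : y₂ ≡ k * x₂ + (y₁ - k * x₁)
      y₂≡ = combine ((- 1) ⋆ k≡)
        (solve₅ (λ y₂ k x₂ y₁ x₁ → y₂ :- (k :* x₂ :+ (y₁ :- k :* x₁))
          := :- #1 :* (k :* (x₂ :- x₁) :- (y₂ :- y₁))) refl y₂ k x₂ y₁ x₁)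

      module Sum = LineSum {a} {b} {x₁} {x₂} {k = k} {y₁ - k * x₁} {λ′} {ν} {ε} {z₁} {z₂} refl b≡ c²≡ λ≡ νc≡1 Eε≡1
        (trans (cong (z₁ *_) (sym y₁≡)) z₁y₁≡x₁) (trans (cong (z₂ *_) (sym y₂≡)) z₂y₂≡x₂)

      y₃≡ : ∀ x₃ → k * (x₁ - x₃) - y₁ ≡ k * (x₁ - x₃) - (k * x₁ + (y₁ - k * x₁))
      y₃≡ x₃ = cong (λ y → k * (x₁ - x₃) - y) y₁≡

    -- Serves chords and tangents alike, the latter with both points equal: the two cases differ
    -- only in how the Vieta relations and `λ′ = - ν k` are obtained.
    third-At : let x₃ = k ^ 2 - a - x₁ - x₂
                   z₃ = z₁ + z₂ + ν * (a + 2 * b * λ′) * ε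
                   y₃ = k * (x₁ - x₃) - y₁
               in z₃ * y₃ ≡ x₃ × (λ′ * z₃ - ν) * y₃ ≡ 1
    third-At = trans (cong ((z₁ + z₂ + ν * (a + 2 * b * λ′) * ε) *_) (y₃≡ (k ^ 2 - a - x₁ - x₂))) Sum.z-coordinate ,
               trans (cong ((λ′ * (z₁ + z₂ + ν * (a + 2 * b * λ′) * ε) - ν) *_) (y₃≡ (k ^ 2 - a - x₁ - x₂))) Sum.w-coordinate

  chord-At : ∀ {x₁ y₁ x₂ y₂ k} → x₁ ≢ x₂ →
    y₁ ^ 2 ≡ x₁ ^ 3 + a * x₁ ^ 2 + b * x₁ → y₂ ^ 2 ≡ x₂ ^ 3 + a * x₂ ^ 2 + b * x₂ →
    z₁ * y₁ ≡ x₁ → w₁ * y₁ ≡ 1 → z₂ * y₂ ≡ x₂ → w₂ * y₂ ≡ 1 → k * (x₂ - x₁) ≡ y₂ - y₁ →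
    let x₃ = k ^ 2 - a - x₁ - x₂
        z₃ = z₁ + z₂ + ν * (a + 2 * b * λ′) * ε
        y₃ = k * (x₁ - x₃) - y₁
    in z₃ * y₃ ≡ x₃ × (λ′ * z₃ - ν) * y₃ ≡ 1
  chord-At {x₁} {y₁} {x₂} {y₂} {k} x₁≢x₂ curve₁ curve₂ z₁y₁≡x₁ w₁y₁≡1 z₂y₂≡x₂ w₂y₂≡1 k≡ =
    third-At {x₁} {y₁} {x₂} {y₂} {k} z₁y₁≡x₁ w₁y₁≡1 z₂y₂≡x₂
      (secant-λ≡ {x₁} {y₁} {x₂} {y₂} {k} x₁≢x₂ k≡ (on-line₁ z₁y₁≡x₁ w₁y₁≡1) (on-line₂ z₂y₂≡x₂ w₂y₂≡1))
      k≡ S.b≡ S.c²≡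
    where module S = Secant {a} {b} {x₁} {y₁} {x₂} {y₂} {k} x₁≢x₂ curve₁ curve₂ k≡

  opposite-At : ∀ {x₁ y₁ x₂ y₂} → x₁ ≡ x₂ →
    z₁ * y₁ ≡ x₁ → w₁ * y₁ ≡ 1 → z₂ * y₂ ≡ x₂ → w₂ * y₂ ≡ 1 → y₁ ≡ - y₂ →
    let z₃ = z₁ + z₂ + ν * (a + 2 * b * λ′) * ε in z₃ ≡ 0 × λ′ * z₃ - ν ≡ 0
  opposite-At refl z₁y₁≡x₁ w₁y₁≡1 z₂y₂≡x₂ w₂y₂≡1 y₁≡-y₂ =
    let ν≡0 , z₁+z₂≡0 = opposite z₁y₁≡x₁ w₁y₁≡1 z₂y₂≡x₂ w₂y₂≡1 y₁≡-y₂ in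
    trans (sym (ν≡0⇒z₃≡ ν≡0)) z₁+z₂≡0 ,
    trans (sym (ν≡0⇒w₃≡ ν≡0)) (trans (cong (λ′ *_) z₁+z₂≡0) (ℚ.*-zeroʳ λ′))

  tangent-At : ∀ {x₁ y₁ x₂ y₂ k} → x₁ ≡ x₂ → y₁ ≢ - y₂ →
    y₁ ^ 2 ≡ x₁ ^ 3 + a * x₁ ^ 2 + b * x₁ → y₂ ^ 2 ≡ x₂ ^ 3 + a * x₂ ^ 2 + b * x₂ →
    z₁ * y₁ ≡ x₁ → w₁ * y₁ ≡ 1 → z₂ * y₂ ≡ x₂ → w₂ * y₂ ≡ 1 →
    k * (2 * y₁) ≡ 3 * x₁ ^ 2 + 2 * a * x₁ + b →
    let x₃ = k ^ 2 - a - x₁ - x₁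
        z₃ = z₁ + z₂ + ν * (a + 2 * b * λ′) * ε
        y₃ = k * (x₁ - x₃) - y₁
    in z₃ * y₃ ≡ x₃ × (λ′ * z₃ - ν) * y₃ ≡ 1
  tangent-At {x₁} {y₁} {_} {y₂} {k} refl y₁≢-y₂ curve₁ curve₂ z₁y₁≡x₁ w₁y₁≡1 z₂y₂≡x₂ w₂y₂≡1 k≡ =
    third-At {x₁} {y₁} {x₁} {y₁} {k} z₁y₁≡x₁ w₁y₁≡1 (trans (cong (z₂ *_) y₁≡y₂) z₂y₂≡x₂)
      (tangent-λ≡ {x₁} {y₁} {k} curve₁ z₁≡z₂ w₁≡w₂ z₁y₁≡x₁ w₁y₁≡1 k≡) k≡0 T.b≡ T.c²≡
    where
    module T = Tangent {a} {b} {x₁} {y₁} {k} curve₁ k≡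
    y₁≡y₂ : y₁ ≡ y₂
    y₁≡y₂ = square-roots {y₁} {y₂} (trans curve₁ (sym curve₂)) y₁≢-y₂
    y₁≢0 : y₁ ≢ 0
    y₁≢0 = p*q≡1⇒q≢0 w₁ w₁y₁≡1
    z₁≡z₂ : z₁ ≡ z₂
    z₁≡z₂ = *-cancelʳ-≡ z₁ z₂ y₁≢0 (trans z₁y₁≡x₁ (sym (trans (cong (z₂ *_) y₁≡y₂) z₂y₂≡x₂)))
    w₁≡w₂ : w₁ ≡ w₂
    w₁≡w₂ = *-cancelʳ-≡ w₁ w₂ y₁≢0 (trans w₁y₁≡1 (sym (trans (cong (w₂ *_) y₁≡y₂) w₂y₂≡1)))
    k≡0 : k * (x₁ - x₁) ≡ y₁ - y₁
    k≡0 = solve₃ (λ k x₁ y₁ → k :* (x₁ :- x₁) := y₁ :- y₁) refl k x₁ y₁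

infix 4 _At_

-- Multiplicative form of `z = x / y`, `w = 1 / y`: the equation `w y = 1` makes `y` nonzero, so
-- points of order two have no chart coordinates.
_At_ : ∀ {E} → Point E → ℚ × ℚ → Set
∞            At (z , w) = z ≡ 0 × w ≡ 0
affine x y _ At (z , w) = z * y ≡ x × w * y ≡ 1

At-resp : ∀ {E} (P : Point E) {z w z′ w′} → z ≡ z′ → w ≡ w′ → P At (z , w) → P At (z′ , w′)
At-resp P refl refl at = at

module _ (E : EllipticCurve) where
  open EllipticCurve E

  module ChartAddition {z₁ w₁ z₂ w₂ λ′ ν ε : ℚ}
    (slope : w₁ - w₂ ≡ λ′ * (z₁ - z₂))
    (tangent : λ′ * (1 - (a * z₂ ^ 2 + b * z₂ * (w₁ + w₂))) ≡
               z₁ * z₁ + z₁ * z₂ + z₂ * z₂ + a * (z₁ + z₂) * w₁ + b * w₁ * w₁)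
    (ν≡ : ν ≡ w₁ - λ′ * z₁)
    (Eε≡1 : (1 + a * λ′ + b * λ′ ^ 2) * ε ≡ 1) where

    open ChartLine {a} {b} {z₁} {w₁} {z₂} {w₂} {λ′} {ν} {ε} slope tangent ν≡ Eε≡1

    -- One formula covers every clause of `_⊕_`: the line stays defined when the points coincide,
    -- and the clauses for `∞` and for opposite points are those with `ν = 0`.
    ⊕-At : (P Q : Point E) → P At (z₁ , w₁) → Q At (z₂ , w₂) →
      P ⊕ Q At (z₁ + z₂ + ν * (a + 2 * b * λ′) * ε , λ′ * (z₁ + z₂ + ν * (a + 2 * b * λ′) * ε) - ν)
    ⊕-At ∞ Q (z₁≡0 , w₁≡0) Q-at = At-resp Q {z₂} {w₂}
      (trans (combine ((- 1) ⋆ z₁≡0)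
        (solve₂ (λ z₂ z₁ → z₂ :- (z₁ :+ z₂)
          := :- #1 :* (z₁ :- #0)) refl z₂ z₁)) (ν≡0⇒z₃≡ ν≡0))
      (trans (combine ((- 1) ⋆ slope ⊞ 1 ⋆ w₁≡0 ⊞ (- (2 * λ′)) ⋆ z₁≡0)
        (solve₅ (λ w₂ λ′ z₁ z₂ w₁ → w₂ :- λ′ :* (z₁ :+ z₂)
          := :- #1 :* (w₁ :- w₂ :- λ′ :* (z₁ :- z₂)) :+ #1 :* (w₁ :- #0) :+ :- (#2 :* λ′) :* (z₁
             :- #0)) refl w₂ λ′ z₁ z₂ w₁)) (ν≡0⇒w₃≡ ν≡0))
      Q-at
      where
      ν≡0 : ν ≡ 0
      ν≡0 = combine (1 ⋆ ν≡ ⊞ 1 ⋆ w₁≡0 ⊞ (- λ′) ⋆ z₁≡0)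
        (solve₄ (λ ν w₁ λ′ z₁ → ν :- #0
          := #1 :* (ν :- (w₁ :- λ′ :* z₁)) :+ #1 :* (w₁ :- #0) :+ :- λ′ :* (z₁ :- #0))
          refl ν w₁ λ′ z₁)
    ⊕-At P@(affine _ _ _) ∞ P-at (z₂≡0 , w₂≡0) = At-resp P {z₁} {w₁}
      (trans (combine ((- 1) ⋆ z₂≡0)
        (solve₂ (λ z₁ z₂ → z₁ :- (z₁ :+ z₂)
          := :- #1 :* (z₂ :- #0)) refl z₁ z₂)) (ν≡0⇒z₃≡ ν≡0))
      (trans (combine (1 ⋆ slope ⊞ 1 ⋆ w₂≡0 ⊞ (- (2 * λ′)) ⋆ z₂≡0)
        (solve₅ (λ w₁ λ′ z₁ z₂ w₂ → w₁ :- λ′ :* (z₁ :+ z₂)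
          := #1 :* (w₁ :- w₂ :- λ′ :* (z₁ :- z₂)) :+ #1 :* (w₂ :- #0) :+ :- (#2 :* λ′) :* (z₂ :-
             #0)) refl w₁ λ′ z₁ z₂ w₂)) (ν≡0⇒w₃≡ ν≡0))
      P-at
      where
      ν≡0 : ν ≡ 0
      ν≡0 = combine (1 ⋆ ν≡ ⊞ 1 ⋆ slope ⊞ 1 ⋆ w₂≡0 ⊞ (- λ′) ⋆ z₂≡0)
        (solve₆ (λ ν w₁ λ′ z₁ w₂ z₂ → ν :- #0
          := #1 :* (ν :- (w₁ :- λ′ :* z₁)) :+ #1 :* (w₁ :- w₂ :- λ′ :* (z₁ :- z₂)) :+ #1 :* (w₂
             :- #0) :+ :- λ′ :* (z₂ :- #0)) refl ν w₁ λ′ z₁ w₂ z₂)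
    ⊕-At (affine x₁ y₁ e₁) (affine x₂ y₂ e₂) (z₁y₁≡x₁ , w₁y₁≡1) (z₂y₂≡x₂ , w₂y₂≡1)
      with x₁ ℚ.≟ x₂ | y₁ ℚ.≟ - y₂
    ... | no x₁≢x₂ | _ =
      chord-At {k = GroupLaw.chordSlope {E} x₁ y₁ x₂ y₂ x₁≢x₂} x₁≢x₂ (recompute (_ ℚ.≟ _) e₁) (recompute (_ ℚ.≟ _) e₂) z₁y₁≡x₁ w₁y₁≡1 z₂y₂≡x₂ w₂y₂≡1
        (÷-*-cancel (y₂ - y₁) (x₂ - x₁) {{≢-nonZero (x₁≢x₂ ∘ sym ∘ p-q≡0⇒p≡q)}})
    ... | yes x₁≡x₂ | yes y₁≡-y₂ = opposite-At x₁≡x₂ z₁y₁≡x₁ w₁y₁≡1 z₂y₂≡x₂ w₂y₂≡1 y₁≡-y₂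
    ... | yes x₁≡x₂ | no y₁≢-y₂ =
      tangent-At {k = GroupLaw.tangentSlope {E} x₁ y₁ 2y≢0} x₁≡x₂ y₁≢-y₂ (recompute (_ ℚ.≟ _) e₁) (recompute (_ ℚ.≟ _) e₂)
        z₁y₁≡x₁ w₁y₁≡1 z₂y₂≡x₂ w₂y₂≡1
        (÷-*-cancel _ (2 * y₁) {{≢-nonZero 2y≢0}})
      where
      2y≢0 : 2 * y₁ ≢ 0
      2y≢0 = p*q≡1⇒q≢0 w₁ w₁y₁≡1 ∘ *-cancelˡ-0 {2} (λ ())

chart-curve : ∀ {a b x y z w} → y ^ 2 ≡ x ^ 3 + a * x ^ 2 + b * x → z * y ≡ x → w * y ≡ 1 →
  w ≡ z ^ 3 + a * z ^ 2 * w + b * z * w ^ 2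
chart-curve {a} {b} {x} {y} {z} {w} curve zy≡x wy≡1 =
  *-cancelʳ-≡ w r y≢0 (*-cancelʳ-≡ (w * y) (r * y) y≢0 (*-cancelʳ-≡ (w * y * y) (r * y * y) y≢0 (combine
    (1 ⋆ curve
      ⊞ (y ^ 2 - a * (z * y) ^ 2 - b * (z * y) * (w * y + 1)) ⋆ wy≡1
      ⊞ (- ((z * y) ^ 2 + z * y * x + x ^ 2 + a * (z * y + x) + b)) ⋆ zy≡x) expand)))
  where
  y≢0 : y ≢ 0
  y≢0 = p*q≡1⇒q≢0 w wy≡1
  r : ℚ
  r = z ^ 3 + a * z ^ 2 * w + b * z * w ^ 2
  expand : w * y * y * y - (z ^ 3 + a * z ^ 2 * w + b * z * w ^ 2) * y * y * y ≡
    1 * (y ^ 2 - (x ^ 3 + a * x ^ 2 + b * x))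
    + (y ^ 2 - a * (z * y) ^ 2 - b * (z * y) * (w * y + 1)) * (w * y - 1)
    + (- ((z * y) ^ 2 + z * y * x + x ^ 2 + a * (z * y + x) + b)) * (z * y - x)
  expand =
    solve₆ (λ w y z a b x →
      w :* y :* y :* y :- (z ³ :+ a :* z ² :* w :+ b :* z :* w ²) :* y :* y :* y
      := #1 :* (y ² :- (x ³ :+ a :* x ² :+ b :* x)) :+ (y ² :- a :* (z :* y) ² :- b :* (z :* y)
         :* (w :* y :+ #1)) :* (w :* y :- #1) :+ :- ((z :* y) ² :+ z :* y :* x :+ x ² :+ a :* (z
         :* y :+ x) :+ b) :* (z :* y :- x)) refl w y z a b x

At-curve : ∀ {E} (Q : Point E) {z w} → Q At (z , w) → let open EllipticCurve E in
  w ≡ z ^ 3 + a * z ^ 2 * w + b * z * w ^ 2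
At-curve {E} ∞ {z} {w} (z≡0 , w≡0) =
  combine (1 ⋆ w≡0 ⊞ (- (z ^ 2 + a * z * w + b * w ^ 2)) ⋆ z≡0)
    (solve₄ (λ w z a b → w :- (z ³ :+ a :* z ² :* w :+ b :* z :* w ²)
      := #1 :* (w :- #0) :+ :- (z ² :+ a :* z :* w :+ b :* w ²) :* (z :- #0)) refl w z a b)
  where open EllipticCurve E
At-curve {E} (affine x y e) {z} {w} (zy≡x , wy≡1) =
  chart-curve {a} {b} {x} {y} {z} {w} (recompute (y ^ 2 ℚ.≟ x ^ 3 + a * x ^ 2 + b * x) e) zy≡x wy≡1
  where open EllipticCurve E

-- Multiples of a point reducing to `∞`

module _ (p₀ : ℕ) (p₀>1 : 1 ℕ.< p₀) (p : ℚ) (p≡p₀ : p ≡ fromℤ (ℤ.+ p₀)) where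
  open Localisation p₀ p₀>1 p p≡p₀
  open Neighbourhood p₀ p₀>1 p p≡p₀

  -- The `scale-` lemmas pass from `ζ`, `ω` to `z = p ζ`, `w = p ω`: the fields of `Line` become the
  -- hypotheses of `ChartAddition` with `λ′ = p² ℓ` and `ν = p n`.
  scale-slope : ∀ {ζ₁ ω₁ ζ₂ ω₂ ℓ} → ω₁ - ω₂ ≡ p * p * ℓ * (ζ₁ - ζ₂) →
    p * ω₁ - p * ω₂ ≡ p * p * ℓ * (p * ζ₁ - p * ζ₂)
  scale-slope {ζ₁} {ω₁} {ζ₂} {ω₂} {ℓ} slope = combine (p ⋆ slope)
    (solve₆ (λ p ω₁ ω₂ ℓ ζ₁ ζ₂ → p :* ω₁ :- p :* ω₂ :- p :* p :* ℓ :* (p :* ζ₁ :- p :* ζ₂)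
      := p :* (ω₁ :- ω₂ :- p :* p :* ℓ :* (ζ₁ :- ζ₂))) refl p ω₁ ω₂ ℓ ζ₁ ζ₂)

  scale-tangent : ∀ {a b ζ₁ ω₁ ζ₂ ω₂ ℓ} →
    ℓ * (1 - p * p * (a * ζ₂ ^ 2 + b * ζ₂ * (ω₁ + ω₂))) ≡
      ζ₁ * ζ₁ + ζ₁ * ζ₂ + ζ₂ * ζ₂ + a * (ζ₁ + ζ₂) * ω₁ + b * ω₁ * ω₁ →
    p * p * ℓ * (1 - (a * (p * ζ₂) ^ 2 + b * (p * ζ₂) * (p * ω₁ + p * ω₂))) ≡
      p * ζ₁ * (p * ζ₁) + p * ζ₁ * (p * ζ₂) + p * ζ₂ * (p * ζ₂)
        + a * (p * ζ₁ + p * ζ₂) * (p * ω₁) + b * (p * ω₁) * (p * ω₁)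
  scale-tangent {a} {b} {ζ₁} {ω₁} {ζ₂} {ω₂} {ℓ} ℓΔ≡ = combine ((p * p) ⋆ ℓΔ≡)
    (solve₈ (λ p ℓ a ζ₂ b ω₁ ω₂ ζ₁ →
      p :* p :* ℓ :* (#1 :- (a :* (p :* ζ₂) ² :+ b :* (p :* ζ₂) :* (p :* ω₁ :+ p :* ω₂))) :- (p
        :* ζ₁ :* (p :* ζ₁) :+ p :* ζ₁ :* (p :* ζ₂) :+ p :* ζ₂ :* (p :* ζ₂) :+ a :* (p :* ζ₁ :+ p
        :* ζ₂) :* (p :* ω₁) :+ b :* (p :* ω₁) :* (p :* ω₁))
      := p :* p :* (ℓ :* (#1 :- p :* p :* (a :* ζ₂ ² :+ b :* ζ₂ :* (ω₁ :+ ω₂))) :- (ζ₁ :* ζ₁ :+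
         ζ₁ :* ζ₂ :+ ζ₂ :* ζ₂ :+ a :* (ζ₁ :+ ζ₂) :* ω₁ :+ b :* ω₁ :* ω₁)))
      refl p ℓ a ζ₂ b ω₁ ω₂ ζ₁)

  scale-sum : ∀ {ζ₁ ζ₂ n M ε} → p * ζ₁ + p * ζ₂ + p * n * M * ε ≡ p * (ζ₁ + ζ₂ + n * M * ε)
  scale-sum {ζ₁} {ζ₂} {n} {M} {ε} =
    solve₆ (λ p ζ₁ ζ₂ n M ε → p :* ζ₁ :+ p :* ζ₂ :+ p :* n :* M :* ε
      := p :* (ζ₁ :+ ζ₂ :+ n :* M :* ε)) refl p ζ₁ ζ₂ n M ε

  scale-ω₃ : ∀ {z ζ n ℓ} → z ≡ p * ζ → p * p * ℓ * z - p * n ≡ p * (p * p * ℓ * ζ - n)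
  scale-ω₃ {z} {ζ} {n} {ℓ} z≡ = combine ((p * p * ℓ) ⋆ z≡)
    (solve₅ (λ p ℓ z n ζ → p :* p :* ℓ :* z :- p :* n :- p :* (p :* p :* ℓ :* ζ :- n)
      := p :* p :* ℓ :* (z :- p :* ζ)) refl p ℓ z n ζ)

  scale-ν : ∀ {ω ζ ℓ} → p * (ω - p * p * ℓ * ζ) ≡ p * ω - p * p * ℓ * (p * ζ)
  scale-ν {ω} {ζ} {ℓ} =
    solve₄ (λ p ω ℓ ζ → p :* (ω :- p :* p :* ℓ :* ζ)
      := p :* ω :- p :* p :* ℓ :* (p :* ζ)) refl p ω ℓ ζ

  module Reduction (E : EllipticCurve)
    (a∈ : Local (EllipticCurve.a E)) (b∈ : Local (EllipticCurve.b E)) where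

    open EllipticCurve E
    open Chart a∈ b∈

    record Reduces∞ (Q : Point E) : Set where
      constructor reduces∞
      field
        {ζ ω} : ℚ
        ζ∈    : Local ζ
        ω∈    : Local ω
        at    : Q At (p * ζ , p * ω)

      toNear : Near
      toNear = near ζ ω ζ∈ ω∈ (At-curve Q at)

    open Reduces∞ using (toNear)

    ⊕-Reduces∞ : ∀ {P Q} → Reduces∞ P → Reduces∞ Q → Reduces∞ (P ⊕ Q)
    ⊕-Reduces∞ {P} {Q} P∞@(reduces∞ {ζ₁} {ω₁} _ _ P-at) Q∞@(reduces∞ {ζ₂} {ω₂} _ _ Q-at) =
      reduces∞ L.ζ₃∈ L.ω₃∈ (At-resp (P ⊕ Q) z₃≡ (scale-ω₃ {n = L.n} {L.ℓ} z₃≡)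
        (ChartAddition.⊕-At E {λ′ = p * p * L.ℓ} {p * L.n} {L.ε}
          (scale-slope {ζ₁} {ω₁} {ζ₂} {ω₂} {L.ℓ} L.slope)
          (scale-tangent {a} {b} {ζ₁} {ω₁} {ζ₂} {ω₂} {L.ℓ} L.ℓΔ≡)
          (scale-ν {ω₁} {ζ₁} {L.ℓ}) L.Eε≡1 P Q P-at Q-at))
      where
      module L = Line (line-through (toNear P∞) (toNear Q∞))
      z₃≡ : p * ζ₁ + p * ζ₂ + p * L.n * (a + 2 * b * (p * p * L.ℓ)) * L.ε ≡ p * L.ζ₃
      z₃≡ = scale-sum {ζ₁} {ζ₂} {L.n} {a + 2 * b * (p * p * L.ℓ)} {L.ε}

    ⊕-isometry : ∀ {P Q Q′} (P∞ : Reduces∞ P) (Q∞ : Reduces∞ Q) (Q′∞ : Reduces∞ Q′) →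
      Σ[ c ∈ ℚ ] Local c ×
        Reduces∞.ζ (⊕-Reduces∞ P∞ Q∞) - Reduces∞.ζ (⊕-Reduces∞ P∞ Q′∞) ≡
          (Reduces∞.ζ Q∞ - Reduces∞.ζ Q′∞) * (1 + p * p * c)
    ⊕-isometry P∞ Q∞ Q′∞ = shift-isometry {toNear P∞} {toNear Q∞} {toNear Q′∞}
      (line-through (toNear P∞) (toNear Q∞)) (line-through (toNear P∞) (toNear Q′∞))

    module _ {P : Point E} (P∞ : Reduces∞ P) where
      open RawMonoidDefs (RawGroup.rawMonoid (𝓖 E)) renaming (_×_ to _×ᴳ_)

      -- `suc n ×ᴳ P` is by definition `P ⊕ (n ×ᴳ P)`, so passing from `n` to `suc n` is translation
      -- by the fixed point `P`, as in `⊕-isometry`.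
      multiples : ∀ n → Reduces∞ (n ×ᴳ P)
      multiples ℕ.zero    = reduces∞ {ζ = 0} {0} ⟨0⟩ ⟨0⟩ (ℚ.*-zeroʳ p , ℚ.*-zeroʳ p)
      multiples (ℕ.suc n) = ⊕-Reduces∞ P∞ (multiples n)

      ζ-multiple : ℕ → ℚ
      ζ-multiple n = Reduces∞.ζ (multiples n)

      ζ-multiple-shift : ∀ i j → Σ[ c ∈ ℚ ] Local c ×
        ζ-multiple (ℕ.suc i) - ζ-multiple (ℕ.suc j) ≡
          (ζ-multiple i - ζ-multiple j) * (1 + p * p * c)
      ζ-multiple-shift i j = ⊕-isometry P∞ (multiples i) (multiples j)

      Reduces∞⇒¬Torsion : ζ-multiple 1 ≢ 0 → ¬ Torsion (𝓖 E) P
      Reduces∞⇒¬Torsion ζ₁≢0 (n , n>0 , nP≡∞) =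
        nonvanishing ζ-multiple refl ζ₁≢0 ζ-multiple-shift n n>0 (*-cancelˡ-0 p≢0 (proj₁ (subst (_At (p * ζ-multiple n , p * Reduces∞.ω (multiples n))) nP≡∞ (Reduces∞.at (multiples n)))))

    nontorsion : ∀ {x y} .(e : OnCurve E x y) → x ≢ 0 → Reduces∞ (affine x y e) →
      ¬ Torsion (𝓖 E) (affine x y e)
    nontorsion {x} {y} e x≢0 P∞ = Reduces∞⇒¬Torsion P∞ λ ζ₁≡0 →
      -- `1 ×ᴳ P` computes to `P` itself, so `p ζ y = x` there, and `ζ = 0` would force `x = 0`.
      x≢0 (trans (sym (proj₁ (Reduces∞.at (multiples P∞ 1))))
        (trans (cong (λ ζ → p * ζ * y) ζ₁≡0) (solve₂ (λ p y → p :* #0 :* y := #0) refl p y)))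

-- From a non-torsion point to the rank

⊕-identityʳ : ∀ {E} (P : Point E) → P ⊕ ∞ ≡ P
⊕-identityʳ ∞              = refl
⊕-identityʳ (affine _ _ _) = refl

⊖≡∞ : ∀ {E} (P : Point E) → ⊖ P ≡ ∞ → P ≡ ∞
⊖≡∞ ∞ _ = refl

¬Torsion⇒Rank≥1 : ∀ {E} {P : Point E} → ¬ Torsion (𝓖 E) P → Rank≥ (𝓖 E) 1
¬Torsion⇒Rank≥1 {E} {P} ¬torsion = (λ _ → P) , independent
  where
  vanishing : ∀ k → _·_ (𝓖 E) k P ≡ ∞ → k ≡ ℤ.0ℤ
  vanishing (ℤ.+ ℕ.zero)  _  = refl
  vanishing (ℤ.+ ℕ.suc n) eq = ⊥-elim (¬torsion (ℕ.suc n , ℕ.z<s , eq))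
  vanishing ℤ.-[1+ n ]    eq = ⊥-elim (¬torsion (ℕ.suc n , ℕ.z<s , ⊖≡∞ _ eq))

  independent : LinearlyIndependent (𝓖 E) {1} (λ _ → P)
  independent k eq zero = vanishing (k zero) (trans (sym (⊕-identityʳ _)) eq)

-- Reduction modulo the numerator of `m`

fromℕ : ℕ → ℚ
fromℕ n = fromℤ (ℤ.+ n)

fromℕ-1+* : ∀ x y → fromℕ (1 ℕ.+ x ℕ.* y) ≡ 1 + fromℕ x * fromℕ y
fromℕ-1+* x y = trans (fromℤ-+ (ℤ.+ 1) (ℤ.+ (x ℕ.* y)))
  (cong (λ a → 1 + a) (fromℕ-* x y))
  where
  fromℕ-* : ∀ x y → fromℕ (x ℕ.* y) ≡ fromℕ x * fromℕ y
  fromℕ-* x y = trans (cong fromℤ (ℤ.pos-* x y)) (fromℤ-* (ℤ.+ x) (ℤ.+ y))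

-- In the form `1 / q = s / (1 + p t)`, this puts the inverse of the denominator of `m` into the
-- localisation at its numerator; that inverse is the `r` of `Numerator`.
bézout : ∀ {p q} → Coprime p q → Σ[ s ∈ ℚ ] Σ[ t ∈ ℚ ]
  Integer s × Integer t × fromℕ q * s ≡ 1 + fromℕ p * t
bézout {p} {q} coprime with coprime-Bézout coprime
... | Bézout.+- x y eq = - fromℕ y , - fromℕ x , Integer-neg (ℤ.+ y , refl) , Integer-neg (ℤ.+ x , refl) ,
  rearrange {fromℕ x} {fromℕ y} {fromℕ p} {fromℕ q} fromℕ-eq
  where
  rearrange : ∀ {x y p q} → 1 + y * q ≡ x * p → q * - y ≡ 1 + p * - x
  rearrange {x} {y} {p} {q} eq = combine ((- 1) ⋆ eq)
    (solve₄ (λ q y p x → q :* (:- y) :- (#1 :+ p :* (:- x))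
      := :- #1 :* (#1 :+ y :* q :- x :* p)) refl q y p x)
  fromℕ-eq : 1 + fromℕ y * fromℕ q ≡ fromℕ x * fromℕ p
  fromℕ-eq = trans (sym (fromℕ-1+* y q)) (trans (cong fromℕ eq)
    (trans (cong fromℤ (ℤ.pos-* x p)) (fromℤ-* (ℤ.+ x) (ℤ.+ p))))
... | Bézout.-+ x y eq = fromℕ y , fromℕ x , (ℤ.+ y , refl) , (ℤ.+ x , refl) ,
  rearrange {fromℕ x} {fromℕ y} {fromℕ p} {fromℕ q} fromℕ-eq
  where
  rearrange : ∀ {x y p q} → 1 + x * p ≡ y * q → q * y ≡ 1 + p * x
  rearrange {x} {y} {p} {q} eq = combine ((- 1) ⋆ eq)
    (solve₄ (λ q y p x → q :* y :- (#1 :+ p :* x)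
      := :- #1 :* (#1 :+ x :* p :- y :* q)) refl q y p x)
  fromℕ-eq : 1 + fromℕ x * fromℕ p ≡ fromℕ y * fromℕ q
  fromℕ-eq = trans (sym (fromℕ-1+* x p)) (trans (cong fromℕ eq)
    (trans (cong fromℤ (ℤ.pos-* y q)) (fromℤ-* (ℤ.+ y) (ℤ.+ q))))

record Numerator (m : ℚ) : Set where
  field
    p₀   : ℕ
    p₀>1 : 1 ℕ.< p₀
  open Localisation p₀ p₀>1 (fromℕ p₀) refl public
  field
    r    : ℚ
    r∈   : Local r
    m≡pr : m ≡ fromℕ p₀ * r

divide-by : ∀ {m q s t n} → 1 ℕ.< n → q ≢ 0 → m * q ≡ fromℕ n → Integer s → Integer t →
  q * s ≡ 1 + fromℕ n * t → Numerator m
divide-by {m} {q} {s} {t} {n} n>1 q≢0 mq≡n si ti qs≡1+nt with inverse q≢0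
... | r , qr≡1 = record
  { p₀   = n
  ; p₀>1 = n>1
  ; r    = r
  ; r∈   = subst Integer (r[1+pt]≡s {fromℕ n} qs≡1+nt) si /1+p ti
  ; m≡pr = m≡pr {fromℕ n} mq≡n
  }
  where
  open Localisation n n>1 (fromℕ n) refl using (_/1+p_)

  r[1+pt]≡s : ∀ {p} → q * s ≡ 1 + p * t → s ≡ r * (1 + p * t)
  r[1+pt]≡s {p} qs≡ = combine (r ⋆ qs≡ ⊞ (- s) ⋆ qr≡1)
    (solve₅ (λ s r p t q → s :- r :* (#1 :+ p :* t)
      := r :* (q :* s :- (#1 :+ p :* t)) :+ :- s :* (q :* r :- #1)) refl s r p t q)

  m≡pr : ∀ {p} → m * q ≡ p → m ≡ p * r
  m≡pr {p} mq≡p = combine (r ⋆ mq≡p ⊞ (- m) ⋆ qr≡1)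
    (solve₄ (λ m p r q → m :- p :* r
      := r :* (m :* q :- p) :+ :- m :* (q :* r :- #1)) refl m p r q)

numerator-of : ∀ {m} → 1 < m → Numerator m
numerator-of {mkℚ ℤ.-[1+ n ] d _} (*<* lt)
  with () ← subst₂ ℤ._<_ (ℤ.*-identityˡ (ℤ.+ ℕ.suc d)) (ℤ.*-identityʳ ℤ.-[1+ n ]) lt
numerator-of {m@(mkℚ (ℤ.+ n) d c)} (*<* lt)
  with bézout {n} {ℕ.suc d} (Coprimality.recompute c)
... | s , t , si , ti , qs≡1+pt = divide-by {m} {fromℕ (ℕ.suc d)} {s} {t} n>1 (λ ()) mq≡p si ti qs≡1+pt
  where
  n>1 : 1 ℕ.< n
  -- `1 < n / q` unfolds to `1 * q < n * 1`, and `q ≥ 1`.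
  n>1 with ℤ.+<+ q<n ← subst₂ ℤ._<_ (ℤ.*-identityˡ (ℤ.+ ℕ.suc d)) (ℤ.*-identityʳ (ℤ.+ n)) lt =
    ℕ.≤-<-trans (ℕ.s≤s ℕ.z≤n) q<n

  mq≡p : m * fromℕ (ℕ.suc d) ≡ fromℕ n
  mq≡p = ℚ.toℚᵘ-injective (ℚᵘ.≃-trans (ℚ.toℚᵘ-homo-* m (fromℕ (ℕ.suc d))) (ℚᵘ.*≡* (trans
    (ℤ.*-identityʳ (ℤ.+ n ℤ.* ℤ.+ ℕ.suc d))
    (cong (λ d → ℤ.+ n ℤ.* ℤ.+ d) (sym (ℕ.*-identityʳ (ℕ.suc d)))))))

-- Both families have the shape N = m² + σ, x(P) = 1 / m², y(P) = (κ m² + σ) / m³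
-- with σ² = 1, so that P reduces to ∞ modulo the numerator of m.
family-nontorsion : ∀ {N m σ κ} .(¼<N : 1 ÷ 4 < N) (1<m : 1 < m) → N ≡ m ^ 2 + σ →
  Integer σ → Integer κ → σ * σ ≡ 1 → ∀ {x y} .(e : OnCurve (𝓔 N ¼<N) x y) →
  x * m ^ 2 ≡ 1 → y * m ^ 3 ≡ κ * m ^ 2 + σ → ¬ Torsion (𝓖 (𝓔 N ¼<N)) (affine x y e)
family-nontorsion {N} {m} {σ} {κ} ¼<N 1<m N≡ σ-Integer κ-Integer σσ≡1 {x} {y} e xm²≡1 ym³≡ =
  nontorsion e x≢0
    -- With `u = 1 / (κ m² + σ)`: `x / y = m u = p (r u)` and `1 / y = m³ u = p (p² r³ u)`.
    (reduces∞ (r∈ ⟨*⟩ u∈) (⟨p⟩ ⟨*⟩ ⟨p⟩ ⟨*⟩ r∈ ⟨*⟩ r∈ ⟨*⟩ r∈ ⟨*⟩ u∈) (zy≡x {fromℕ p₀} m≡pr , wy≡1 {fromℕ p₀} m≡pr))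
  where
  open Numerator (numerator-of 1<m)

  σ∈ : Local σ
  σ∈ = integer σ-Integer

  N∈ : Local N
  N∈ = subst Local (sym (trans N≡ (cong (λ m → m ^ 2 + σ) m≡pr)))
    (⟨p⟩ ⟨*⟩ r∈ ⟨*⟩ (⟨p⟩ ⟨*⟩ r∈ ⟨*⟩ ⟨1⟩) ⟨+⟩ σ∈)

  a∈ : Local (2 * (2 * N ^ 2 + 2 * N - 1))
  a∈ = ⟨2⟩ ⟨*⟩ (⟨2⟩ ⟨*⟩ (N∈ ⟨*⟩ (N∈ ⟨*⟩ ⟨1⟩)) ⟨+⟩ ⟨2⟩ ⟨*⟩ N∈ ⟨-⟩ ⟨1⟩)

  b∈ : Local (- (4 * N - 1))
  b∈ = ⟨neg⟩ ((⟨2⟩ ⟨+⟩ ⟨2⟩) ⟨*⟩ N∈ ⟨-⟩ ⟨1⟩)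

  open Reduction p₀ p₀>1 (fromℕ p₀) refl (𝓔 N ¼<N) a∈ b∈

  -- By `σ² = 1`, `κ m² + σ = σ (1 + σ κ m²)`, and `m² = p (p r²)` puts the second factor into
  -- `1 + p Local`. If `v` is its inverse, then `σ v` inverts `κ m² + σ`.
  v-inverse = 1+p*-invertible (σ∈ ⟨*⟩ integer κ-Integer ⟨*⟩ ⟨p⟩ ⟨*⟩ r∈ ⟨*⟩ r∈)

  u : ℚ
  u = σ * proj₁ v-inverse

  u∈ : Local u
  u∈ = σ∈ ⟨*⟩ proj₁ (proj₂ v-inverse)

  cu≡1 : (κ * m ^ 2 + σ) * u ≡ 1
  cu≡1 = unit {fromℕ p₀} m≡pr (proj₂ (proj₂ v-inverse))
    where
    unit : ∀ {p v} → m ≡ p * r → (1 + p * (σ * κ * p * r * r)) * v ≡ 1 → (κ * m ^ 2 + σ) * (σ * v) ≡ 1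
    unit {p} {v} m≡ eq = combine
      (1 ⋆ eq ⊞ v ⋆ σσ≡1 ⊞ (κ * σ * v * (m + p * r)) ⋆ m≡)
        (solve₆ (λ κ m σ v p r → (κ :* m ² :+ σ) :* (σ :* v) :- #1
          := #1 :* ((#1 :+ p :* (σ :* κ :* p :* r :* r)) :* v :- #1) :+ v :* (σ :* σ :- #1) :+ κ
             :* σ :* v :* (m :+ p :* r) :* (m :- p :* r)) refl κ m σ v p r)

  myu≡x : m * y * u ≡ x
  myu≡x = *-cancelʳ-≡ _ _ (p*q≡1⇒q≢0 x xm²≡1)
    (combine (u ⋆ ym³≡ ⊞ 1 ⋆ cu≡1 ⊞ (- 1) ⋆ xm²≡1)
      (solve₆ (λ m y u x κ σ → m :* y :* u :* m ² :- x :* m ²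
        := u :* (y :* m ³ :- (κ :* m ² :+ σ)) :+ #1 :* ((κ :* m ² :+ σ) :* u :- #1) :+ :- #1 :*
           (x :* m ² :- #1)) refl m y u x κ σ))

  zy≡x : ∀ {p} → m ≡ p * r → p * (r * u) * y ≡ x
  zy≡x {p} m≡ = combine (1 ⋆ myu≡x ⊞ (- (y * u)) ⋆ m≡)
    (solve₆ (λ p r u y x m → p :* (r :* u) :* y :- x
      := #1 :* (m :* y :* u :- x) :+ :- (y :* u) :* (m :- p :* r)) refl p r u y x m)

  wy≡1 : ∀ {p} → m ≡ p * r → p * (p * p * r * r * r * u) * y ≡ 1
  wy≡1 {p} m≡ = combine
    (u ⋆ ym³≡ ⊞ 1 ⋆ cu≡1 ⊞ (- (u * y * (m ^ 2 + m * (p * r) + (p * r) ^ 2))) ⋆ m≡)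
      (solve₇ (λ p r u y m κ σ → p :* (p :* p :* r :* r :* r :* u) :* y :- #1
        := u :* (y :* m ³ :- (κ :* m ² :+ σ)) :+ #1 :* ((κ :* m ² :+ σ) :* u :- #1) :+ :- (u :*
           y :* (m ² :+ m :* (p :* r) :+ (p :* r) ²)) :* (m :- p :* r)) refl p r u y m κ σ)

  x≢0 : x ≢ 0
  x≢0 refl with trans (sym xm²≡1) (ℚ.*-zeroˡ (m ^ 2))
  ... | ()

-- Recognising the triangle

÷-unique : ∀ {p q r} .{{_ : NonZero q}} → p ≡ r * q → p ÷ q ≡ r
÷-unique {q = q} {r} refl =
  trans (ℚ.*-assoc r q (1/ q)) (trans (cong (r *_) (ℚ.*-inverseʳ q)) (ℚ.*-identityʳ r))

infixl 6 _+⁺_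
infixl 7 _*⁺_

_+⁺_ : ∀ {p q} → 0 < p → 0 < q → 0 < p + q
_+⁺_ = ℚ.+-mono-<

_*⁺_ : ∀ {p q} → 0 < p → 0 < q → 0 < p * q
_*⁺_ {p} {q} p>0 q>0 = ℚ.positive⁻¹ (p * q) {{ℚ.pos*pos⇒pos p {{positive p>0}} q {{positive q>0}}}}

>0⇒≢0 : ∀ {p} → 0 < p → p ≢ 0
>0⇒≢0 p>0 p≡0 = ℚ.<⇒≢ p>0 (sym p≡0)

<-by-difference : ∀ {p q d} → 0 < d → q - p ≡ d → p < q
<-by-difference {p} {q} {d} d>0 q-p≡d = subst₂ _<_ (ℚ.+-identityˡ p) eq (ℚ.+-monoˡ-< p d>0)
  where
  eq : d + p ≡ q
  eq = combine ((- 1) ⋆ q-p≡d)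
    (solve₃ (λ d p q → d :+ p :- q
      := :- #1 :* (q :- p :- d)) refl d p q)

^2≢0 : ∀ {p} → p ≢ 0 → p ^ 2 ≢ 0
^2≢0 {p} p≢0 p²≡0 = p≢0 (*-cancelˡ-0 p≢0 (combine (1 ⋆ p²≡0)
  (solve₁ (λ p → p :* p :- #0
    := #1 :* (p ² :- #0)) refl p)))

-- The two sign changes in `(f - g - h) (g - h - f)` cancel, so the denominator is a product of
-- quantities that the triangle inequalities make positive.
R/r-criterion : ∀ {f g h a b c N} → f + g + h ≡ a → g + h - f ≡ b → h + f - g ≡ c →
  0 < a → 0 < b → 0 < c → 2 * f * g * h ≡ N * (a * b * c) → R/r[ f , g , h ]≡ N
R/r-criterion {f} {g} {h} {a} {b} {c} {N} a≡ b≡ c≡ a>0 b>0 c>0 eq =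
  d≢0 , ÷-unique {{d≢0}} (trans eq (cong (N *_) (sym d≡)))
  where
  d≡ : (f + g + h) * (f - g - h) * (g - h - f) ≡ a * b * c
  d≡ = combine (((g + h - f) * (h + f - g)) ⋆ a≡ ⊞ (a * (h + f - g)) ⋆ b≡ ⊞ (a * b) ⋆ c≡)
    (solve₆ (λ f g h a b c → (f :+ g :+ h) :* (f :- g :- h) :* (g :- h :- f) :- a :* b :* c
      := (g :+ h :- f) :* (h :+ f :- g) :* (f :+ g :+ h :- a) :+ a :* (h :+ f :- g) :* (g :+ h
         :- f :- b) :+ a :* b :* (h :+ f :- g :- c)) refl f g h a b c)
  d≢0 : NonZero ((f + g + h) * (f - g - h) * (g - h - f))
  d≢0 = ≢-nonZero λ d≡0 → >0⇒≢0 (a>0 *⁺ b>0 *⁺ c>0) (trans (sym d≡) d≡0)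

-- x = κ / D and √B = S / D².
module Shape {N x D κ S s f g h : ℚ} (D>0 : 0 < D) (κ>0 : 0 < κ) (S>0 : 0 < S) (s>0 : 0 < s)
  (xD≡κ : x * D ≡ κ)
  (B≡ : S ^ 2 ≡ κ ^ 4 + 4 * (2 * N - 1) * κ ^ 3 * D + 4 * (4 * N ^ 2 - 2 * N + 1) * κ ^ 2 * D ^ 2
                - 32 * N ^ 2 * κ * D ^ 3 + 16 * N ^ 2 * D ^ 4)
  (f≡ : 2 * f * D * κ ≡ s * (4 * N * D ^ 2 - κ ^ 2 - 2 * (2 * N - 1) * κ * D - S))
  (g≡ : g * D ≡ s * κ)
  (h≡ : 2 * h * D * κ ≡ s * (2 * (2 * N + 1) * κ * D - κ ^ 2 - 4 * N * D ^ 2 + S))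
  where

  private
    D²>0 : 0 < D * D
    D²>0 = D>0 *⁺ D>0

    D≢0 : D ≢ 0
    D≢0 = >0⇒≢0 D>0

    instance
      _ : Positive (D * D)
      _ = positive D²>0
      D²≢0 : NonZero (D * D)
      D²≢0 = ℚ.pos⇒nonZero (D * D)

    √B : ℚ
    √B = S * 1/ (D * D)

    √BD²≡S : √B * D ^ 2 ≡ S
    √BD²≡S = lemma (ℚ.*-inverseˡ (D * D))
      where
      lemma : ∀ {i} → i * (D * D) ≡ 1 → S * i * D ^ 2 ≡ S
      lemma {i} eq = combine (S ⋆ eq)
        (solve₃ (λ S i D → S :* i :* D ² :- S
          := S :* (i :* (D :* D) :- #1)) refl S i D)

    √B>0 : 0 < √B
    √B>0 = S>0 *⁺ ℚ.positive⁻¹ ((1/ (D * D)) {{ℚ.pos⇒nonZero (D * D)}}) {{ℚ.1/pos⇒pos (D * D)}}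

    x²D²≡κ² : x ^ 2 * D ^ 2 ≡ κ ^ 2
    x²D²≡κ² = combine ((x * D + κ) ⋆ xD≡κ)
      (solve₃ (λ x D κ → x ² :* D ² :- κ ²
        := (x :* D :+ κ) :* (x :* D :- κ)) refl x D κ)

    -- Multiplied by `D⁴`, this is the hypothesis on `S²`, whose right-hand side is `D⁴ B(κ / D)`
    -- expanded.
    B-formula : ∀ {r} → r * D ^ 2 ≡ S → r ^ 2 ≡ B N x
    B-formula {r} rD²≡S = cancel-combine (^2≢0 (^2≢0 D≢0))
      ((r * D ^ 2 + S) ⋆ rD²≡S ⊞ 1 ⋆ B≡ ⊞ (- (x ^ 2 * D ^ 2 + κ ^ 2)) ⋆ x²D²≡κ²
       ⊞ (- (4 * (2 * N - 1) * D * x * D)) ⋆ x²D²≡κ²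
       ⊞ (- (4 * (2 * N - 1) * D * κ ^ 2)) ⋆ xD≡κ
       ⊞ (- (4 * (4 * N ^ 2 - 2 * N + 1) * D ^ 2)) ⋆ x²D²≡κ²
       ⊞ (32 * N ^ 2 * D ^ 3) ⋆ xD≡κ) unfolded
      where
      unfolded : (D ^ 2) ^ 2 * (r ^ 2 - (x ^ 4 + 4 * (2 * N - 1) * x ^ 3
          + 4 * (4 * N ^ 2 - 2 * N + 1) * x ^ 2 - 32 * N ^ 2 * x + 16 * N ^ 2)) ≡ _
      unfolded =
        solve₆ (λ D r x N S κ →
          (D ²) ² :* (r ² :- (x ⁴ :+ #4 :* (#2 :* N :- #1) :* x ³ :+ #4 :* (#4 :* N ² :- #2 :* N
            :+ #1) :* x ² :- #32 :* N ² :* x :+ #16 :* N ²))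
          := (r :* D ² :+ S) :* (r :* D ² :- S) :+ #1 :* (S ² :- (κ ⁴ :+ #4 :* (#2 :* N :- #1)
             :* κ ³ :* D :+ #4 :* (#4 :* N ² :- #2 :* N :+ #1) :* κ ² :* D ² :- #32 :* N ² :* κ
             :* D ³ :+ #16 :* N ² :* D ⁴)) :+ :- (x ² :* D ² :+ κ ²) :* (x ² :* D ² :- κ ²) :+
             :- (#4 :* (#2 :* N :- #1) :* D :* x :* D) :* (x ² :* D ² :- κ ²) :+ :- (#4 :* (#2
             :* N :- #1) :* D :* κ ²) :* (x :* D :- κ) :+ :- (#4 :* (#4 :* N ² :- #2 :* N :+ #1)
             :* D ²) :* (x ² :* D ² :- κ ²) :+ #32 :* N ² :* D ³ :* (x :* D :- κ))
          refl D r x N S κ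

    f-formula : ∀ {r} → r * D ^ 2 ≡ S → f * (2 * x) ≡ s * (A₁ N x - r)
    f-formula {r} rD²≡S = cancel-combine (^2≢0 D≢0)
      ((2 * f * D + 2 * s * (2 * N - 1) * D) ⋆ xD≡κ ⊞ 1 ⋆ f≡ ⊞ s ⋆ x²D²≡κ² ⊞ s ⋆ rD²≡S) unfolded
      where
      unfolded : D ^ 2 * (f * (2 * x) - s * (- (x ^ 2) - 2 * (2 * N - 1) * x + 4 * N - r)) ≡ _
      unfolded =
        solve₈ (λ D f x s N r κ S →
          D ² :* (f :* (#2 :* x) :- s :* (:- (x ²) :- #2 :* (#2 :* N :- #1) :* x :+ #4 :* N :-
            r))
          := (#2 :* f :* D :+ #2 :* s :* (#2 :* N :- #1) :* D) :* (x :* D :- κ) :+ #1 :* (#2 :*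
             f :* D :* κ :- s :* (#4 :* N :* D ² :- κ ² :- #2 :* (#2 :* N :- #1) :* κ :* D :-
             S)) :+ s :* (x ² :* D ² :- κ ²) :+ s :* (r :* D ² :- S)) refl D f x s N r κ S

    h-formula : ∀ {r} → r * D ^ 2 ≡ S → h * (2 * x) ≡ s * (A₂ N x + r)
    h-formula {r} rD²≡S = cancel-combine (^2≢0 D≢0)
      ((2 * h * D - 2 * s * (2 * N + 1) * D) ⋆ xD≡κ ⊞ 1 ⋆ h≡ ⊞ s ⋆ x²D²≡κ² ⊞ (- s) ⋆ rD²≡S) unfolded
      where
      unfolded : D ^ 2 * (h * (2 * x) - s * (- (x ^ 2) + 2 * (2 * N + 1) * x - 4 * N + r)) ≡ _
      unfolded =
        solve₈ (λ D h x s N r κ S →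
          D ² :* (h :* (#2 :* x) :- s :* (:- (x ²) :+ #2 :* (#2 :* N :+ #1) :* x :- #4 :* N :+
            r))
          := (#2 :* h :* D :- #2 :* s :* (#2 :* N :+ #1) :* D) :* (x :* D :- κ) :+ #1 :* (#2 :*
             h :* D :* κ :- s :* (#2 :* (#2 :* N :+ #1) :* κ :* D :- κ ² :- #4 :* N :* D ² :+
             S)) :+ s :* (x ² :* D ² :- κ ²) :+ :- s :* (r :* D ² :- S)) refl D h x s N r κ S

    g-formula : g ≡ s * x
    g-formula = cancel-combine D≢0 (1 ⋆ g≡ ⊞ (- s) ⋆ xD≡κ)
      (solve₅ (λ D g s x κ → D :* (g :- s :* x)
        := #1 :* (g :* D :- s :* κ) :+ :- s :* (x :* D :- κ)) refl D g s x κ)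

    2x≢0 : 2 * x ≢ 0
    2x≢0 2x≡0 = >0⇒≢0 κ>0 (combine ((- 1) ⋆ xD≡κ ⊞ D ⋆ x≡0)
      (solve₃ (λ κ x D → κ :- #0
        := :- #1 :* (x :* D :- κ) :+ D :* (x :- #0)) refl κ x D))
      where
      x≡0 : x ≡ 0
      x≡0 = *-cancelˡ-0 {2} (λ ()) 2x≡0

    ÷-form : ∀ {p T} .{{_ : NonZero (2 * x)}} → p * (2 * x) ≡ s * T → p ≡ s ÷ (2 * x) * T
    ÷-form {p} {T} eq = lemma {s ÷ (2 * x)} (÷-*-cancel s (2 * x))
      where
      lemma : ∀ {w} → w * (2 * x) ≡ s → p ≡ w * T
      lemma {w} w≡ = cancel-combine 2x≢0 (1 ⋆ eq ⊞ (- T) ⋆ w≡)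
        (solve₅ (λ x p w T s → #2 :* x :* (p :- w :* T)
          := #1 :* (p :* (#2 :* x) :- s :* T) :+ :- T :* (w :* (#2 :* x) :- s)) refl x p w T s)

  triangle-from : IsTriangle f g h → R/r[ f , g , h ]≡ N → TriangleFrom N x f g h
  triangle-from isTriangle R/r≡N = record
    { 2x≢0       = ≢-nonZero 2x≢0
    ; √B         = √B
    ; √B≥0       = ℚ.<⇒≤ √B>0
    ; √B²≡B      = B-formula {√B} √BD²≡S
    ; s          = s
    ; s>0        = s>0
    ; f≡         = ÷-form {{≢-nonZero 2x≢0}} (f-formula √BD²≡S)
    ; g≡         = g-formula
    ; h≡         = ÷-form {{≢-nonZero 2x≢0}} (h-formula √BD²≡S)
    ; isTriangle = isTriangle
    ; R/r≡N      = R/r≡N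
    }

-- The point `- P - T₆⁺`

affine-≡ : ∀ {E x y x′ y′} .(e : OnCurve E x y) → x ≡ x′ → y ≡ y′ →
  Σ[ e′ ∈ OnCurve E x′ y′ ] affine {E} x y e ≡ affine x′ y′ e′
affine-≡ e refl refl = recompute (_ ℚ.≟ _) e , refl

-- The slope enters through `k (x₂ - x₁) = y₂ - y₁` instead of as a quotient, so it can be supplied
-- in closed form and the coordinates checked by polynomial identities.
chord-⊕ : ∀ {E x₁ y₁ x₂ y₂ k U V}
  .(e₁ : OnCurve E x₁ y₁) .(e₂ : OnCurve E x₂ y₂) → x₁ ≢ x₂ → k * (x₂ - x₁) ≡ y₂ - y₁ →
  k ^ 2 - EllipticCurve.a E - x₁ - x₂ ≡ U → k * (x₁ - U) - y₁ ≡ V →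
  Σ[ e ∈ OnCurve E U V ] affine {E} x₁ y₁ e₁ ⊕ affine x₂ y₂ e₂ ≡ affine U V e
chord-⊕ {E} {x₁} {y₁} {x₂} {y₂} {k} {U} {V} e₁ e₂ x₁≢x₂ k≡ U≡ V≡ with x₁ ℚ.≟ x₂ | y₁ ℚ.≟ - y₂
... | yes x₁≡x₂ | _ = ⊥-elim (x₁≢x₂ x₁≡x₂)
... | no x₁≢x₂′ | _ = affine-≡ {E} _
  (trans (cong (λ k → GroupLaw.thirdX {E} k x₁ x₂) slope≡k) U≡)
  (trans (cong (λ k → GroupLaw.thirdY {E} k x₁ y₁ x₂) slope≡k)
    (trans (cong (λ U → k * (x₁ - U) - y₁) U≡) V≡))
  where
  slope≡k : GroupLaw.chordSlope {E} x₁ y₁ x₂ y₂ x₁≢x₂′ ≡ k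
  slope≡k = ÷-unique {{≢-nonZero (x₁≢x₂′ ∘ sym ∘ p-q≡0⇒p≡q)}} (sym k≡)

Conclusion : ∀ {N} → 1 ÷ 4 < N → (x y U V f g h : ℚ) → Set
Conclusion {N} ¼<N x y U V f g h =
  Rank≥ (𝓖 (𝓔 N ¼<N)) 1 ×
  (Σ[ P ∈ Point (𝓔 N ¼<N) ]
    P HasCoordinates (x , y) ×
    ¬ Torsion (𝓖 (𝓔 N ¼<N)) P ×
    (⊖ P ⊝ T₆⁺ N ¼<N) HasCoordinates (U , V) ×
    LeadsTo N ¼<N (⊖ P ⊝ T₆⁺ N ¼<N) f g h)

-- The data of one of the two families: P = (1 / m² , c / m³), the slope of the
-- line through - P and - T₆⁺ is K / (m d), and - P - T₆⁺ = (- μ / d² , ν / d³)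
-- leads to the triangle with x = κ / D and √B = S / D².
module Family {N m d c K μ ν D κ f g h : ℚ} (¼<N : 1 ÷ 4 < N)
  (m>0 : 0 < m) (d>0 : 0 < d) (4N-1>0 : 0 < 4 * N - 1)
  (P-onCurve : c ^ 2 ≡
    1 + 2 * (2 * N ^ 2 + 2 * N - 1) * m ^ 2 + (- (4 * N - 1)) * m ^ 4)
  (slope : K * ((1 - 4 * N) * m ^ 2 - 1) ≡ (c - 2 * N * (4 * N - 1) * m ^ 3) * d)
  (U-identity : K ^ 2 ≡
    (2 * (2 * N ^ 2 + 2 * N - 1) + (1 - 4 * N)) * m ^ 2 * d ^ 2 + d ^ 2 - m ^ 2 * μ)
  (V-identity : K * d ^ 2 + K * m ^ 2 * μ + c * d ^ 3 ≡ m ^ 3 * ν)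
  (denominator>0 : 0 < (μ + d ^ 2) * ((4 * N - 1) * d ^ 2 - μ))
  (x-identity : 4 * N * (ν - 2 * N * μ * d) * d * D ≡
                κ * ((μ + d ^ 2) * ((4 * N - 1) * d ^ 2 - μ)))
  (triangle-from : ∀ {x} → x * D ≡ κ → TriangleFrom N x f g h)
  {x y U V : ℚ} (xm²≡1 : x * m ^ 2 ≡ 1) (ym³≡c : y * m ^ 3 ≡ c)
  (Ud²≡-μ : U * d ^ 2 ≡ - μ) (Vd³≡ν : V * d ^ 3 ≡ ν)
  where

  private
    E : EllipticCurve
    E = 𝓔 N ¼<N

    m≢0 : m ≢ 0
    m≢0 = >0⇒≢0 m>0

    d≢0 : d ≢ 0
    d≢0 = >0⇒≢0 d>0

    *≢0 : ∀ {p q} → p ≢ 0 → q ≢ 0 → p * q ≢ 0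
    *≢0 p≢0 q≢0 = q≢0 ∘ *-cancelˡ-0 p≢0

    ^3≢0 : ∀ {p} → p ≢ 0 → p ^ 3 ≢ 0
    ^3≢0 p≢0 = *≢0 p≢0 (^2≢0 p≢0)

    e : OnCurve E x y
    e = curve {2 * (2 * N ^ 2 + 2 * N - 1)} {(- (4 * N - 1))} P-onCurve
      where
      curve : ∀ {a b} → c ^ 2 ≡ 1 + a * m ^ 2 + b * m ^ 4 → y ^ 2 ≡ x ^ 3 + a * x ^ 2 + b * x
      curve {a} {b} c²≡ = cancel-combine (^2≢0 (^3≢0 m≢0))
        ((y * m ^ 3 + c) ⋆ ym³≡c ⊞ 1 ⋆ c²≡
         ⊞ (- ((x * m ^ 2) ^ 2 + x * m ^ 2 + 1 + a * m ^ 2 * (x * m ^ 2 + 1) + b * m ^ 4)) ⋆ xm²≡1)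
        (solve₆ (λ m y x a b c → (m ³) ² :* (y ² :- (x ³ :+ a :* x ² :+ b :* x))
          := (y :* m ³ :+ c) :* (y :* m ³ :- c) :+ #1 :* (c ² :- (#1 :+ a :* m ² :+ b :* m ⁴))
             :+ :- ((x :* m ²) ² :+ x :* m ² :+ #1 :+ a :* m ² :* (x :* m ² :+ #1) :+ b :* m ⁴)
             :* (x :* m ² :- #1)) refl m y x a b c)

    -- `x = 1 / m²` is positive and `1 - 4 N` negative, so the sum is computed by the chord clause
    -- of `_⊕_`.
    x≢1-4N : x ≢ 1 - 4 * N
    x≢1-4N x≡ = >0⇒≢0 (ℚ.positive⁻¹ 1 +⁺ 4N-1>0 *⁺ (m>0 *⁺ m>0))
      (combine ((- 1) ⋆ xm²≡1 ⊞ (m ^ 2) ⋆ x≡)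
        (solve₃ (λ N m x → #1 :+ (#4 :* N :- #1) :* (m :* m) :- #0
          := :- #1 :* (x :* m ² :- #1) :+ m ² :* (x :- (#1 :- #4 :* N))) refl N m x))

    chord : ∀ {k} → k * (m * d) ≡ K →
      k * ((1 - 4 * N) - x) ≡ - (2 * N * (4 * N - 1)) - - y ×
      k ^ 2 - 2 * (2 * N ^ 2 + 2 * N - 1) - x - (1 - 4 * N) ≡ U ×
      k * (x - U) - - y ≡ V
    chord {k} kmd≡K = k≡ , U≡ , V≡
      where
      k≡ : k * ((1 - 4 * N) - x) ≡ - (2 * N * (4 * N - 1)) - - y
      k≡ = cancel-combine (*≢0 (^3≢0 m≢0) d≢0)
        ((m ^ 2 * ((1 - 4 * N) - x)) ⋆ kmd≡K ⊞ (- K) ⋆ xm²≡1 ⊞ (- d) ⋆ ym³≡c ⊞ 1 ⋆ slope)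
          (solve₈ (λ m d k N x y K c →
            m ³ :* d :* (k :* (#1 :- #4 :* N :- x) :- (:- (#2 :* N :* (#4 :* N :- #1)) :- :- y))
            := m ² :* (#1 :- #4 :* N :- x) :* (k :* (m :* d) :- K) :+ :- K :* (x :* m ² :- #1)
               :+ :- d :* (y :* m ³ :- c) :+ #1 :* (K :* ((#1 :- #4 :* N) :* m ² :- #1) :- (c :-
               #2 :* N :* (#4 :* N :- #1) :* m ³) :* d)) refl m d k N x y K c)

      U≡ : k ^ 2 - 2 * (2 * N ^ 2 + 2 * N - 1) - x - (1 - 4 * N) ≡ U
      U≡ = cancel-combine (*≢0 (^2≢0 m≢0) (^2≢0 d≢0))
        ((k * (m * d) + K) ⋆ kmd≡K ⊞ (- (d ^ 2)) ⋆ xm²≡1 ⊞ (- (m ^ 2)) ⋆ Ud²≡-μ ⊞ 1 ⋆ U-identity)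
          (solve₈ (λ m d k N x U K μ →
            m ² :* d ² :* (k ² :- #2 :* (#2 :* N ² :+ #2 :* N :- #1) :- x :- (#1 :- #4 :* N) :-
              U)
            := (k :* (m :* d) :+ K) :* (k :* (m :* d) :- K) :+ :- (d ²) :* (x :* m ² :- #1) :+
               :- (m ²) :* (U :* d ² :- :- μ) :+ #1 :* (K ² :- ((#2 :* (#2 :* N ² :+ #2 :* N :-
               #1) :+ (#1 :- #4 :* N)) :* m ² :* d ² :+ d ² :- m ² :* μ))) refl m d k N x U K μ)

      V≡ : k * (x - U) - - y ≡ V
      V≡ = cancel-combine (*≢0 (^3≢0 m≢0) (^3≢0 d≢0))
        ((m ^ 2 * d ^ 2 * (x - U)) ⋆ kmd≡K ⊞ (K * d ^ 2) ⋆ xm²≡1 ⊞ (- (K * m ^ 2)) ⋆ Ud²≡-μ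
         ⊞ (d ^ 3) ⋆ ym³≡c ⊞ (- (m ^ 3)) ⋆ Vd³≡ν ⊞ 1 ⋆ V-identity)
           (solve₁₁ (λ m d k x U y V K μ c ν → m ³ :* d ³ :* (k :* (x :- U) :- :- y :- V)
             := m ² :* d ² :* (x :- U) :* (k :* (m :* d) :- K) :+ K :* d ² :* (x :* m ² :- #1)
                :+ :- (K :* m ²) :* (U :* d ² :- :- μ) :+ d ³ :* (y :* m ³ :- c) :+ :- (m ³) :*
                (V :* d ³ :- ν) :+ #1 :* (K :* d ² :+ K :* m ² :* μ :+ c :* d ³ :- m ³ :* ν))
             refl m d k x U y V K μ c ν)

    P : Point E
    P = affine x y e

    sum : Σ[ e′ ∈ OnCurve E U V ] ⊖ P ⊝ T₆⁺ N ¼<N ≡ affine U V e′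
    sum =
      let i , mdi≡1    = inverse (*≢0 m≢0 d≢0)
          k≡ , U≡ , V≡ = chord {K * i} (kmd≡K mdi≡1)
      in chord-⊕ {E} {x} {(- y)} {1 - 4 * N} {(- (2 * N * (4 * N - 1)))} {K * i} {U} {V}
           _ _ x≢1-4N k≡ U≡ V≡
      where
      kmd≡K : ∀ {i} → m * d * i ≡ 1 → K * i * (m * d) ≡ K
      kmd≡K {i} mdi≡1 = combine (K ⋆ mdi≡1)
        (solve₄ (λ K i m d → K :* i :* (m :* d) :- K
          := K :* (m :* d :* i :- #1)) refl K i m d)

    q : ℚ
    q = (U - 1) * (U + 4 * N - 1)

    -- Comes from `U = - μ / d²`; the resulting sign cancels the one in front of the quotient that
    -- gives the `x` of the triangle.
    qd⁴≡ : q * d ^ 4 ≡ - ((μ + d ^ 2) * ((4 * N - 1) * d ^ 2 - μ))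
    qd⁴≡ = unfolded
      where
      unfolded : (U - 1) * (U + 4 * N - 1) * d ^ 4 ≡ - ((μ + d ^ 2) * ((4 * N - 1) * d ^ 2 - μ))
      unfolded = combine ((U * d ^ 2 - μ + (4 * N - 2) * d ^ 2) ⋆ Ud²≡-μ)
        (solve₄ (λ U N d μ →
          (U :- #1) :* (U :+ #4 :* N :- #1) :* d ⁴ :- :- ((μ :+ d ²) :* ((#4 :* N :- #1) :* d ²
            :- μ))
          := (U :* d ² :- μ :+ (#4 :* N :- #2) :* d ²) :* (U :* d ² :- :- μ)) refl U N d μ)

    q≢0 : q ≢ 0
    q≢0 q≡0 = >0⇒≢0 denominator>0 (lemma q≡0 qd⁴≡)
      where
      lemma : ∀ {q Q} → q ≡ 0 → q * d ^ 4 ≡ - Q → Q ≡ 0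
      lemma {q} {Q} q≡0 eq = combine ((- (d ^ 4)) ⋆ q≡0 ⊞ 1 ⋆ eq)
        (solve₃ (λ Q d q → Q :- #0
          := :- (d ⁴) :* (q :- #0) :+ #1 :* (q :* d ⁴ :- :- Q)) refl Q d q)

    x-formula : ∀ {w} → w * q ≡ 4 * N * (V + 2 * N * U) → (- w) * D ≡ κ
    x-formula {w} wq≡ = lemma denominator>0 wq≡ qd⁴≡ numerator≡ x-identity
      where
      numerator≡ : 4 * N * (V + 2 * N * U) * d ^ 3 ≡ 4 * N * (ν - 2 * N * μ * d)
      numerator≡ = combine ((4 * N) ⋆ Vd³≡ν ⊞ (8 * N ^ 2 * d) ⋆ Ud²≡-μ)
        (solve₆ (λ N V U d ν μ →
          #4 :* N :* (V :+ #2 :* N :* U) :* d ³ :- #4 :* N :* (ν :- #2 :* N :* μ :* d)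
          := #4 :* N :* (V :* d ³ :- ν) :+ #8 :* N ² :* d :* (U :* d ² :- :- μ))
          refl N V U d ν μ)
      lemma : ∀ {q Q n n′} → 0 < Q → w * q ≡ n → q * d ^ 4 ≡ - Q → n * d ^ 3 ≡ n′ →
        n′ * d * D ≡ κ * Q → (- w) * D ≡ κ
      lemma {q} {Q} {n} {n′} Q>0 wq≡n qd⁴≡-Q nd³≡n′ n′dD≡κQ = cancel-combine (>0⇒≢0 Q>0)
        ((- (w * D)) ⋆ qd⁴≡-Q ⊞ (D * d ^ 4) ⋆ wq≡n ⊞ (D * d) ⋆ nd³≡n′ ⊞ 1 ⋆ n′dD≡κQ)
          (solve₈ (λ Q w D κ q d n n′ → Q :* (:- w :* D :- κ)
            := :- (w :* D) :* (q :* d ⁴ :- :- Q) :+ D :* d ⁴ :* (w :* q :- n) :+ D :* d :* (n :*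
               d ³ :- n′) :+ #1 :* (n′ :* d :* D :- κ :* Q)) refl Q w D κ q d n n′)

    leads-to : .(e′ : OnCurve E U V) → LeadsTo N ¼<N (affine U V e′) f g h
    leads-to _ = ≢-nonZero q≢0 ,
      triangle-from (x-formula {((4 * N * (V + 2 * N * U)) ÷ q) {{≢-nonZero q≢0}}} (÷-*-cancel (4 * N * (V + 2 * N * U)) q {{≢-nonZero q≢0}}))

    conclude : ∀ {Q} .{e′ : OnCurve E U V} → Q ≡ affine U V e′ →
      Q HasCoordinates (U , V) × LeadsTo N ¼<N Q f g h
    conclude {e′ = e′} refl = (refl , refl) , leads-to e′

  conclusion : ¬ Torsion (𝓖 E) P → Conclusion ¼<N x y U V f g h
  conclusion ¬torsion =
    ¬Torsion⇒Rank≥1 {E} {P} ¬torsion , P , (refl , refl) , ¬torsion , conclude (proj₂ sum)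

4N-1>0 : ∀ {N} → 1 ÷ 4 < N → 0 < 4 * N - 1
4N-1>0 ¼<N = ℚ.+-monoˡ-< (- 1) (ℚ.*-monoʳ-<-pos 4 ¼<N)

-- The polynomial identities and inequalities of the two families

module _ {m : ℚ} (1<m : 1 < m) where
  private
    n⁺ : ∀ n → .{{ℕ.NonZero n}} → 0 < fromℕ n
    n⁺ (ℕ.suc n) = ℚ.positive⁻¹ (fromℕ (ℕ.suc n))

    m⁺ : 0 < m
    m⁺ = ℚ.positive⁻¹ m {{m>0 1<m}}

    m²⁺ : 0 < m ^ 2
    m²⁺ = m⁺ *⁺ (m⁺ *⁺ n⁺ 1)

    [m-1]⁺ : 0 < m - 1
    [m-1]⁺ = ℚ.+-monoˡ-< (- 1) 1<m

    [m+1]⁺ : 0 < m + 1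
    [m+1]⁺ = m⁺ +⁺ n⁺ 1

    [m²+1]⁺ : 0 < m ^ 2 + 1
    [m²+1]⁺ = m²⁺ +⁺ n⁺ 1

    resp⁺ : ∀ {p q} → 0 < p → p ≡ q → 0 < q
    resp⁺ p>0 refl = p>0

  module Plus (¼<N : 1 ÷ 4 < m ^ 2 + 1) where
    private
      d⁺ : 0 < 2 * m ^ 2 - m + 1
      d⁺ = ℚ.positive⁻¹ (2 * m ^ 2 - m + 1) {{2m²-m+1>0 1<m}}

      d′⁺ : 0 < 2 * m ^ 2 + m + 1
      d′⁺ = n⁺ 2 *⁺ m²⁺ +⁺ m⁺ +⁺ n⁺ 1

      [4m²+3]⁺ : 0 < 4 * m ^ 2 + 3
      [4m²+3]⁺ = n⁺ 4 *⁺ m²⁺ +⁺ n⁺ 3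

      S⁺ : 0 < 4 * m ^ 6 - 8 * m ^ 5 + 11 * m ^ 4 - 2 * m ^ 3 + 8 * m ^ 2 + 2 * m + 1
      -- The squares `(m - 1)²` absorb the two negative terms `- 8 m⁵` and `- 2 m³`.
      S⁺ = resp⁺ {4 * m ^ 2 * m ^ 2 * ((m - 1) * (m - 1)) + m ^ 2 * ((m - 1) * (m - 1))
                  + 6 * m ^ 2 * m ^ 2 + 7 * m ^ 2 + 2 * m + 1}
        (n⁺ 4 *⁺ m²⁺ *⁺ m²⁺ *⁺ ([m-1]⁺ *⁺ [m-1]⁺) +⁺ m²⁺ *⁺ ([m-1]⁺ *⁺ [m-1]⁺)
          +⁺ n⁺ 6 *⁺ m²⁺ *⁺ m²⁺ +⁺ n⁺ 7 *⁺ m²⁺ +⁺ n⁺ 2 *⁺ m⁺ +⁺ n⁺ 1)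
            (solve₁ (λ m →
              #4 :* m ² :* m ² :* ((m :- #1) :* (m :- #1)) :+ m ² :* ((m :- #1) :* (m :- #1)) :+
                #6 :* m ² :* m ² :+ #7 :* m ² :+ #2 :* m :+ #1
              := #4 :* m ⁶ :- #8 :* m ⁵ :+ #11 :* m ⁴ :- #2 :* m ³ :+ #8 :* m ² :+ #2 :* m :+ #1)
              refl m)

      isTriangle : IsTriangle ((m - 1) * (2 * m ^ 2 + m + 1) ^ 2)
                              ((m + 1) * (2 * m ^ 2 - m + 1) ^ 2) (4 * m * (m ^ 2 + 1))
      isTriangle = record
        { f>0   = [m-1]⁺ *⁺ (d′⁺ *⁺ (d′⁺ *⁺ n⁺ 1))
        ; g>0   = [m+1]⁺ *⁺ (d⁺ *⁺ (d⁺ *⁺ n⁺ 1))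
        ; h>0   = n⁺ 4 *⁺ m⁺ *⁺ [m²+1]⁺
        ; f<g+h = <-by-difference {d = 2 * (m + 1) * (2 * m ^ 2 + m + 1)} (n⁺ 2 *⁺ [m+1]⁺ *⁺ d′⁺)
          (solve₁ (λ m →
            (m :+ #1) :* (#2 :* m ² :- m :+ #1) ² :+ #4 :* m :* (m ² :+ #1) :- (m :- #1) :* (#2
              :* m ² :+ m :+ #1) ²
            := #2 :* (m :+ #1) :* (#2 :* m ² :+ m :+ #1)) refl m)
        ; g<h+f = <-by-difference {d = 2 * (m - 1) * (2 * m ^ 2 - m + 1)} (n⁺ 2 *⁺ [m-1]⁺ *⁺ d⁺)
          (solve₁ (λ m →
            #4 :* m :* (m ² :+ #1) :+ (m :- #1) :* (#2 :* m ² :+ m :+ #1) ² :- (m :+ #1) :* (#2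
              :* m ² :- m :+ #1) ²
            := #2 :* (m :- #1) :* (#2 :* m ² :- m :+ #1)) refl m)
        ; h<f+g = <-by-difference {d = 2 * m * ((m - 1) * (m + 1)) * (4 * m ^ 2 + 3)}
                    (n⁺ 2 *⁺ m⁺ *⁺ ([m-1]⁺ *⁺ [m+1]⁺) *⁺ [4m²+3]⁺)
                      (solve₁ (λ m →
                        (m :- #1) :* (#2 :* m ² :+ m :+ #1) ² :+ (m :+ #1) :* (#2 :* m ² :- m :+
                          #1) ² :- #4 :* m :* (m ² :+ #1)
                        := #2 :* m :* ((m :- #1) :* (m :+ #1)) :* (#4 :* m ² :+ #3)) refl m)
        }

      R/r≡N : R/r[ (m - 1) * (2 * m ^ 2 + m + 1) ^ 2 , (m + 1) * (2 * m ^ 2 - m + 1) ^ 2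
                 , 4 * m * (m ^ 2 + 1) ]≡ (m ^ 2 + 1)
      R/r≡N = R/r-criterion
        {(m - 1) * (2 * m ^ 2 + m + 1) ^ 2} {(m + 1) * (2 * m ^ 2 - m + 1) ^ 2} {4 * m * (m ^ 2 + 1)}
        {2 * m * (2 * m ^ 2 - m + 1) * (2 * m ^ 2 + m + 1)} {2 * (m + 1) * (2 * m ^ 2 + m + 1)} {2 * (m - 1) * (2 * m ^ 2 - m + 1)}
        (solve₁ (λ m →
          (m :- #1) :* (#2 :* m ² :+ m :+ #1) ² :+ (m :+ #1) :* (#2 :* m ² :- m :+ #1) ² :+ #4
            :* m :* (m ² :+ #1)
          := #2 :* m :* (#2 :* m ² :- m :+ #1) :* (#2 :* m ² :+ m :+ #1)) refl m)
          (solve₁ (λ m →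
            (m :+ #1) :* (#2 :* m ² :- m :+ #1) ² :+ #4 :* m :* (m ² :+ #1) :- (m :- #1) :* (#2
              :* m ² :+ m :+ #1) ²
            := #2 :* (m :+ #1) :* (#2 :* m ² :+ m :+ #1)) refl m)
          (solve₁ (λ m →
            #4 :* m :* (m ² :+ #1) :+ (m :- #1) :* (#2 :* m ² :+ m :+ #1) ² :- (m :+ #1) :* (#2
              :* m ² :- m :+ #1) ²
            := #2 :* (m :- #1) :* (#2 :* m ² :- m :+ #1)) refl m)
        (n⁺ 2 *⁺ m⁺ *⁺ d⁺ *⁺ d′⁺) (n⁺ 2 *⁺ [m+1]⁺ *⁺ d′⁺) (n⁺ 2 *⁺ [m-1]⁺ *⁺ d⁺)
          (solve₁ (λ m →
            #2 :* ((m :- #1) :* (#2 :* m ² :+ m :+ #1) ²) :* ((m :+ #1) :* (#2 :* m ² :- m :+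
              #1) ²) :* (#4 :* m :* (m ² :+ #1))
            := (m ² :+ #1) :* (#2 :* m :* (#2 :* m ² :- m :+ #1) :* (#2 :* m ² :+ m :+ #1) :*
               (#2 :* (m :+ #1) :* (#2 :* m ² :+ m :+ #1)) :* (#2 :* (m :- #1) :* (#2 :* m ² :-
               m :+ #1)))) refl m)

      triangle-from : ∀ {x} →
        x * (m * (2 * m ^ 2 + m + 1)) ≡ (m + 1) * (2 * m ^ 2 - m + 1) →
        TriangleFrom (m ^ 2 + 1) x ((m - 1) * (2 * m ^ 2 + m + 1) ^ 2)
          ((m + 1) * (2 * m ^ 2 - m + 1) ^ 2) (4 * m * (m ^ 2 + 1))
      triangle-from xD≡κ = Shape.triangle-from
        -- The scale is `s = g / x`, and the equation for `f` then determines `S = D² √B`; the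
        -- positivity of `S` selects the non-negative root.
        {S = 4 * m ^ 6 - 8 * m ^ 5 + 11 * m ^ 4 - 2 * m ^ 3 + 8 * m ^ 2 + 2 * m + 1}
        {m * (2 * m ^ 2 - m + 1) * (2 * m ^ 2 + m + 1)}
        (m⁺ *⁺ d′⁺) ([m+1]⁺ *⁺ d⁺) S⁺ (m⁺ *⁺ d⁺ *⁺ d′⁺) xD≡κ
          (solve₁ (λ m →
            (#4 :* m ⁶ :- #8 :* m ⁵ :+ #11 :* m ⁴ :- #2 :* m ³ :+ #8 :* m ² :+ #2 :* m :+ #1) ²
            := ((m :+ #1) :* (#2 :* m ² :- m :+ #1)) ⁴ :+ #4 :* (#2 :* (m ² :+ #1) :- #1) :* ((m
               :+ #1) :* (#2 :* m ² :- m :+ #1)) ³ :* (m :* (#2 :* m ² :+ m :+ #1)) :+ #4 :* (#4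
               :* (m ² :+ #1) ² :- #2 :* (m ² :+ #1) :+ #1) :* ((m :+ #1) :* (#2 :* m ² :- m :+
               #1)) ² :* (m :* (#2 :* m ² :+ m :+ #1)) ² :- #32 :* (m ² :+ #1) ² :* ((m :+ #1)
               :* (#2 :* m ² :- m :+ #1)) :* (m :* (#2 :* m ² :+ m :+ #1)) ³ :+ #16 :* (m ² :+
               #1) ² :* (m :* (#2 :* m ² :+ m :+ #1)) ⁴) refl m)
          (solve₁ (λ m →
            #2 :* ((m :- #1) :* (#2 :* m ² :+ m :+ #1) ²) :* (m :* (#2 :* m ² :+ m :+ #1)) :*
              ((m :+ #1) :* (#2 :* m ² :- m :+ #1))
            := m :* (#2 :* m ² :- m :+ #1) :* (#2 :* m ² :+ m :+ #1) :* (#4 :* (m ² :+ #1) :* (m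
               :* (#2 :* m ² :+ m :+ #1)) ² :- ((m :+ #1) :* (#2 :* m ² :- m :+ #1)) ² :- #2 :*
               (#2 :* (m ² :+ #1) :- #1) :* ((m :+ #1) :* (#2 :* m ² :- m :+ #1)) :* (m :* (#2
               :* m ² :+ m :+ #1)) :- (#4 :* m ⁶ :- #8 :* m ⁵ :+ #11 :* m ⁴ :- #2 :* m ³ :+ #8
               :* m ² :+ #2 :* m :+ #1))) refl m)
          (solve₁ (λ m → (m :+ #1) :* (#2 :* m ² :- m :+ #1) ² :* (m :* (#2 :* m ² :+ m :+ #1))
            := m :* (#2 :* m ² :- m :+ #1) :* (#2 :* m ² :+ m :+ #1) :* ((m :+ #1) :* (#2 :* m ²
               :- m :+ #1))) refl m)
          (solve₁ (λ m →
            #2 :* (#4 :* m :* (m ² :+ #1)) :* (m :* (#2 :* m ² :+ m :+ #1)) :* ((m :+ #1) :* (#2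
              :* m ² :- m :+ #1))
            := m :* (#2 :* m ² :- m :+ #1) :* (#2 :* m ² :+ m :+ #1) :* (#2 :* (#2 :* (m ² :+
               #1) :+ #1) :* ((m :+ #1) :* (#2 :* m ² :- m :+ #1)) :* (m :* (#2 :* m ² :+ m :+
               #1)) :- ((m :+ #1) :* (#2 :* m ² :- m :+ #1)) ² :- #4 :* (m ² :+ #1) :* (m :* (#2
               :* m ² :+ m :+ #1)) ² :+ (#4 :* m ⁶ :- #8 :* m ⁵ :+ #11 :* m ⁴ :- #2 :* m ³ :+ #8
               :* m ² :+ #2 :* m :+ #1))) refl m) isTriangle R/r≡N

      -- Since `4 N - 1 = 4 m² + 3`, the second factor is `(4 m² + 3) (d² - (m + 1)²)` with
      -- `d = 2 m² - m + 1`, and `d² - (m + 1)² = (2 m² - 2 m) (2 m² + 2)`.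
      denominator⁺ : 0 < ((4 * m ^ 2 + 3) * (m + 1) ^ 2 + (2 * m ^ 2 - m + 1) ^ 2) *
        ((4 * (m ^ 2 + 1) - 1) * (2 * m ^ 2 - m + 1) ^ 2 - (4 * m ^ 2 + 3) * (m + 1) ^ 2)
      denominator⁺ = ([4m²+3]⁺ *⁺ ([m+1]⁺ *⁺ ([m+1]⁺ *⁺ n⁺ 1)) +⁺ d⁺ *⁺ (d⁺ *⁺ n⁺ 1)) *⁺
        resp⁺ {(4 * m ^ 2 + 3) * (4 * m * (m - 1) * (m ^ 2 + 1))}
          ([4m²+3]⁺ *⁺ (n⁺ 4 *⁺ m⁺ *⁺ [m-1]⁺ *⁺ [m²+1]⁺))
            (solve₁ (λ m → (#4 :* m ² :+ #3) :* (#4 :* m :* (m :- #1) :* (m ² :+ #1))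
              := (#4 :* (m ² :+ #1) :- #1) :* (#2 :* m ² :- m :+ #1) ² :- (#4 :* m ² :+ #3) :*
                 (m :+ #1) ²) refl m)

    conclusion : ∀ {x y U V} → x * m ^ 2 ≡ 1 → y * m ^ 3 ≡ 3 * m ^ 2 + 1 →
      U * (2 * m ^ 2 - m + 1) ^ 2 ≡ - ((4 * m ^ 2 + 3) * (m + 1) ^ 2) →
      V * (2 * m ^ 2 - m + 1) ^ 3 ≡
        2 * (m + 1) * (4 * m ^ 2 + 3) * (m ^ 2 + 1) * (2 * m ^ 3 + m ^ 2 + 2 * m - 1) →
      Conclusion ¼<N x y U V
        ((m - 1) * (2 * m ^ 2 + m + 1) ^ 2) ((m + 1) * (2 * m ^ 2 - m + 1) ^ 2) (4 * m * (m ^ 2 + 1))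
    conclusion {x} {y} {U} {V} xm²≡1 ym³≡c Ud²≡-μ Vd³≡ν = Family.conclusion
      -- `(4 N - 1) m² + 1 = 4 m⁴ + 3 m² + 1 = (2 m² - m + 1) (2 m² + m + 1)`. The second factor
      -- also divides the numerator of the chord slope, leaving `d = 2 m² - m + 1` and the cofactor
      -- `K`.
      {K = 4 * m ^ 5 - 2 * m ^ 4 + 6 * m ^ 3 - 2 * m ^ 2 + m - 1}
      ¼<N m⁺ d⁺ (4N-1>0 ¼<N)
        (solve₁ (λ m → (#3 :* m ² :+ #1) ²
          := #1 :+ #2 :* (#2 :* (m ² :+ #1) ² :+ #2 :* (m ² :+ #1) :- #1) :* m ² :+ :- (#4 :* (m
             ² :+ #1) :- #1) :* m ⁴) refl m)
        (solve₁ (λ m →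
          (#4 :* m ⁵ :- #2 :* m ⁴ :+ #6 :* m ³ :- #2 :* m ² :+ m :- #1) :* ((#1 :- #4 :* (m ² :+
            #1)) :* m ² :- #1)
          := (#3 :* m ² :+ #1 :- #2 :* (m ² :+ #1) :* (#4 :* (m ² :+ #1) :- #1) :* m ³) :* (#2
             :* m ² :- m :+ #1)) refl m)
        (solve₁ (λ m → (#4 :* m ⁵ :- #2 :* m ⁴ :+ #6 :* m ³ :- #2 :* m ² :+ m :- #1) ²
          := (#2 :* (#2 :* (m ² :+ #1) ² :+ #2 :* (m ² :+ #1) :- #1) :+ (#1 :- #4 :* (m ² :+
             #1))) :* m ² :* (#2 :* m ² :- m :+ #1) ² :+ (#2 :* m ² :- m :+ #1) ² :- m ² :* ((#4
             :* m ² :+ #3) :* (m :+ #1) ²)) refl m)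
        (solve₁ (λ m →
          (#4 :* m ⁵ :- #2 :* m ⁴ :+ #6 :* m ³ :- #2 :* m ² :+ m :- #1) :* (#2 :* m ² :- m :+
            #1) ² :+ (#4 :* m ⁵ :- #2 :* m ⁴ :+ #6 :* m ³ :- #2 :* m ² :+ m :- #1) :* m ² :*
            ((#4 :* m ² :+ #3) :* (m :+ #1) ²) :+ (#3 :* m ² :+ #1) :* (#2 :* m ² :- m :+ #1) ³
          := m ³ :* (#2 :* (m :+ #1) :* (#4 :* m ² :+ #3) :* (m ² :+ #1) :* (#2 :* m ³ :+ m ² :+
             #2 :* m :- #1))) refl m) denominator⁺
        (solve₁ (λ m →
          #4 :* (m ² :+ #1) :* (#2 :* (m :+ #1) :* (#4 :* m ² :+ #3) :* (m ² :+ #1) :* (#2 :* m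
            ³ :+ m ² :+ #2 :* m :- #1) :- #2 :* (m ² :+ #1) :* ((#4 :* m ² :+ #3) :* (m :+ #1)
            ²) :* (#2 :* m ² :- m :+ #1)) :* (#2 :* m ² :- m :+ #1) :* (m :* (#2 :* m ² :+ m :+
            #1))
          := (m :+ #1) :* (#2 :* m ² :- m :+ #1) :* (((#4 :* m ² :+ #3) :* (m :+ #1) ² :+ (#2 :*
             m ² :- m :+ #1) ²) :* ((#4 :* (m ² :+ #1) :- #1) :* (#2 :* m ² :- m :+ #1) ² :- (#4
             :* m ² :+ #3) :* (m :+ #1) ²))) refl m) triangle-from
      {x} {y} {U} {V} xm²≡1 ym³≡c Ud²≡-μ Vd³≡ν
      (family-nontorsion {σ = 1} {3} ¼<N 1<m refl (ℤ.+ 1 , refl) (ℤ.+ 3 , refl) refl _ xm²≡1 ym³≡c)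

  module Minus (¼<N : 1 ÷ 4 < m ^ 2 - 1) where
    private
      d⁺ : 0 < 2 * m - 1
      d⁺ = ℚ.positive⁻¹ (2 * m - 1) {{2m-1>0 1<m}}

      d′⁺ : 0 < 2 * m + 1
      d′⁺ = n⁺ 2 *⁺ m⁺ +⁺ n⁺ 1

      -- This is `4 N - 1`. For `m > 1` alone it can be negative, so `1/4 < N` is what keeps the
      -- triangle from degenerating.
      [4m²-5]⁺ : 0 < 4 * m ^ 2 - 5
      [4m²-5]⁺ = resp⁺ (4N-1>0 ¼<N)
        (solve₁ (λ m → #4 :* (m ² :- #1) :- #1
          := #4 :* m ² :- #5) refl m)

      S⁺ : 0 < 4 * m ^ 4 - m ^ 2 + 4 * m + 1
      S⁺ = resp⁺ {m ^ 2 * ((m - 1) * (m + 1)) + 3 * m ^ 2 * m ^ 2 + 4 * m + 1}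
        (m²⁺ *⁺ ([m-1]⁺ *⁺ [m+1]⁺) +⁺ n⁺ 3 *⁺ m²⁺ *⁺ m²⁺ +⁺ n⁺ 4 *⁺ m⁺ +⁺ n⁺ 1)
          (solve₁ (λ m → m ² :* ((m :- #1) :* (m :+ #1)) :+ #3 :* m ² :* m ² :+ #4 :* m :+ #1
            := #4 :* m ⁴ :- m ² :+ #4 :* m :+ #1) refl m)

      isTriangle : IsTriangle ((m - 1) * (2 * m + 1) ^ 2) ((m + 1) * (2 * m - 1) ^ 2) (4 * m)
      isTriangle = record
        { f>0   = [m-1]⁺ *⁺ (d′⁺ *⁺ (d′⁺ *⁺ n⁺ 1))
        ; g>0   = [m+1]⁺ *⁺ (d⁺ *⁺ (d⁺ *⁺ n⁺ 1))
        ; h>0   = n⁺ 4 *⁺ m⁺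
        ; f<g+h = <-by-difference {d = 2 * (2 * m + 1)} (n⁺ 2 *⁺ d′⁺)
          (solve₁ (λ m →
            (m :+ #1) :* (#2 :* m :- #1) ² :+ #4 :* m :- (m :- #1) :* (#2 :* m :+ #1) ²
            := #2 :* (#2 :* m :+ #1)) refl m)
        ; g<h+f = <-by-difference {d = 2 * (2 * m - 1)} (n⁺ 2 *⁺ d⁺)
          (solve₁ (λ m →
            #4 :* m :+ (m :- #1) :* (#2 :* m :+ #1) ² :- (m :+ #1) :* (#2 :* m :- #1) ²
            := #2 :* (#2 :* m :- #1)) refl m)
        ; h<f+g = <-by-difference {d = 2 * m * (4 * m ^ 2 - 5)} (n⁺ 2 *⁺ m⁺ *⁺ [4m²-5]⁺)
          (solve₁ (λ m →
            (m :- #1) :* (#2 :* m :+ #1) ² :+ (m :+ #1) :* (#2 :* m :- #1) ² :- #4 :* m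
            := #2 :* m :* (#4 :* m ² :- #5)) refl m)
        }

      R/r≡N : R/r[ (m - 1) * (2 * m + 1) ^ 2 , (m + 1) * (2 * m - 1) ^ 2 , 4 * m ]≡ (m ^ 2 - 1)
      R/r≡N = R/r-criterion
        {(m - 1) * (2 * m + 1) ^ 2} {(m + 1) * (2 * m - 1) ^ 2} {4 * m}
        {2 * m * (2 * m - 1) * (2 * m + 1)} {2 * (2 * m + 1)} {2 * (2 * m - 1)}
        (solve₁ (λ m →
          (m :- #1) :* (#2 :* m :+ #1) ² :+ (m :+ #1) :* (#2 :* m :- #1) ² :+ #4 :* m
          := #2 :* m :* (#2 :* m :- #1) :* (#2 :* m :+ #1)) refl m)
          (solve₁ (λ m →
            (m :+ #1) :* (#2 :* m :- #1) ² :+ #4 :* m :- (m :- #1) :* (#2 :* m :+ #1) ²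
            := #2 :* (#2 :* m :+ #1)) refl m)
          (solve₁ (λ m →
            #4 :* m :+ (m :- #1) :* (#2 :* m :+ #1) ² :- (m :+ #1) :* (#2 :* m :- #1) ²
            := #2 :* (#2 :* m :- #1)) refl m) (n⁺ 2 *⁺ m⁺ *⁺ d⁺ *⁺ d′⁺) (n⁺ 2 *⁺ d′⁺) (n⁺ 2 *⁺ d⁺)
          (solve₁ (λ m →
            #2 :* ((m :- #1) :* (#2 :* m :+ #1) ²) :* ((m :+ #1) :* (#2 :* m :- #1) ²) :* (#4 :*
              m)
            := (m ² :- #1) :* (#2 :* m :* (#2 :* m :- #1) :* (#2 :* m :+ #1) :* (#2 :* (#2 :* m
               :+ #1)) :* (#2 :* (#2 :* m :- #1)))) refl m)

      triangle-from : ∀ {x} → x * (m * (2 * m + 1)) ≡ (m + 1) * (2 * m - 1) →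
        TriangleFrom (m ^ 2 - 1) x
          ((m - 1) * (2 * m + 1) ^ 2) ((m + 1) * (2 * m - 1) ^ 2) (4 * m)
      triangle-from xD≡κ = Shape.triangle-from
        {S = 4 * m ^ 4 - m ^ 2 + 4 * m + 1} {m * (2 * m - 1) * (2 * m + 1)}
        (m⁺ *⁺ d′⁺) ([m+1]⁺ *⁺ d⁺) S⁺ (m⁺ *⁺ d⁺ *⁺ d′⁺) xD≡κ
          (solve₁ (λ m → (#4 :* m ⁴ :- m ² :+ #4 :* m :+ #1) ²
            := ((m :+ #1) :* (#2 :* m :- #1)) ⁴ :+ #4 :* (#2 :* (m ² :- #1) :- #1) :* ((m :+ #1)
               :* (#2 :* m :- #1)) ³ :* (m :* (#2 :* m :+ #1)) :+ #4 :* (#4 :* (m ² :- #1) ² :-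
               #2 :* (m ² :- #1) :+ #1) :* ((m :+ #1) :* (#2 :* m :- #1)) ² :* (m :* (#2 :* m :+
               #1)) ² :- #32 :* (m ² :- #1) ² :* ((m :+ #1) :* (#2 :* m :- #1)) :* (m :* (#2 :*
               m :+ #1)) ³ :+ #16 :* (m ² :- #1) ² :* (m :* (#2 :* m :+ #1)) ⁴) refl m)
          (solve₁ (λ m →
            #2 :* ((m :- #1) :* (#2 :* m :+ #1) ²) :* (m :* (#2 :* m :+ #1)) :* ((m :+ #1) :*
              (#2 :* m :- #1))
            := m :* (#2 :* m :- #1) :* (#2 :* m :+ #1) :* (#4 :* (m ² :- #1) :* (m :* (#2 :* m
               :+ #1)) ² :- ((m :+ #1) :* (#2 :* m :- #1)) ² :- #2 :* (#2 :* (m ² :- #1) :- #1)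
               :* ((m :+ #1) :* (#2 :* m :- #1)) :* (m :* (#2 :* m :+ #1)) :- (#4 :* m ⁴ :- m ²
               :+ #4 :* m :+ #1))) refl m)
          (solve₁ (λ m → (m :+ #1) :* (#2 :* m :- #1) ² :* (m :* (#2 :* m :+ #1))
            := m :* (#2 :* m :- #1) :* (#2 :* m :+ #1) :* ((m :+ #1) :* (#2 :* m :- #1)))
            refl m)
          (solve₁ (λ m →
            #2 :* (#4 :* m) :* (m :* (#2 :* m :+ #1)) :* ((m :+ #1) :* (#2 :* m :- #1))
            := m :* (#2 :* m :- #1) :* (#2 :* m :+ #1) :* (#2 :* (#2 :* (m ² :- #1) :+ #1) :*
               ((m :+ #1) :* (#2 :* m :- #1)) :* (m :* (#2 :* m :+ #1)) :- ((m :+ #1) :* (#2 :*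
               m :- #1)) ² :- #4 :* (m ² :- #1) :* (m :* (#2 :* m :+ #1)) ² :+ (#4 :* m ⁴ :- m ²
               :+ #4 :* m :+ #1))) refl m) isTriangle R/r≡N

      -- Here `4 N - 1 = μ = 4 m² - 5`, and the second factor is `(4 m² - 5) (d² - 1)` with
      -- `d = 2 m - 1`.
      denominator⁺ : 0 < (4 * m ^ 2 - 5 + (2 * m - 1) ^ 2) *
        ((4 * (m ^ 2 - 1) - 1) * (2 * m - 1) ^ 2 - (4 * m ^ 2 - 5))
      denominator⁺ = ([4m²-5]⁺ +⁺ d⁺ *⁺ (d⁺ *⁺ n⁺ 1)) *⁺
        resp⁺ {(4 * m ^ 2 - 5) * (4 * m * (m - 1))} ([4m²-5]⁺ *⁺ (n⁺ 4 *⁺ m⁺ *⁺ [m-1]⁺))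
          (solve₁ (λ m → (#4 :* m ² :- #5) :* (#4 :* m :* (m :- #1))
            := (#4 :* (m ² :- #1) :- #1) :* (#2 :* m :- #1) ² :- (#4 :* m ² :- #5)) refl m)

    conclusion : ∀ {x y U V} → x * m ^ 2 ≡ 1 → y * m ^ 3 ≡ m ^ 2 - 1 →
      U * (2 * m - 1) ^ 2 ≡ - (4 * m ^ 2 - 5) →
      V * (2 * m - 1) ^ 3 ≡ 2 * (m - 1) * (4 * m ^ 2 - 5) * (2 * m ^ 2 + m + 1) →
      Conclusion ¼<N x y U V ((m - 1) * (2 * m + 1) ^ 2) ((m + 1) * (2 * m - 1) ^ 2) (4 * m)
    conclusion {x} {y} {U} {V} xm²≡1 ym³≡c Ud²≡-μ Vd³≡ν = Family.conclusion
      -- `(4 N - 1) m² + 1 = (m² - 1) (2 m - 1) (2 m + 1)`. The numerator of the chord slope is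
      -- divisible by `(m² - 1) (2 m + 1)`, leaving `d = 2 m - 1` and the cofactor `K`.
      {K = 4 * m ^ 4 - 2 * m ^ 3 - 4 * m ^ 2 + 2 * m - 1}
      ¼<N m⁺ d⁺ (4N-1>0 ¼<N)
        (solve₁ (λ m → (m ² :- #1) ²
          := #1 :+ #2 :* (#2 :* (m ² :- #1) ² :+ #2 :* (m ² :- #1) :- #1) :* m ² :+ :- (#4 :* (m
             ² :- #1) :- #1) :* m ⁴) refl m)
        (solve₁ (λ m →
          (#4 :* m ⁴ :- #2 :* m ³ :- #4 :* m ² :+ #2 :* m :- #1) :* ((#1 :- #4 :* (m ² :- #1))
            :* m ² :- #1)
          := (m ² :- #1 :- #2 :* (m ² :- #1) :* (#4 :* (m ² :- #1) :- #1) :* m ³) :* (#2 :* m :-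
             #1)) refl m)
        (solve₁ (λ m → (#4 :* m ⁴ :- #2 :* m ³ :- #4 :* m ² :+ #2 :* m :- #1) ²
          := (#2 :* (#2 :* (m ² :- #1) ² :+ #2 :* (m ² :- #1) :- #1) :+ (#1 :- #4 :* (m ² :-
             #1))) :* m ² :* (#2 :* m :- #1) ² :+ (#2 :* m :- #1) ² :- m ² :* (#4 :* m ² :- #5))
          refl m)
        (solve₁ (λ m →
          (#4 :* m ⁴ :- #2 :* m ³ :- #4 :* m ² :+ #2 :* m :- #1) :* (#2 :* m :- #1) ² :+ (#4 :*
            m ⁴ :- #2 :* m ³ :- #4 :* m ² :+ #2 :* m :- #1) :* m ² :* (#4 :* m ² :- #5) :+ (m ²
            :- #1) :* (#2 :* m :- #1) ³
          := m ³ :* (#2 :* (m :- #1) :* (#4 :* m ² :- #5) :* (#2 :* m ² :+ m :+ #1))) refl m) denominator⁺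
        (solve₁ (λ m →
          #4 :* (m ² :- #1) :* (#2 :* (m :- #1) :* (#4 :* m ² :- #5) :* (#2 :* m ² :+ m :+ #1)
            :- #2 :* (m ² :- #1) :* (#4 :* m ² :- #5) :* (#2 :* m :- #1)) :* (#2 :* m :- #1) :*
            (m :* (#2 :* m :+ #1))
          := (m :+ #1) :* (#2 :* m :- #1) :* ((#4 :* m ² :- #5 :+ (#2 :* m :- #1) ²) :* ((#4 :*
             (m ² :- #1) :- #1) :* (#2 :* m :- #1) ² :- (#4 :* m ² :- #5)))) refl m) triangle-from
      {x} {y} {U} {V} xm²≡1 ym³≡c Ud²≡-μ Vd³≡ν
      (family-nontorsion {σ = - 1} {1} ¼<N 1<m refl (ℤ.- ℤ.+ 1 , refl) (ℤ.+ 1 , refl) refl _ xm²≡1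
        (trans ym³≡c (solve₁ (λ m → m ² :- #1 := #1 :* m ² :- #1) refl m)))

neg-÷-*-cancel : ∀ p q .{{_ : NonZero q}} → (- (p ÷ q)) * q ≡ - p
neg-÷-*-cancel p q = trans (sym (ℚ.neg-distribˡ-* (p ÷ q) q)) (cong -_ (÷-*-cancel p q))

theorem6 : ∀ (N : ℚ) (¼<N : 1 ÷ 4 < N) →
  (∀ (m : ℚ) (1<m : 1 < m) → N ≡ m ^ 2 + 1 →
    let m^≢0 = ^-nonZero m {{m>0 1<m}}
        d    = 2 * m ^ 2 - m + 1
        d^≢0 = ^-nonZero d {{2m²-m+1>0 1<m}}
    in
    Rank≥ (𝓖 (𝓔 N ¼<N)) 1 ×
    (Σ[ P ∈ Point (𝓔 N ¼<N) ]
      P HasCoordinates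
        ( (1 ÷ m ^ 2) {{m^≢0 2}}
        , ((3 * m ^ 2 + 1) ÷ m ^ 3) {{m^≢0 3}} ) ×
      ¬ Torsion (𝓖 (𝓔 N ¼<N)) P ×
      (⊖ P ⊝ T₆⁺ N ¼<N) HasCoordinates
        ( - (((4 * m ^ 2 + 3) * (m + 1) ^ 2) ÷ d ^ 2) {{d^≢0 2}}
        , ((2 * (m + 1) * (4 * m ^ 2 + 3) * (m ^ 2 + 1) * (2 * m ^ 3 + m ^ 2 + 2 * m - 1))
            ÷ d ^ 3) {{d^≢0 3}} ) ×
      LeadsTo N ¼<N (⊖ P ⊝ T₆⁺ N ¼<N)
        ((m - 1) * (2 * m ^ 2 + m + 1) ^ 2)
        ((m + 1) * (2 * m ^ 2 - m + 1) ^ 2)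
        (4 * m * (m ^ 2 + 1))))
  ×
  (∀ (m : ℚ) (1<m : 1 < m) → N ≡ m ^ 2 - 1 →
    let m^≢0 = ^-nonZero m {{m>0 1<m}}
        d    = 2 * m - 1
        d^≢0 = ^-nonZero d {{2m-1>0 1<m}}
    in
    Rank≥ (𝓖 (𝓔 N ¼<N)) 1 ×
    (Σ[ P ∈ Point (𝓔 N ¼<N) ]
      P HasCoordinates
        ( (1 ÷ m ^ 2) {{m^≢0 2}}
        , ((m ^ 2 - 1) ÷ m ^ 3) {{m^≢0 3}} ) ×
      ¬ Torsion (𝓖 (𝓔 N ¼<N)) P ×
      (⊖ P ⊝ T₆⁺ N ¼<N) HasCoordinates
        ( - ((4 * m ^ 2 - 5) ÷ d ^ 2) {{d^≢0 2}}
        , ((2 * (m - 1) * (4 * m ^ 2 - 5) * (2 * m ^ 2 + m + 1)) ÷ d ^ 3) {{d^≢0 3}} ) ×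
      LeadsTo N ¼<N (⊖ P ⊝ T₆⁺ N ¼<N)
        ((m - 1) * (2 * m + 1) ^ 2)
        ((m + 1) * (2 * m - 1) ^ 2)
        (4 * m)))
theorem6 N ¼<N =
  (λ { m 1<m refl →
    let d    = 2 * m ^ 2 - m + 1
        d^≢0 = ^-nonZero d {{2m²-m+1>0 1<m}}
    in Plus.conclusion 1<m ¼<N
      (÷-*-cancel 1 (m ^ 2) {{^-nonZero m {{m>0 1<m}} 2}})
      (÷-*-cancel (3 * m ^ 2 + 1) (m ^ 3) {{^-nonZero m {{m>0 1<m}} 3}})
      (neg-÷-*-cancel ((4 * m ^ 2 + 3) * (m + 1) ^ 2) (d ^ 2) {{d^≢0 2}})
      (÷-*-cancel (2 * (m + 1) * (4 * m ^ 2 + 3) * (m ^ 2 + 1) * (2 * m ^ 3 + m ^ 2 + 2 * m - 1))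
        (d ^ 3) {{d^≢0 3}}) }) ,
  (λ { m 1<m refl →
    let d    = 2 * m - 1
        d^≢0 = ^-nonZero d {{2m-1>0 1<m}}
    in Minus.conclusion 1<m ¼<N
      (÷-*-cancel 1 (m ^ 2) {{^-nonZero m {{m>0 1<m}} 2}})
      (÷-*-cancel (m ^ 2 - 1) (m ^ 3) {{^-nonZero m {{m>0 1<m}} 3}})
      (neg-÷-*-cancel (4 * m ^ 2 - 5) (d ^ 2) {{d^≢0 2}})
      (÷-*-cancel (2 * (m - 1) * (4 * m ^ 2 - 5) * (2 * m ^ 2 + m + 1)) (d ^ 3) {{d^≢0 3}}) })
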